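{- Let $n,r$ be positive integers with $r<n-1$, and let $\alpha(n,r)=(n-r,1^r)$ be the partition $(n-r,1,\dots,1)$ of $n$ with $1$ repeated $r$ times. Let $\mathcal{H}$ be the Iwahori--Hecke algebra of $W_n$ over $\mathbb{Z}[v,v^{ -1}]$ with Kazhdan--Lusztig basis $\{C_x\mid x\in W_n\}$. (a) Let $\Bbbk$ be a unital commutative ring and specialize $v\mapsto 1$, so that $\Bbbk\otimes_{\mathbb{Z}[v,v^{ -1}]}\mathcal{H}\cong \Bbbk[W_n]$. Then the set of images of $\{C_x\mid x\in W_n,\ \mathrm{RSK}(x)\not\trianglerighteq \alpha(n,r)\}$ is a $\Bbbk$-basis of the annihilator in $\Bbbk[W_n]$ of the $\Bbbk[W_n]$-module $V^{\otimes r}$. (b) The set $\{C_x\mid x\in W_n,\ \mathrm{RSK}(x)\not\trianglerighteq\alpha(n,r)\}$ is a $\mathbb{Z}[v,v^{ -1}]$-basis of the annihilator in $\mathcal{H}$ of the left $\mathcal{H}$-module $M^{\alpha(n,r)}$.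
   Context: $W_n$ is the symmetric group on $\{1,\dots,n\}$, $S$ its set of adjacent transpositions, $l$ the length function. $\mathcal{H}$ is the $\mathbb{Z}[v,v^{ -1}]$-algebra ($v$ an indeterminate) with basis $\{T_w\mid w\in W_n\}$, $T_1=1$, and multiplication $T_sT_w=T_{sw}$ if $l(sw)=l(w)+1$ and $T_sT_w=T_{sw}+(v-v^{ -1})T_w$ if $l(sw)=l(w)-1$ ($s\in S$). The bar involution is the ring involution of $\mathcal{H}$ with $\overline{\sum a_wT_w}=\sum \overline{a_w}\,T_{w^{ -1}}^{ -1}$, where $\overline{v}=v^{ -1}$ on $\mathbb{Z}[v,v^{ -1}]$. $C_w$ is the unique element with $\overline{C_w}=C_w$ and $C_w\equiv T_w$ modulo $\sum_{y} v\mathbb{Z}[v]T_y$. Under specialization $v\mapsto 1$ in $\Bbbk$, $T_w\mapsto w$. $M^{\alpha(n,r)}=\mathcal{H}x_{\alpha(n,r)}$ (left ideal, acted on by left multiplication), where $x_{\alpha(n,r)}=\sum_{w\in W_{n-r}} v^{l(w)}T_w$ and $W_{n-r}$ is the subgroup of permutations fixing each of $n-r+1,\dots,n$. $V$ is the free $\Bbbk$-module with basis $v_1,\dots,v_n$, $W_n$ acts by $w\cdot v_j=v_{w(j)}$ and diagonally on $V^{\otimes r}$. $\mathrm{RSK}(x)$ is the common shape of the pair of standard Young tableaux associated to $x$ by the Robinson--Schensted--Knuth correspondence (i.e., the shape of the tableau obtained by row-inserting $x(1),\dots,x(n)$ into an empty tableau). Dominance order: $\lambda\trianglerighteq\mu$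 iff $\sum_{i\le k}\lambda_i\ge\sum_{i\le k}\mu_i$ for all $k$. -}

module Defs where

open import Data.Bool using (Bool; true; false; if_then_else_; _∧_; not)
open import Data.Nat as ℕ using (ℕ; zero; suc; _<ᵇ_; _≡ᵇ_)
open import Data.Integer as ℤ using (ℤ; +_; -[1+_])
open import Data.Fin using (Fin; zero; suc; toℕ)
import Data.Fin as Fin
open import Data.List as List using (List; []; _∷_; _++_; [_]; filterᵇ; concatMap; allFin; replicate; reverse; foldr; foldl; length; take)
open import Data.List.Membership.Propositional using (_∈_)
open import Data.Vec as Vec using (Vec; []; _∷_)
import Data.Vec.Properties as VecP
open import Data.Maybe using (Maybe; just; nothing)
open import Data.Product using (_×_; _,_; Σ; Σ-syntax)
open import Relation.Nullary using (¬_; does)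
open import Relation.Binary.PropositionalEquality using (_≡_)
open import Algebra.Bundles using (CommutativeRing)
import Level

-- Laurent polynomials ℤ[v,v⁻¹]:  mkL low cs  denotes  v^low * Σ_i cs_i v^i

record L : Set where
  constructor mkL
  field
    low : ℤ
    cs  : List ℤ
open L public

lookupOr : ℕ → List ℤ → ℤ
lookupOr _ [] = + 0
lookupOr zero (c ∷ _) = c
lookupOr (suc j) (_ ∷ cs) = lookupOr j cs

coeff : L → ℤ → ℤ
coeff p k with k ℤ.- low p
... | + j = lookupOr j (cs p)
... | -[1+ _ ] = + 0

_≃_ : L → L → Set
p ≃ q = ∀ k → coeff p k ≡ coeff q k

addLists : List ℤ → List ℤ → List ℤ
addLists [] ys = ys
addLists xs [] = xs
addLists (x ∷ xs) (y ∷ ys) = (x ℤ.+ y) ∷ addLists xs ys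

zeroL oneL vL vinvL : L
zeroL = mkL (+ 0) []
oneL = mkL (+ 0) (+ 1 ∷ [])
vL = mkL (+ 1) (+ 1 ∷ [])
vinvL = mkL (-[1+ 0 ]) (+ 1 ∷ [])

vpow : ℕ → L
vpow k = mkL (+ k) (+ 1 ∷ [])

addL : L → L → L
addL p q = mkL m (addLists (pad p) (pad q))
  where
  m = low p ℤ.⊓ low q
  pad : L → List ℤ
  pad r = replicate ℤ.∣ low r ℤ.- m ∣ (+ 0) ++ cs r

negL : L → L
negL p = mkL (low p) (List.map ℤ.-_ (cs p))

conv : List ℤ → List ℤ → List ℤ
conv [] ys = []
conv (x ∷ xs) ys = addLists (List.map (x ℤ.*_) ys) (+ 0 ∷ conv xs ys)

mulL : L → L → L
mulL p q = mkL (low p ℤ.+ low q) (conv (cs p) (cs q))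

barL : L → L
barL p = mkL (ℤ.- (low p ℤ.+ (+ length (cs p) ℤ.- + 1))) (reverse (cs p))

vmv : L
vmv = addL vL (negL vinvL)

ev1 : L → ℤ
ev1 p = foldr ℤ._+_ (+ 0) (cs p)

InVZv : L → Set
InVZv p = ∀ k → k ℤ.≤ + 0 → coeff p k ≡ + 0

-- Permutations of {1..n} (0-indexed as Fin n) in one-line notation:
-- w is the vector (w(1), ..., w(n)).

Perm : ℕ → Set
Perm n = Vec (Fin n) n

allVecs : ∀ {n} k → List (Vec (Fin n) k)
allVecs zero = [ [] ]
allVecs {n} (suc k) = concatMap (λ a → List.map (a ∷_) (allVecs k)) (allFin n)

notInB : ∀ {n k} → Fin n → Vec (Fin n) k → Bool
notInB a [] = true
notInB a (b ∷ bs) = not (does (a Fin.≟ b)) ∧ notInB a bs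

distinctB : ∀ {n k} → Vec (Fin n) k → Bool
distinctB [] = true
distinctB (a ∷ as) = notInB a as ∧ distinctB as

perms : ∀ n → List (Perm n)
perms n = filterᵇ distinctB (allVecs n)

_≟V_ : ∀ {n k} → (u w : Vec (Fin n) k) → _
_≟V_ = VecP.≡-dec Fin._≟_

swapF : ∀ {n} → ℕ → Fin n → Fin n
swapF {suc (suc n)} zero zero = suc zero
swapF {suc (suc n)} zero (suc zero) = zero
swapF {suc (suc n)} zero (suc (suc x)) = suc (suc x)
swapF {suc zero} zero x = x
swapF {suc n} (suc j) zero = zero
swapF {suc n} (suc j) (suc x) = suc (swapF j x)

sL : ∀ {n} → ℕ → Perm n → Perm n
sL j u = Vec.map (swapF j) u

-- right multiplication u ∘ s_j (swap positions j and j+1)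
swapPos : ∀ {A : Set} {k} → ℕ → Vec A k → Vec A k
swapPos zero (a ∷ b ∷ rest) = b ∷ a ∷ rest
swapPos (suc j) (a ∷ rest) = a ∷ swapPos j rest
swapPos _ v = v

countLess : ∀ {n k} → Fin n → Vec (Fin n) k → ℕ
countLess a [] = 0
countLess a (b ∷ bs) = (if toℕ b <ᵇ toℕ a then 1 else 0) ℕ.+ countLess a bs

len : ∀ {n k} → Vec (Fin n) k → ℕ
len [] = 0
len (a ∷ as) = countLess a as ℕ.+ len as

findDesc : ∀ {n k} → Vec (Fin n) k → Maybe ℕ
findDesc (a ∷ b ∷ rest) = if toℕ b <ᵇ toℕ a then just 0 else Data.Maybe.map suc (findDesc (b ∷ rest))
  where import Data.Maybe
findDesc _ = nothing

wordF : ∀ {n} → ℕ → Perm n → List ℕ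
wordF zero w = []
wordF (suc f) w with findDesc w
... | nothing = []
... | just j = wordF f (swapPos j w) ++ [ j ]

-- reduced word [i1,…,ik] with w = s_{i1} ⋯ s_{ik}
redWord : ∀ {n} → Perm n → List ℕ
redWord w = wordF (len w) w

idPerm : ∀ n → Perm n
idPerm n = Vec.allFin n

-- Iwahori–Hecke algebra: h = Σ_{w ∈ W_n} h(w) T_w  (only values on perms n matter)

H : ℕ → Set
H n = Perm n → L

_≈H_ : ∀ {n} → H n → H n → Set
_≈H_ {n} h g = ∀ w → w ∈ perms n → h w ≃ g w

zeroH : ∀ {n} → H n
zeroH _ = zeroL

addH : ∀ {n} → H n → H n → H n
addH h g u = addL (h u) (g u)

scaleH : ∀ {n} → L → H n → H n
scaleH a h u = mulL a (h u)

sumH : ∀ {n} → List (H n) → H n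
sumH = foldr addH zeroH

T : ∀ {n} → Perm n → H n
T w u = if does (u ≟V w) then oneL else zeroL

-- left multiplication by T_{s_j}
Ts : ∀ {n} → ℕ → H n → H n
Ts j h u = addL (h (sL j u)) (if len (sL j u) <ᵇ len u then mulL vmv (h u) else zeroL)

-- left multiplication by T_{s_j}⁻¹ = T_{s_j} - (v - v⁻¹)
Tsinv : ∀ {n} → ℕ → H n → H n
Tsinv j h = addH (Ts j h) (scaleH (negL vmv) h)

Tw⋆ : ∀ {n} → Perm n → H n → H n
Tw⋆ w g = foldr Ts g (redWord w)

mulH : ∀ {n} → H n → H n → H n
mulH {n} h g = sumH (List.map (λ w → scaleH (h w) (Tw⋆ w g)) (perms n))

-- T_{w⁻¹}⁻¹
TinvInv : ∀ {n} → Perm n → H n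
TinvInv {n} w = foldr Tsinv (T (idPerm n)) (redWord w)

barH : ∀ {n} → H n → H n
barH {n} h = sumH (List.map (λ w → scaleH (barL (h w)) (TinvInv w)) (perms n))

IsKL : ∀ {n} → (Perm n → H n) → Set
IsKL {n} C = ∀ w → w ∈ perms n →
  (barH (C w) ≈H C w) × (∀ y → y ∈ perms n → InVZv (addL (C w y) (negL (T w y))))

psum : ℕ → List ℕ → ℕ
psum k l = foldr ℕ._+_ 0 (take k l)

_⊵_ : List ℕ → List ℕ → Set
lam ⊵ mu = ∀ k → psum k mu ℕ.≤ psum k lam

α : ℕ → ℕ → List ℕ
α n r = (n ℕ.∸ r) ∷ replicate r 1

bump : ℕ → List ℕ → Maybe (List ℕ × ℕ)
bump x [] = nothing
bump x (y ∷ ys) with x <ᵇ y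
... | true = just (x ∷ ys , y)
... | false with bump x ys
...   | nothing = nothing
...   | just (ys' , z) = just (y ∷ ys' , z)

rowInsert : ℕ → List (List ℕ) → List (List ℕ)
rowInsert x [] = [ [ x ] ]
rowInsert x (row ∷ rows) with bump x row
... | nothing = (row ++ [ x ]) ∷ rows
... | just (row' , y) = row' ∷ rowInsert y rows

RSK : ∀ {n} → Perm n → List ℕ
RSK w = List.map length (foldl (λ t a → rowInsert (toℕ a) t) [] (Vec.toList w))

-- Part (b): annihilator of M^{α(n,r)} = H x_{α(n,r)}

-- x_{α(n,r)} = Σ_{w ∈ W_{n-r}} v^{l(w)} T_w ; W_{n-r} fixes positions ≥ n-r (0-indexed)
fixesFromB : ∀ {n k} → ℕ → ℕ → Vec (Fin n) k → Bool
fixesFromB m pos [] = true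
fixesFromB m pos (a ∷ as) = (if m ℕ.≤ᵇ pos then toℕ a ≡ᵇ pos else true) ∧ fixesFromB m (suc pos) as

xα : ∀ n r → H n
xα n r = sumH (List.map (λ w → scaleH (vpow (len w)) (T w)) (filterᵇ (fixesFromB (n ℕ.∸ r) 0) (perms n)))

AnnM : ∀ n r → H n → Set
AnnM n r a = ∀ (h : H n) → mulH a (mulH h (xα n r)) ≈H zeroH

combH : ∀ {n} → (Perm n → L) → (Perm n → H n) → H n
combH {n} c b = sumH (List.map (λ x → scaleH (c x) (b x)) (perms n))

PartB : ∀ n r → (Perm n → H n) → Set
PartB n r C =
  (∀ x → x ∈ perms n → ¬ (RSK x ⊵ α n r) → AnnM n r (C x))
  × (∀ (c : Perm n → L) → (∀ x → x ∈ perms n → RSK x ⊵ α n r → c x ≃ zeroL)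
       → combH c C ≈H zeroH → ∀ x → x ∈ perms n → c x ≃ zeroL)
  × (∀ a → AnnM n r a → Σ[ c ∈ (Perm n → L) ]
       ((∀ x → x ∈ perms n → RSK x ⊵ α n r → c x ≃ zeroL) × (a ≈H combH c C)))

module OverRing {c ℓ} (𝕜 : CommutativeRing c ℓ) where
  open CommutativeRing 𝕜

  ιℕ : ℕ → Carrier
  ιℕ zero = 0#
  ιℕ (suc k) = 1# + ιℕ k

  ιℤ : ℤ → Carrier
  ιℤ (+ k) = ιℕ k
  ιℤ (-[1+ k ]) = - ιℕ (suc k)

  -- 𝕜[W_n]: a = Σ_w a(w) w
  KW : ℕ → Set c
  KW n = Perm n → Carrier

  _≈K_ : ∀ {n} → KW n → KW n → Set ℓ
  _≈K_ {n} a b = ∀ w → w ∈ perms n → a w ≈ b w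

  zeroK : ∀ {n} → KW n
  zeroK _ = 0#

  spec : ∀ {n} → H n → KW n
  spec h w = ιℤ (ev1 (h w))

  -- elements of V^{⊗r}: finite 𝕜-linear combinations of v_{j1} ⊗ ⋯ ⊗ v_{jr}
  Tensor : ℕ → ℕ → Set c
  Tensor n r = List (Carrier × Vec (Fin n) r)

  actT : ∀ {n r} → KW n → Tensor n r → Tensor n r
  actT {n} a x = concatMap (λ { (k , f) → List.map (λ w → (a w * k , Vec.map (Vec.lookup w) f)) (perms n) }) x

  coordT : ∀ {n r} → Tensor n r → Vec (Fin n) r → Carrier
  coordT x g = foldr (λ { (k , f) acc → (if does (f ≟V g) then k else 0#) + acc }) 0# x

  AnnV : ∀ n r → KW n → Set (c Level.⊔ ℓ)
  AnnV n r a = ∀ (x : Tensor n r) (g : Vec (Fin n) r) → coordT (actT a x) g ≈ 0#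

  sumK : ∀ {n} → List (KW n) → KW n
  sumK = foldr (λ a b w → a w + b w) zeroK

  combK : ∀ {n} → (Perm n → Carrier) → (Perm n → KW n) → KW n
  combK {n} cf b = sumK (List.map (λ x w → cf x * b x w) (perms n))

  PartA : ∀ n r → (Perm n → H n) → Set (c Level.⊔ ℓ)
  PartA n r C =
    (∀ x → x ∈ perms n → ¬ (RSK x ⊵ α n r) → AnnV n r (spec (C x)))
    × (∀ (cf : Perm n → Carrier) → (∀ x → x ∈ perms n → RSK x ⊵ α n r → cf x ≈ 0#)
         → combK cf (λ x → spec (C x)) ≈K zeroK → ∀ x → x ∈ perms n → cf x ≈ 0#)
    × (∀ a → AnnV n r a → Σ[ cf ∈ (Perm n → Carrier) ]
         ((∀ x → x ∈ perms n → RSK x ⊵ α n r → cf x ≈ 0#) × (a ≈K combK cf (λ x → spec (C x)))))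

{-# OPTIONS --safe #-}
module Submission where

-- Write m = n − r, C_s = T_s − v, and let X be the set of x whose insertion tableau has first row of
-- length ≥ m, i.e. RSK x ⊵ α(n,r).  Only the first row matters, and no cell theory is needed.
--
-- Upper bound.  For x ∈ X choose an increasing subsequence of length m.  At v = 1, summing the
-- coefficients of all w that agree with x outside the chosen positions is a functional vanishing on
-- Ann, and x is the unique shortest such w; hence these functionals, and their v-analogues, are
-- unitriangular with respect to length.
--
-- Lower bound modulo v.  If y has at most m − 2 ascents then C_y T_t = −v⁻¹ C_y along its descending
-- runs, and C_y ∈ Ann by the pigeonhole principle.  Right multiplication by an explicit element of
-- the Hecke algebra of S₃ realises Knuth moves T_y ↦ T_{y*} modulo v, and column insertion connects
-- every y ∉ X to such a word.  Hence every T_y with y ∉ X lifts modulo v to Ann.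
--
-- Both bounds together give C_y ≡ Σ_{x ∈ X} c_x C_x modulo Ann with c_x ∈ vℤ[v]; since Ann is stable
-- under the bar involution, c_x is bar invariant, hence zero, and C_y ∈ Ann.  The functionals
-- survive v = 1, which gives the statement on V^{⊗r}.

open import Defs
open import Data.Nat using (ℕ; _≤_; _<_; _+_)
open import Data.Product using (_×_)
open import Algebra.Bundles using (CommutativeRing)

open import Level using (_⊔_)
import Algebra.Properties.Ring
import Algebra.Solver.Ring
open import Algebra.Solver.Ring.AlmostCommutativeRing using (fromCommutativeRing; _-Raw-AlmostCommutative⟶_)
import Data.Bool as Bool
open import Data.Bool using (Bool; true; false; if_then_else_; _∧_; not)
open import Data.Bool.Properties using (T-≡; T?)
open import Data.Empty using (⊥; ⊥-elim)
open import Data.Fin as F using (Fin; zero; suc; toℕ)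
import Data.Fin.Properties as FP
import Data.Integer as ℤ
import Data.Integer.Properties as ℤP
open import Data.Integer.Tactic.RingSolver using (solve-∀)
open import Data.List as List using (List; []; _∷_; _++_; [_]; foldr; foldl; length; filterᵇ; concat; concatMap; allFin)
open import Data.List.Membership.Propositional using (_∈_)
import Data.List.Membership.Propositional.Properties as MP
import Data.List.Properties as LP
open import Data.List.Relation.Binary.Permutation.Propositional using (_↭_; prep; swap; ↭-sym; ↭⇒↭ₛ) renaming (refl to ↭refl; trans to ↭trans)
import Data.List.Relation.Binary.Permutation.Propositional.Properties as PP
import Data.List.Relation.Binary.Permutation.Setoid.Properties as SP
open import Data.List.Relation.Unary.All as LA using ([]; _∷_)
import Data.List.Relation.Unary.All.Properties as LAP
open import Data.List.Relation.Unary.AllPairs using () renaming ([] to []ᵖ; _∷_ to _∷ᵖ_)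
open import Data.List.Relation.Unary.Any using (here; there)
open import Data.List.Relation.Unary.Unique.Propositional using () renaming (Unique to UniqueL)
open import Data.Maybe using (Maybe; just; nothing)
open import Data.Nat as ℕ using (zero; suc; _∸_; z≤n; s≤s; _<ᵇ_)
open import Data.Nat.ListAction using (sum)
import Data.Nat.Properties as ℕP
open import Data.Product using (_,_; Σ; ∃; proj₁; proj₂)
open import Data.Sum using (_⊎_; inj₁; inj₂; map₂)
open import Data.Vec as V using (Vec; []; _∷_; lookup)
import Data.Vec.Properties as VP
open import Data.Vec.Relation.Unary.All as VA using (All; []; _∷_)
import Data.Vec.Relation.Unary.All.Properties as VAP
open import Data.Vec.Relation.Unary.AllPairs using ([]; _∷_)
open import Data.Vec.Relation.Unary.Unique.Propositional using (Unique)
import Data.Vec.Relation.Unary.Unique.Propositional.Properties as UP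
open import Function using (_∘_; id; Equivalence)
open import Relation.Binary.Construct.Closure.ReflexiveTransitive using (Star; ε; _◅_; _◅◅_; gmap)
open import Relation.Binary.Definitions using (tri<; tri≈; tri>)
open import Relation.Binary.PropositionalEquality hiding ([_]; isEquivalence) renaming (setoid to ≡setoid)
import Relation.Binary.Reasoning.Setoid
open import Relation.Nullary using (¬_; Dec; yes; no; does)
open import Relation.Nullary.Decidable using (dec-true; dec-false; _×-dec_)

-- Two obstacles shape the development. The algebra is given by left multiplication rules only, so
-- associativity and the bar involution have to be produced. Elements are coefficient functions,
-- multiplications by generators from either side are explicit operators, and once these commute
-- (`LR`) a semilinear map is determined by its value at `T1` and by how it transforms one-sided
-- multiplications (`R-ext`, `L-ext`); this yields the required associativity and the
-- multiplicativity of bar. Secondly, ℤ[v,v⁻¹] is not v-adically complete: lifts modulo v improve to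
-- every power of v, but no limit can be taken. The c_x are therefore defined as pairings of C_y
-- with functionals dual to the C_x, and the finite approximations only bound valuations, an element
-- divisible by all powers of v being zero. The module M enters through the functions on which each
-- T_s of S_m acts from the right by v. Right multiplication by x_α scales them by the Poincaré
-- polynomial of S_m, which is regular because its constant term is 1. At v = 1 it becomes m!,
-- possibly zero in 𝕜, so functionals and not this argument are specialised.

true≢false : true ≡ false → ⊥
true≢false ()

false≢true : false ≡ true → ⊥
false≢true ()

<ᵇ-true : ∀ {m n} → m < n → (m <ᵇ n) ≡ true
<ᵇ-true p = Equivalence.to T-≡ (ℕP.<⇒<ᵇ p)

<ᵇ-true⁻ : ∀ {m n} → (m <ᵇ n) ≡ true → m < n
<ᵇ-true⁻ {m} {n} p = ℕP.<ᵇ⇒< m n (Equivalence.from T-≡ p)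

<ᵇ-false⁻ : ∀ {m n} → (m <ᵇ n) ≡ false → n ≤ m
<ᵇ-false⁻ {m} {n} p = ℕP.≮⇒≥ λ q → true≢false (trans (sym (<ᵇ-true q)) p)

<ᵇ-false : ∀ {m n} → n ≤ m → (m <ᵇ n) ≡ false
<ᵇ-false {m} {n} p with m <ᵇ n in eq
... | false = refl
... | true = ⊥-elim (ℕP.<⇒≱ (<ᵇ-true⁻ eq) p)

<ᵇ-not : ∀ {m n} → m ≢ n → (m <ᵇ n) ≡ not (n <ᵇ m)
<ᵇ-not {m} {n} m≢n with ℕP.<-cmp m n
... | tri< p _ _ rewrite <ᵇ-true p | <ᵇ-false (ℕP.<⇒≤ p) = refl
... | tri≈ _ p _ = ⊥-elim (m≢n p)
... | tri> _ _ p rewrite <ᵇ-true p | <ᵇ-false (ℕP.<⇒≤ p) = refl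

infix 4 _<f_
_<f_ : ∀ {n} → Fin n → Fin n → Bool
a <f b = toℕ a <ᵇ toℕ b

-- Permutations as vectors with distinct entries

notInB-sound : ∀ {n k} (a : Fin n) (as : Vec (Fin n) k) → notInB a as ≡ true → All (a ≢_) as
notInB-sound a [] _ = []
notInB-sound a (b ∷ bs) p with a F.≟ b
... | no a≢b = a≢b ∷ notInB-sound a bs p

notInB-complete : ∀ {n k} {a : Fin n} {as : Vec (Fin n) k} → All (a ≢_) as → notInB a as ≡ true
notInB-complete [] = refl
notInB-complete {a = a} {b ∷ _} (p ∷ ps) rewrite dec-false (a F.≟ b) p = notInB-complete ps

distinctB-sound : ∀ {n k} (as : Vec (Fin n) k) → distinctB as ≡ true → Unique as
distinctB-sound [] _ = []
distinctB-sound (a ∷ as) p with notInB a as in eq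
... | true = notInB-sound a as eq ∷ distinctB-sound as p

distinctB-complete : ∀ {n k} {as : Vec (Fin n) k} → Unique as → distinctB as ≡ true
distinctB-complete [] = refl
distinctB-complete (p ∷ ps) rewrite notInB-complete p = distinctB-complete ps

∈-filterᵇ⁻ : ∀ {A : Set} (p : A → Bool) {x xs} → x ∈ filterᵇ p xs → p x ≡ true
∈-filterᵇ⁻ p {x} {xs} q = Equivalence.to T-≡ (proj₂ (MP.∈-filter⁻ (T? ∘ p) {x} {xs} q))

∈-filterᵇ⁺ : ∀ {A : Set} (p : A → Bool) {x xs} → x ∈ xs → p x ≡ true → x ∈ filterᵇ p xs
∈-filterᵇ⁺ p q e = MP.∈-filter⁺ (T? ∘ p) q (Equivalence.from T-≡ e)

∈-allVecs : ∀ {n} k (w : Vec (Fin n) k) → w ∈ allVecs k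
∈-allVecs zero [] = here refl
∈-allVecs (suc k) (a ∷ w) =
  MP.∈-concat⁺′ (MP.∈-map⁺ (a ∷_) (∈-allVecs k w)) (MP.∈-map⁺ _ (MP.∈-allFin a))

perms-unique : ∀ {n} {w : Perm n} → w ∈ perms n → Unique w
perms-unique {n} {w} p = distinctB-sound w (∈-filterᵇ⁻ distinctB {w} {allVecs n} p)

unique-perms : ∀ {n} {w : Perm n} → Unique w → w ∈ perms n
unique-perms {n} {w} u = ∈-filterᵇ⁺ distinctB (∈-allVecs n w) (distinctB-complete u)

idUnique : ∀ n → Unique (idPerm n)
idUnique n = UP.tabulate⁺ id

swapF-invol : ∀ {n} j (x : Fin n) → swapF j (swapF j x) ≡ x
swapF-invol {suc zero} zero zero = refl
swapF-invol {suc (suc n)} zero zero = refl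
swapF-invol {suc (suc n)} zero (suc zero) = refl
swapF-invol {suc (suc n)} zero (suc (suc x)) = refl
swapF-invol {suc zero} (suc j) zero = refl
swapF-invol {suc (suc n)} (suc j) zero = refl
swapF-invol {suc (suc n)} (suc j) (suc x) = cong suc (swapF-invol j x)

swapF-injective : ∀ {n} j {x y : Fin n} → swapF j x ≡ swapF j y → x ≡ y
swapF-injective j {x} {y} e = trans (sym (swapF-invol j x)) (trans (cong (swapF j) e) (swapF-invol j y))

-- Only the values j and j + 1 change their relative order. In that exceptional case every other
-- value is fixed, which lets `descB-sL` identify a whole vector.
swapF-order : ∀ {n} j (a b : Fin n) →
  ((swapF j a <f swapF j b) ≡ (a <f b))
  ⊎ (swapF j a ≡ b × swapF j b ≡ a × (∀ x → x ≢ a → x ≢ b → swapF j x ≡ x))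
swapF-order {suc zero} zero a b = inj₁ refl
swapF-order {suc (suc n)} zero zero zero = inj₁ refl
swapF-order {suc (suc n)} zero zero (suc zero) = inj₂ (refl , refl , λ
  { zero p q → ⊥-elim (p refl) ; (suc zero) p q → ⊥-elim (q refl) ; (suc (suc x)) p q → refl })
swapF-order {suc (suc n)} zero zero (suc (suc b)) = inj₁ refl
swapF-order {suc (suc n)} zero (suc zero) zero = inj₂ (refl , refl , λ
  { zero p q → ⊥-elim (q refl) ; (suc zero) p q → ⊥-elim (p refl) ; (suc (suc x)) p q → refl })
swapF-order {suc (suc n)} zero (suc zero) (suc zero) = inj₁ refl
swapF-order {suc (suc n)} zero (suc zero) (suc (suc b)) = inj₁ refl
swapF-order {suc (suc n)} zero (suc (suc a)) zero = inj₁ refl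
swapF-order {suc (suc n)} zero (suc (suc a)) (suc zero) = inj₁ refl
swapF-order {suc (suc n)} zero (suc (suc a)) (suc (suc b)) = inj₁ refl
swapF-order {suc zero} (suc j) zero zero = inj₁ refl
swapF-order {suc (suc n)} (suc j) zero zero = inj₁ refl
swapF-order {suc (suc n)} (suc j) zero (suc b) = inj₁ refl
swapF-order {suc (suc n)} (suc j) (suc a) zero = inj₁ refl
swapF-order {suc (suc n)} (suc j) (suc a) (suc b) with swapF-order j a b
... | inj₁ e = inj₁ e
... | inj₂ (e , e' , f) = inj₂ (cong suc e , cong suc e' , λ
  { zero p q → refl ; (suc x) p q → cong suc (f x (p ∘ cong suc) (q ∘ cong suc)) })

sL-invol : ∀ {n k} j (u : Vec (Fin n) k) → V.map (swapF j) (V.map (swapF j) u) ≡ u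
sL-invol j [] = refl
sL-invol j (x ∷ u) = cong₂ _∷_ (swapF-invol j x) (sL-invol j u)

sL-unique : ∀ {n k} j {u : Vec (Fin n) k} → Unique u → Unique (V.map (swapF j) u)
sL-unique j = UP.map⁺ (swapF-injective j)

swapPos-invol : ∀ {A : Set} {k} j (u : Vec A k) → swapPos j (swapPos j u) ≡ u
swapPos-invol zero [] = refl
swapPos-invol zero (x ∷ []) = refl
swapPos-invol zero (x ∷ y ∷ u) = refl
swapPos-invol (suc j) [] = refl
swapPos-invol (suc j) (x ∷ u) = cong (x ∷_) (swapPos-invol j u)

swapPos-map : ∀ {A B : Set} {k} (f : A → B) j (u : Vec A k) → V.map f (swapPos j u) ≡ swapPos j (V.map f u)
swapPos-map f zero [] = refl
swapPos-map f zero (x ∷ []) = refl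
swapPos-map f zero (x ∷ y ∷ u) = refl
swapPos-map f (suc j) [] = refl
swapPos-map f (suc j) (x ∷ u) = cong (f x ∷_) (swapPos-map f j u)

swapPos-All : ∀ {A : Set} {P : A → Set} {k} j {u : Vec A k} → All P u → All P (swapPos j u)
swapPos-All zero [] = []
swapPos-All zero (x ∷ []) = x ∷ []
swapPos-All zero (x ∷ y ∷ u) = y ∷ x ∷ u
swapPos-All (suc j) [] = []
swapPos-All (suc j) (x ∷ u) = x ∷ swapPos-All j u

swapPos-unique : ∀ {A : Set} {k} j {u : Vec A k} → Unique u → Unique (swapPos j u)
swapPos-unique zero [] = []
swapPos-unique zero (x ∷ []) = x ∷ []
swapPos-unique zero ((x ∷ xs) ∷ y ∷ u) = ((x ∘ sym) ∷ y) ∷ xs ∷ u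
swapPos-unique (suc j) [] = []
swapPos-unique (suc j) (x ∷ u) = swapPos-All j x ∷ swapPos-unique j u

swapPos-out : ∀ {A : Set} {k} j (u : Vec A k) → k ≤ suc j → swapPos j u ≡ u
swapPos-out zero [] _ = refl
swapPos-out zero (x ∷ []) _ = refl
swapPos-out zero (x ∷ y ∷ u) (s≤s ())
swapPos-out (suc j) [] _ = refl
swapPos-out (suc j) (x ∷ u) (s≤s p) = cong (x ∷_) (swapPos-out j u p)

-- Descents and the inversion count

countLess-swapPos : ∀ {n k} (a : Fin n) j (u : Vec (Fin n) k) → countLess a (swapPos j u) ≡ countLess a u
countLess-swapPos a zero [] = refl
countLess-swapPos a zero (x ∷ []) = refl
countLess-swapPos a zero (x ∷ y ∷ u) = x+[y+z]≡y+[x+z] (if y <f a then 1 else 0) (if x <f a then 1 else 0) _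
  where x+[y+z]≡y+[x+z] : ∀ x y z → x + (y + z) ≡ y + (x + z)
        x+[y+z]≡y+[x+z] x y z = trans (sym (ℕP.+-assoc x y z)) (trans (cong (_+ z) (ℕP.+-comm x y)) (ℕP.+-assoc y x z))
countLess-swapPos a (suc j) [] = refl
countLess-swapPos a (suc j) (x ∷ u) = cong ((if x <f a then 1 else 0) +_) (countLess-swapPos a j u)

descB : ∀ {n k} → ℕ → Vec (Fin n) k → Bool
descB zero (a ∷ b ∷ _) = b <f a
descB (suc j) (_ ∷ u) = descB j u
descB _ _ = false

descB-inRange : ∀ {n k} j (u : Vec (Fin n) k) → descB j u ≡ true → suc j < k
descB-inRange zero (a ∷ b ∷ u) _ = s≤s (s≤s z≤n)
descB-inRange (suc j) (a ∷ u) p = s≤s (descB-inRange j u p)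

len-swapPos-desc : ∀ {n k} j (u : Vec (Fin n) k) → descB j u ≡ true → len u ≡ suc (len (swapPos j u))
len-swapPos-desc zero (a ∷ b ∷ u) p
  rewrite p | <ᵇ-false (ℕP.<⇒≤ (<ᵇ-true⁻ {toℕ b} {toℕ a} p)) =
  cong suc (trans (sym (ℕP.+-assoc (countLess a u) _ _))
     (trans (cong (_+ len u) (ℕP.+-comm (countLess a u) (countLess b u))) (ℕP.+-assoc (countLess b u) _ _)))
len-swapPos-desc (suc j) (a ∷ u) p = trans (cong₂ _+_ (sym (countLess-swapPos a j u)) (len-swapPos-desc j u p)) (ℕP.+-suc _ _)

descB-swapPos : ∀ {n k} j {u : Vec (Fin n) k} → Unique u → suc j < k → descB j (swapPos j u) ≡ not (descB j u)
descB-swapPos zero {a ∷ b ∷ u} ((a≢b ∷ _) ∷ _) _ = <ᵇ-not (a≢b ∘ FP.toℕ-injective)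
descB-swapPos zero {a ∷ []} _ (s≤s ())
descB-swapPos (suc j) {a ∷ u} (_ ∷ p) (s≤s q) = descB-swapPos j p q

len-swapPos-asc : ∀ {n k} j {u : Vec (Fin n) k} → Unique u → suc j < k → descB j u ≡ false → len (swapPos j u) ≡ suc (len u)
len-swapPos-asc j {u} p q e =
  trans (len-swapPos-desc j (swapPos j u) (trans (descB-swapPos j p q) (cong not e))) (cong (suc ∘ len) (swapPos-invol j u))

len-swapPos-<ᵇ : ∀ {n k} j {u : Vec (Fin n) k} → Unique u → (len (swapPos j u) <ᵇ len u) ≡ descB j u
len-swapPos-<ᵇ {k = k} j {u} p with suc j ℕ.<? k | descB j u in eq
... | yes q | true = <ᵇ-true (ℕP.≤-reflexive (sym (len-swapPos-desc j u eq)))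
... | yes q | false = <ᵇ-false (ℕP.≤-trans (ℕP.n≤1+n _) (ℕP.≤-reflexive (sym (len-swapPos-asc j p q eq))))
... | no q | true = ⊥-elim (q (descB-inRange j u eq))
... | no q | false = <ᵇ-false (ℕP.≤-reflexive (cong len (sym (swapPos-out j u (ℕP.≮⇒≥ q)))))

map-fixed : ∀ {A : Set} {k} (f : A → A) {u : Vec A k} → All (λ x → f x ≡ x) u → V.map f u ≡ u
map-fixed f [] = refl
map-fixed f (p ∷ ps) = cong₂ _∷_ p (map-fixed f ps)

-- The descent at j compares two entries, and s_i reverses this comparison only if they are the
-- values i and i + 1; then exchanging the values is the same as exchanging the positions.
descB-sL : ∀ {n k} i j {u : Vec (Fin n) k} → Unique u →
  (descB j (V.map (swapF i) u) ≡ descB j u) ⊎ (V.map (swapF i) u ≡ swapPos j u)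
descB-sL i zero {[]} _ = inj₁ refl
descB-sL i zero {a ∷ []} _ = inj₁ refl
descB-sL i zero {a ∷ b ∷ u} ((_ ∷ a∉) ∷ b∉ ∷ _) with swapF-order i b a
... | inj₁ e = inj₁ e
... | inj₂ (e , e' , f) = inj₂ (cong₂ _∷_ e' (cong₂ _∷_ e
        (map-fixed (swapF i) (VA.map (λ (p , q) → f _ (q ∘ sym) (p ∘ sym)) (VA.zip (a∉ , b∉))))))
descB-sL i (suc j) {[]} _ = inj₁ refl
descB-sL i (suc j) {a ∷ u} (a∉ ∷ p) with descB-sL i j p
... | inj₁ e = inj₁ e
... | inj₂ e with swapF i a F.≟ a
... | yes q = inj₂ (cong₂ _∷_ q e)
-- Here s_i moves the head `a`, so it cannot exchange two entries of the tail; the tail equation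
-- then leaves the comparison at j unchanged.
... | no q = inj₁ (trans (cong (descB j) e) (fixed j e a∉))
  where
  fixed : ∀ {k} j {u : Vec (Fin _) k} → V.map (swapF i) u ≡ swapPos j u → All (a ≢_) u → descB j (swapPos j u) ≡ descB j u
  fixed zero {[]} _ _ = refl
  fixed zero {x ∷ []} _ _ = refl
  fixed zero {x ∷ y ∷ u} e (a≢x ∷ a≢y ∷ _) with swapF-order i x y | VP.∷-injective e
  ... | inj₁ h | e₁ , e₂ rewrite e₁ | VP.∷-injectiveˡ e₂ = sym h
  ... | inj₂ (_ , _ , f) | _ = ⊥-elim (q (f a a≢x a≢y))
  fixed (suc j) {[]} _ _ = refl
  fixed (suc j) {x ∷ u} e (_ ∷ a∉) = fixed j (VP.∷-injectiveʳ e) a∉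

-- Increasing vectors, the identity, and induction along ascents

data Inc {n} : ∀ {k} → ℕ → Vec (Fin n) k → Set where
  [] : ∀ {lo} → Inc lo []
  _∷_ : ∀ {lo k a} {v : Vec (Fin n) k} → lo ≤ toℕ a → Inc (suc (toℕ a)) v → Inc lo (a ∷ v)

inc-bound : ∀ {n k lo} {v : Vec (Fin n) k} → Inc lo v → lo ≤ n → lo + k ≤ n
inc-bound {lo = lo} [] p = ℕP.≤-trans (ℕP.≤-reflexive (ℕP.+-identityʳ lo)) p
inc-bound {k = suc k} {lo} (_∷_ {a = a} q i) _ =
  ℕP.≤-trans (ℕP.≤-reflexive (ℕP.+-suc lo k)) (ℕP.≤-trans (ℕP.+-monoˡ-≤ k (s≤s q)) (inc-bound i (FP.toℕ<n a)))

inc-lookup : ∀ {n k lo} {v : Vec (Fin n) k} → Inc lo v → lo + k ≡ n → ∀ i → toℕ (lookup v i) ≡ lo + toℕ i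
inc-lookup {n} {suc k} {lo} (_∷_ {a = a} {v} q p) e i = go i
  where
  a≡lo : toℕ a ≡ lo
  a≡lo = ℕP.≤-antisym (ℕP.+-cancelʳ-≤ k _ _ (ℕP.≤-pred (ℕP.≤-trans (inc-bound p (FP.toℕ<n a)) (ℕP.≤-reflexive (trans (sym e) (ℕP.+-suc lo k)))))) q
  go : ∀ i → toℕ (lookup (a ∷ v) i) ≡ lo + toℕ i
  go zero = trans a≡lo (sym (ℕP.+-identityʳ lo))
  go (suc i) = trans (inc-lookup p (trans (cong (λ x → suc (x + k)) a≡lo) (trans (sym (ℕP.+-suc lo k)) e)) i)
                     (trans (cong (λ x → suc (x + toℕ i)) a≡lo) (sym (ℕP.+-suc lo (toℕ i))))

lookup-ext : ∀ {A : Set} {k} {u v : Vec A k} → (∀ i → lookup u i ≡ lookup v i) → u ≡ v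
lookup-ext {u = u} {v} f = trans (sym (VP.tabulate∘lookup u)) (trans (VP.tabulate-cong f) (VP.tabulate∘lookup v))

inc-idPerm : ∀ {n} {w : Perm n} → Inc 0 w → w ≡ idPerm n
inc-idPerm {n} p = lookup-ext λ i → FP.toℕ-injective (trans (inc-lookup p refl i) (cong toℕ (sym (VP.lookup-allFin i))))

inc-len : ∀ {n k lo} {v : Vec (Fin n) k} → Inc lo v → len v ≡ 0
inc-len [] = refl
inc-len {v = a ∷ v} (q ∷ p) = cong₂ _+_ (count p ℕP.≤-refl) (inc-len p)
  where
  count : ∀ {n k lo} {a : Fin n} {v : Vec (Fin n) k} → Inc lo v → toℕ a < lo → countLess a v ≡ 0
  count [] _ = refl
  count {a = a} (_∷_ {a = b} q p) r rewrite <ᵇ-false (ℕP.≤-trans (ℕP.<⇒≤ r) q) = count p (ℕP.≤-trans r (ℕP.≤-trans q (ℕP.n≤1+n _)))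

inc-map-suc : ∀ {n k lo} {v : Vec (Fin n) k} → Inc lo v → Inc (suc lo) (V.map suc v)
inc-map-suc [] = []
inc-map-suc (q ∷ p) = s≤s q ∷ inc-map-suc p

allFin-suc : ∀ n → V.tabulate {n = n} F.suc ≡ V.map F.suc (V.allFin n)
allFin-suc n = VP.tabulate-∘ F.suc id

inc-allFin : ∀ n → Inc 0 (V.allFin n)
inc-allFin zero = []
inc-allFin (suc n) = z≤n ∷ subst (Inc 1) (sym (allFin-suc n)) (inc-map-suc (inc-allFin n))

len-idPerm : ∀ n → len (idPerm n) ≡ 0
len-idPerm n = inc-len (inc-allFin n)

findDesc-just : ∀ {n k} (v : Vec (Fin n) k) {j} → findDesc v ≡ just j → descB j v ≡ true
findDesc-just (a ∷ b ∷ v) e with b <f a in eq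
findDesc-just (a ∷ b ∷ v) refl | true = eq
... | false with findDesc (b ∷ v) in eq'
findDesc-just (a ∷ b ∷ v) refl | false | just j = findDesc-just (b ∷ v) eq'

findDesc-nothing : ∀ {n k lo} (a : Fin n) {v : Vec (Fin n) k} → Unique (a ∷ v) → lo ≤ toℕ a → findDesc (a ∷ v) ≡ nothing → Inc lo (a ∷ v)
findDesc-nothing a {[]} _ q _ = q ∷ []
findDesc-nothing a {b ∷ v} ((a≢b ∷ _) ∷ u) q e with b <f a in eq
... | false with findDesc (b ∷ v) in eq'
... | nothing = q ∷ findDesc-nothing b u (ℕP.≤∧≢⇒< (<ᵇ-false⁻ eq) (a≢b ∘ FP.toℕ-injective)) eq'

findDesc-nothing-id : ∀ {n} {w : Perm n} → Unique w → findDesc w ≡ nothing → w ≡ idPerm n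
findDesc-nothing-id {w = []} _ _ = refl
findDesc-nothing-id {w = a ∷ w} u e = inc-idPerm (findDesc-nothing a u z≤n e)

-- Removing a descent shortens a permutation, and one without descents is the identity. Read
-- backwards, every permutation is built from the identity by lengthening right multiplications.
perm-ind : ∀ {n} {q} (Q : Perm n → Set q) → Q (idPerm n) →
  (∀ j w → Unique w → suc j < n → descB j w ≡ false → Q w → Q (swapPos j w)) →
  ∀ {w} → Unique w → Q w
perm-ind {n} Q base step {w} u = go (len w) u refl
  where
  go : ∀ k {w} → Unique w → len w ≡ k → Q w
  go k {w} u e with findDesc w in eq
  ... | nothing = subst Q (sym (findDesc-nothing-id u eq)) base
  go zero {w} u e | just j with () ← trans (sym e) (len-swapPos-desc j w (findDesc-just w eq))
  go (suc k) {w} u e | just j = subst Q (swapPos-invol j w)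
    (step j (swapPos j w) (swapPos-unique j u) r (trans (descB-swapPos j u r) (cong not d))
      (go k (swapPos-unique j u) (ℕP.suc-injective (trans (sym (len-swapPos-desc j w d)) e))))
    where d = findDesc-just w eq
          r = descB-inRange j w d

sL-swapPos : ∀ {n} i j (u : Perm n) → sL i (swapPos j u) ≡ swapPos j (sL i u)
sL-swapPos i j u = swapPos-map (swapF i) j u

sL-idPerm : ∀ {n} j → sL j (idPerm n) ≡ swapPos j (idPerm n)
sL-idPerm {zero} zero = refl
sL-idPerm {zero} (suc j) = refl
sL-idPerm {suc zero} zero = refl
sL-idPerm {suc (suc n)} zero = cong (λ v → suc zero ∷ zero ∷ v) (map-fixed (swapF 0) (VAP.tabulate⁺ λ i → refl))
sL-idPerm {suc zero} (suc j) = cong (zero ∷_) (sym (swapPos-out j [] z≤n))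
sL-idPerm {suc (suc n)} (suc j) = cong (zero ∷_) (begin
  V.map (swapF (suc j)) (V.tabulate suc) ≡⟨ VP.tabulate-∘ (swapF (suc j)) suc ⟨
  V.tabulate (suc ∘ swapF j) ≡⟨ VP.tabulate-∘ suc (swapF j) ⟩
  V.map suc (V.tabulate (swapF j)) ≡⟨ cong (V.map suc) (VP.tabulate-∘ (swapF j) id) ⟩
  V.map suc (sL j (idPerm (suc n))) ≡⟨ cong (V.map suc) (sL-idPerm j) ⟩
  V.map suc (swapPos j (idPerm (suc n))) ≡⟨ swapPos-map suc j _ ⟩
  swapPos j (V.map suc (idPerm (suc n))) ≡⟨ cong (swapPos j) (allFin-suc (suc n)) ⟨
  swapPos j (V.tabulate suc) ∎)
  where open ≡-Reasoning

-- `len` counts pairs of positions and is transparent for right multiplication only. The left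
-- version is carried along `perm-ind`: by `descB-sL`, each new right factor either lengthens both
-- permutations or has the same effect as the left factor.
len-sL : ∀ {n} j → suc j < n → {u : Perm n} → Unique u → (len (sL j u) ≡ suc (len u)) ⊎ (len u ≡ suc (len (sL j u)))
len-sL {n} j r = perm-ind Q base step
  where
  Q : Perm n → Set
  Q u = (len (sL j u) ≡ suc (len u)) ⊎ (len u ≡ suc (len (sL j u)))
  base : Q (idPerm n)
  base rewrite sL-idPerm {n} j with descB j (idPerm n) in eq
  ... | true = inj₂ (len-swapPos-desc j _ eq)
  ... | false = inj₁ (len-swapPos-asc j (idUnique n) r eq)
  step : ∀ i w → Unique w → suc i < n → descB i w ≡ false → Q w → Q (swapPos i w)
  step i w u ri d q with descB-sL j i u
  ... | inj₂ e = inj₂ (trans (len-swapPos-asc i u ri d) (cong (suc ∘ len) (trans (sym (sL-invol j w)) (cong (sL j) e))))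
  ... | inj₁ e rewrite sL-swapPos j i w | len-swapPos-asc i u ri d | len-swapPos-asc i (sL-unique j u) ri (trans e d) with q
  ... | inj₁ p = inj₁ (cong suc p)
  ... | inj₂ p = inj₂ (cong suc p)

swapF-out : ∀ {n} j (x : Fin n) → n ≤ suc j → swapF j x ≡ x
swapF-out {suc zero} zero x _ = refl
swapF-out {suc zero} (suc j) zero _ = refl
swapF-out {suc (suc n)} zero x (s≤s ())
swapF-out {suc (suc n)} (suc j) zero _ = refl
swapF-out {suc (suc n)} (suc j) (suc x) (s≤s p) = cong suc (swapF-out j x p)

sL-out : ∀ {n} j (u : Perm n) → n ≤ suc j → sL j u ≡ u
sL-out j u p = trans (VP.map-cong (λ x → swapF-out j x p) u) (VP.map-id u)

len-sL-≤ : ∀ {n} j {u : Perm n} → Unique u → len (sL j u) ≤ suc (len u)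
len-sL-≤ {n} j {u} p with suc j ℕ.<? n
... | no r = ℕP.≤-trans (ℕP.≤-reflexive (cong len (sL-out j u (ℕP.≮⇒≥ r)))) (ℕP.n≤1+n _)
... | yes r with len-sL j r p
... | inj₁ e = ℕP.≤-reflexive e
... | inj₂ e = ℕP.≤-trans (ℕP.n≤1+n _) (ℕP.≤-trans (ℕP.≤-reflexive (sym e)) (ℕP.n≤1+n _))

sL-asc-desc : ∀ {n} j → suc j < n → {u : Perm n} → Unique u → (len u <ᵇ len (sL j u)) ≡ not (len (sL j u) <ᵇ len u)
sL-asc-desc j r {u} p = <ᵇ-not λ e → case (len-sL j r p) e
  where
  case : (len (sL j u) ≡ suc (len u)) ⊎ (len u ≡ suc (len (sL j u))) → len u ≡ len (sL j u) → ⊥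
  case (inj₁ h) e = ℕP.1+n≢n (trans (sym h) (sym e))
  case (inj₂ h) e = ℕP.1+n≢n (trans (sym h) e)

-- Words in the simple transpositions

InR : ℕ → ℕ → Set
InR n j = suc j < n

prod : ∀ {n} → List ℕ → Perm n
prod {n} ω = foldr sL (idPerm n) ω

act-unique : ∀ {n} ω {z : Perm n} → Unique z → Unique (foldr sL z ω)
act-unique [] p = p
act-unique (j ∷ ω) p = sL-unique j (act-unique ω p)

len-prod : ∀ {n} ω → len (prod {n} ω) ≤ length ω
len-prod {n} [] = ℕP.≤-reflexive (len-idPerm n)
len-prod {n} (j ∷ ω) = ℕP.≤-trans (len-sL-≤ j (act-unique ω (idUnique n))) (s≤s (len-prod ω))

act-lookup : ∀ {n} ω (z : Perm n) → foldr sL z ω ≡ V.map (lookup (prod ω)) z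
act-lookup {n} [] z = sym (trans (VP.map-cong VP.lookup-allFin z) (VP.map-id z))
act-lookup {n} (j ∷ ω) z = begin
  V.map (swapF j) (foldr sL z ω) ≡⟨ cong (V.map (swapF j)) (act-lookup ω z) ⟩
  V.map (swapF j) (V.map (lookup (prod ω)) z) ≡⟨ VP.map-∘ (swapF j) (lookup (prod ω)) z ⟨
  V.map (swapF j ∘ lookup (prod ω)) z ≡⟨ VP.map-cong (λ i → sym (VP.lookup-map i (swapF j) (prod ω))) z ⟩
  V.map (lookup (V.map (swapF j) (prod ω))) z ∎
  where open ≡-Reasoning

act-swapPos : ∀ {n} ω j (z : Perm n) → foldr sL (swapPos j z) ω ≡ swapPos j (foldr sL z ω)
act-swapPos [] j z = refl
act-swapPos (i ∷ ω) j z = trans (cong (sL i) (act-swapPos ω j z)) (sL-swapPos i j _)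

record RedWord {n} (w : Perm n) (ω : List ℕ) : Set where
  field
    isProd : prod ω ≡ w
    length≡ : length ω ≡ len w
    inRange : LA.All (InR n) ω
open RedWord public

wordF-red : ∀ {n} f {w : Perm n} → Unique w → len w ≡ f → RedWord w (wordF f w)
wordF-red {n} zero {w} u e with findDesc w in eq
... | nothing = record { isProd = sym (findDesc-nothing-id u eq) ; length≡ = sym e ; inRange = [] }
... | just j with () ← trans (sym e) (len-swapPos-desc j w (findDesc-just w eq))
wordF-red {n} (suc f) {w} u e with findDesc w in eq
... | nothing with () ← trans (sym (len-idPerm n)) (trans (cong len (sym (findDesc-nothing-id u eq))) e)
... | just j = record
  { isProd = begin
      foldr sL (idPerm n) (ω ++ [ j ]) ≡⟨ LP.foldr-++ sL (idPerm n) ω [ j ] ⟩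
      foldr sL (sL j (idPerm n)) ω ≡⟨ cong (λ z → foldr sL z ω) (sL-idPerm j) ⟩
      foldr sL (swapPos j (idPerm n)) ω ≡⟨ act-swapPos ω j _ ⟩
      swapPos j (prod ω) ≡⟨ cong (swapPos j) (isProd IH) ⟩
      swapPos j (swapPos j w) ≡⟨ swapPos-invol j w ⟩
      w ∎
  ; length≡ = trans (LP.length-++ ω) (trans (ℕP.+-comm (length ω) 1) (trans (cong suc (length≡ IH)) (sym l)))
  ; inRange = LAP.++⁺ (inRange IH) (descB-inRange j w d ∷ [])
  }
  where
  open ≡-Reasoning
  d = findDesc-just w eq
  l = len-swapPos-desc j w d
  ω = wordF f (swapPos j w)
  IH = wordF-red f (swapPos-unique j u) (ℕP.suc-injective (trans (sym l) e))

redWord-red : ∀ {n} {w : Perm n} → Unique w → RedWord w (redWord w)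
redWord-red u = wordF-red _ u refl

-- Reversal, that is, right multiplication by the longest element

countGr : ∀ {n k} → Fin n → Vec (Fin n) k → ℕ
countGr a [] = 0
countGr a (b ∷ bs) = (if a <f b then 1 else 0) + countGr a bs

countLess-∷ʳ : ∀ {n k} (a : Fin n) (v : Vec (Fin n) k) x → countLess a (v V.∷ʳ x) ≡ countLess a (x ∷ v)
countLess-∷ʳ a [] x = refl
countLess-∷ʳ a (b ∷ v) x = trans (cong (B +_) (countLess-∷ʳ a v x))
  (trans (sym (ℕP.+-assoc B X _)) (trans (cong (_+ countLess a v) (ℕP.+-comm B X)) (ℕP.+-assoc X B _)))
  where B = if b <f a then 1 else 0
        X = if x <f a then 1 else 0

countLess-reverse : ∀ {n k} (a : Fin n) (v : Vec (Fin n) k) → countLess a (V.reverse v) ≡ countLess a v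
countLess-reverse a [] = refl
countLess-reverse a (b ∷ v) rewrite VP.reverse-∷ b v =
  trans (countLess-∷ʳ a (V.reverse v) b) (cong ((if b <f a then 1 else 0) +_) (countLess-reverse a v))

countGr-∷ʳ : ∀ {n k} (a : Fin n) (v : Vec (Fin n) k) x → countGr a (v V.∷ʳ x) ≡ countGr a (x ∷ v)
countGr-∷ʳ a [] x = refl
countGr-∷ʳ a (b ∷ v) x = trans (cong (B +_) (countGr-∷ʳ a v x))
  (trans (sym (ℕP.+-assoc B X _)) (trans (cong (_+ countGr a v) (ℕP.+-comm B X)) (ℕP.+-assoc X B _)))
  where B = if a <f b then 1 else 0
        X = if a <f x then 1 else 0

countGr-reverse : ∀ {n k} (a : Fin n) (v : Vec (Fin n) k) → countGr a (V.reverse v) ≡ countGr a v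
countGr-reverse a [] = refl
countGr-reverse a (b ∷ v) rewrite VP.reverse-∷ b v =
  trans (countGr-∷ʳ a (V.reverse v) b) (cong ((if a <f b then 1 else 0) +_) (countGr-reverse a v))

len-∷ʳ : ∀ {n k} (v : Vec (Fin n) k) x → len (v V.∷ʳ x) ≡ countGr x v + len v
len-∷ʳ [] x = refl
len-∷ʳ (a ∷ v) x = begin
  countLess a (v V.∷ʳ x) + len (v V.∷ʳ x) ≡⟨ cong₂ _+_ (countLess-∷ʳ a v x) (len-∷ʳ v x) ⟩
  (X + countLess a v) + (countGr x v + len v) ≡⟨ solve 4 (λ a b c d → (a :+ b) :+ (c :+ d) := (a :+ c) :+ (b :+ d)) refl X (countLess a v) (countGr x v) (len v) ⟩
  (X + countGr x v) + (countLess a v + len v) ∎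
  where open ≡-Reasoning
        open import Data.Nat.Solver using (module +-*-Solver)
        open +-*-Solver
        X = if x <f a then 1 else 0

countLess+countGr : ∀ {n k} {a : Fin n} {v : Vec (Fin n) k} → All (a ≢_) v → countLess a v + countGr a v ≡ k
countLess+countGr [] = refl
countLess+countGr {a = a} {b ∷ v} (p ∷ ps) rewrite <ᵇ-not {toℕ b} {toℕ a} (p ∘ sym ∘ FP.toℕ-injective) with a <f b
... | true = trans (ℕP.+-suc _ _) (cong suc (countLess+countGr ps))
... | false = cong suc (countLess+countGr ps)

-- The number of pairs among k positions, which is the length of the longest element of S_k.
tri : ℕ → ℕ
tri zero = 0
tri (suc k) = k + tri k

-- Each pair of positions is an inversion of exactly one of a vector and its reverse.
len-reverse : ∀ {n k} {v : Vec (Fin n) k} → Unique v → len (V.reverse v) + len v ≡ tri k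
len-reverse [] = refl
len-reverse {k = suc k} {a ∷ v} (p ∷ u) rewrite VP.reverse-∷ a v | len-∷ʳ (V.reverse v) a | countGr-reverse a v = begin
  (countGr a v + len (V.reverse v)) + (countLess a v + len v) ≡⟨ solve 4 (λ a b c d → (a :+ b) :+ (c :+ d) := (c :+ a) :+ (b :+ d)) refl (countGr a v) _ (countLess a v) (len v) ⟩
  (countLess a v + countGr a v) + (len (V.reverse v) + len v) ≡⟨ cong₂ _+_ (countLess+countGr p) (len-reverse u) ⟩
  k + tri k ∎
  where open ≡-Reasoning
        open import Data.Nat.Solver using (module +-*-Solver)
        open +-*-Solver

∷ʳ-All : ∀ {A : Set} {P : A → Set} {k} {v : Vec A k} {x} → All P v → P x → All P (v V.∷ʳ x)
∷ʳ-All [] q = q ∷ []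
∷ʳ-All (p ∷ ps) q = p ∷ ∷ʳ-All ps q

∷ʳ-unique : ∀ {A : Set} {k} {v : Vec A k} {x} → Unique v → All (x ≢_) v → Unique (v V.∷ʳ x)
∷ʳ-unique [] _ = [] ∷ []
∷ʳ-unique (p ∷ u) (q ∷ qs) = ∷ʳ-All p (q ∘ sym) ∷ ∷ʳ-unique u qs

reverse-All : ∀ {A : Set} {P : A → Set} {k} {v : Vec A k} → All P v → All P (V.reverse v)
reverse-All [] = []
reverse-All {v = a ∷ v} (p ∷ ps) rewrite VP.reverse-∷ a v = ∷ʳ-All (reverse-All ps) p

reverse-unique : ∀ {A : Set} {k} {v : Vec A k} → Unique v → Unique (V.reverse v)
reverse-unique [] = []
reverse-unique {v = a ∷ v} (p ∷ u) rewrite VP.reverse-∷ a v = ∷ʳ-unique (reverse-unique u) (reverse-All p)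

-- Left multiplication commutes with reversal, and lengths of a permutation and its reverse have
-- constant sum, so reversal flips the comparison of lengths.
sL-reverse-<ᵇ : ∀ {n} j → suc j < n → {u : Perm n} → Unique u →
  (len (sL j (V.reverse u)) <ᵇ len (V.reverse u)) ≡ not (len (sL j u) <ᵇ len u)
sL-reverse-<ᵇ {n} j r {u} p
  rewrite VP.map-reverse (swapF j) u = trans (flip-< {len (V.reverse (sL j u))} {len (sL j u)} {len (V.reverse u)} {len u} (len-reverse (sL-unique j p)) (len-reverse p)) (sL-asc-desc j r p)
  where
  flip-< : ∀ {a b c d t : ℕ} → a + b ≡ t → c + d ≡ t → (a <ᵇ c) ≡ (d <ᵇ b)
  flip-< {a} {b} {c} {d} e e' with a ℕ.<? c
  ... | yes q = trans (<ᵇ-true q) (sym (<ᵇ-true (ℕP.≰⇒> λ b≤d → ℕP.<-irrefl (trans e (sym e')) (ℕP.+-mono-<-≤ q b≤d))))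
  ... | no q = trans (<ᵇ-false (ℕP.≮⇒≥ q)) (sym (<ᵇ-false (ℕP.≮⇒≥ λ d<b → ℕP.<-irrefl (trans e' (sym e)) (ℕP.+-mono-≤-< (ℕP.≮⇒≥ q) d<b))))

-- Masks with m selected entries (trues) and r others (falses)

data Mask : ℕ → ℕ → ℕ → Set where
  [] : Mask 0 0 0
  tt∷_ : ∀ {m r k} → Mask m r k → Mask (suc m) r (suc k)
  ff∷_ : ∀ {m r k} → Mask m r k → Mask m (suc r) (suc k)

mask-size : ∀ {m r k} → Mask m r k → k ≡ m + r
mask-size [] = refl
mask-size (tt∷ M) = cong suc (mask-size M)
mask-size {m} {suc r} (ff∷ M) = trans (cong suc (mask-size M)) (sym (ℕP.+-suc m r))

trues : ∀ {A : Set} {m r k} → Mask m r k → Vec A k → Vec A m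
trues [] [] = []
trues (tt∷ M) (a ∷ v) = a ∷ trues M v
trues (ff∷ M) (a ∷ v) = trues M v

falses : ∀ {A : Set} {m r k} → Mask m r k → Vec A k → Vec A r
falses [] [] = []
falses (tt∷ M) (a ∷ v) = falses M v
falses (ff∷ M) (a ∷ v) = a ∷ falses M v

trues-map : ∀ {A B : Set} {m r k} (f : A → B) (M : Mask m r k) v → V.map f (trues M v) ≡ trues M (V.map f v)
trues-map f [] [] = refl
trues-map f (tt∷ M) (a ∷ v) = cong (f a ∷_) (trues-map f M v)
trues-map f (ff∷ M) (a ∷ v) = trues-map f M v

falses-map : ∀ {A B : Set} {m r k} (f : A → B) (M : Mask m r k) v → V.map f (falses M v) ≡ falses M (V.map f v)
falses-map f [] [] = refl
falses-map f (tt∷ M) (a ∷ v) = falses-map f M v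
falses-map f (ff∷ M) (a ∷ v) = cong (f a ∷_) (falses-map f M v)

trues-All : ∀ {A : Set} {P : A → Set} {m r k} (M : Mask m r k) {v} → All P v → All P (trues M v)
trues-All [] [] = []
trues-All (tt∷ M) (p ∷ ps) = p ∷ trues-All M ps
trues-All (ff∷ M) (p ∷ ps) = trues-All M ps

falses-All : ∀ {A : Set} {P : A → Set} {m r k} (M : Mask m r k) {v} → All P v → All P (falses M v)
falses-All [] [] = []
falses-All (tt∷ M) (p ∷ ps) = falses-All M ps
falses-All (ff∷ M) (p ∷ ps) = p ∷ falses-All M ps

insert-unique : ∀ {A : Set} {m r} {a : A} (t : Vec A m) {f : Vec A r} → All (a ≢_) t → All (a ≢_) f → Unique (t V.++ f) → Unique (t V.++ (a ∷ f))
insert-unique [] _ q u = q ∷ u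
insert-unique (b ∷ t) (p ∷ ps) q (r ∷ u) =
  VAP.++⁺ (VAP.++ˡ⁻ t r) ((p ∘ sym) ∷ VAP.++ʳ⁻ t r) ∷ insert-unique t ps q u

split-unique : ∀ {A : Set} {m r k} (M : Mask m r k) {v : Vec A k} → Unique v → Unique (trues M v V.++ falses M v)
split-unique [] [] = []
split-unique (tt∷ M) (p ∷ u) = VAP.++⁺ (trues-All M p) (falses-All M p) ∷ split-unique M u
split-unique (ff∷ M) {a ∷ v} (p ∷ u) = insert-unique (trues M v) (trues-All M p) (falses-All M p) (split-unique M u)

-- Minimal length among permutations with prescribed entries outside a mask

swapPos-↭ : ∀ {A : Set} {k} j (u : Vec A k) → V.toList (swapPos j u) ↭ V.toList u
swapPos-↭ zero [] = ↭refl
swapPos-↭ zero (x ∷ []) = ↭refl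
swapPos-↭ zero (x ∷ y ∷ u) = swap y x ↭refl
swapPos-↭ (suc j) [] = ↭refl
swapPos-↭ (suc j) (x ∷ u) = prep x (swapPos-↭ j u)

perm-↭-id : ∀ {n} {w : Perm n} → Unique w → V.toList w ↭ V.toList (idPerm n)
perm-↭-id {n} = perm-ind (λ w → V.toList w ↭ V.toList (idPerm n)) ↭refl λ j w _ _ _ p → ↭trans (swapPos-↭ j w) p

countL : ∀ {n} → Fin n → List (Fin n) → ℕ
countL a [] = 0
countL a (b ∷ bs) = (if b <f a then 1 else 0) + countL a bs

countLess-toList : ∀ {n k} (a : Fin n) (v : Vec (Fin n) k) → countLess a v ≡ countL a (V.toList v)
countLess-toList a [] = refl
countLess-toList a (b ∷ v) = cong ((if b <f a then 1 else 0) +_) (countLess-toList a v)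

countL-↭ : ∀ {n} (a : Fin n) {xs ys} → xs ↭ ys → countL a xs ≡ countL a ys
countL-↭ a ↭refl = refl
countL-↭ a (prep x p) = cong ((if x <f a then 1 else 0) +_) (countL-↭ a p)
countL-↭ a (swap x y p) = trans (sym (ℕP.+-assoc X Y _)) (trans (cong₂ _+_ (ℕP.+-comm X Y) (countL-↭ a p)) (ℕP.+-assoc Y X _))
  where X = if x <f a then 1 else 0
        Y = if y <f a then 1 else 0
countL-↭ a (↭trans p q) = trans (countL-↭ a p) (countL-↭ a q)

countLess-↭ : ∀ {n k l} (a : Fin n) {u : Vec (Fin n) k} {v : Vec (Fin n) l} → V.toList u ↭ V.toList v → countLess a u ≡ countLess a v
countLess-↭ a {u} {v} p = trans (countLess-toList a u) (trans (countL-↭ a p) (sym (countLess-toList a v)))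

toList-Unique : ∀ {A : Set} {k} {v : Vec A k} → Unique v → UniqueL (V.toList v)
toList-Unique [] = []ᵖ
toList-Unique (p ∷ u) = all p ∷ᵖ toList-Unique u
  where
  all : ∀ {A : Set} {P : A → Set} {k} {v : Vec A k} → All P v → LA.All P (V.toList v)
  all [] = []
  all (p ∷ ps) = p ∷ all ps

fromList-Unique : ∀ {A : Set} {k} {v : Vec A k} → UniqueL (V.toList v) → Unique v
fromList-Unique {v = []} _ = []
fromList-Unique {v = a ∷ v} (p ∷ᵖ u) = all v p ∷ fromList-Unique u
  where
  all : ∀ {A : Set} {P : A → Set} {k} (v : Vec A k) → LA.All P (V.toList v) → All P v
  all [] [] = []
  all (x ∷ v) (p ∷ ps) = p ∷ all v ps

Unique-↭ : ∀ {A : Set} {k l} {u : Vec A k} {v : Vec A l} → Unique u → V.toList u ↭ V.toList v → Unique v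
Unique-↭ {A} p q = fromList-Unique (SP.Unique-resp-↭ (≡setoid A) (↭⇒↭ₛ q) (toList-Unique p))

-- With a in front of the first vector and μ in front of the second, this describes the exchange of
-- a leading entry with a later one.
data Replace {A : Set} (μ a : A) : ∀ {k} → Vec A k → Vec A k → Set where
  here : ∀ {k} {v : Vec A k} → Replace μ a (μ ∷ v) (a ∷ v)
  there : ∀ {k b} {u v : Vec A k} → Replace μ a u v → Replace μ a (b ∷ u) (b ∷ v)

replace-↭ : ∀ {A : Set} {μ a : A} {k} {u v : Vec A k} → Replace μ a u v → a ∷ V.toList u ↭ μ ∷ V.toList v
replace-↭ {μ = μ} {a} here = swap a μ ↭refl
replace-↭ {μ = μ} {a} (there {b = b} p) = ↭trans (swap a b ↭refl) (↭trans (prep b (replace-↭ p)) (swap b μ ↭refl))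

≤-if : ∀ {a b c d} → (c ≤ a → d ≤ b) → (if b <ᵇ d then 1 else 0) ≤ (if a <ᵇ c then 1 else 0)
≤-if {a} {b} {c} {d} f with a <ᵇ c in e
... | false rewrite <ᵇ-false (f (<ᵇ-false⁻ e)) = z≤n
... | true with b <ᵇ d
... | true = ℕP.≤-refl
... | false = z≤n

replace-countLess : ∀ {n k} {μ a : Fin n} {u v : Vec (Fin n) k} (b : Fin n) → toℕ μ < toℕ a → Replace μ a u v → countLess b v ≤ countLess b u
replace-countLess {μ = μ} {a} b p (here {v = v}) = ℕP.+-monoˡ-≤ (countLess b v) (≤-if {toℕ μ} {toℕ a} {toℕ b} {toℕ b} λ q → ℕP.≤-trans q (ℕP.<⇒≤ p))
replace-countLess b p (there {b = c} q) = ℕP.+-monoʳ-≤ (if c <f b then 1 else 0) (replace-countLess b p q)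

-- The leading entry a and a later, smaller entry μ change places. The inversion between them
-- disappears, and an entry between them gains none because μ < a.
replace-len : ∀ {n k} {μ a : Fin n} {u v : Vec (Fin n) k} → toℕ μ < toℕ a → Replace μ a u v →
  len (μ ∷ v) < len (a ∷ u)
replace-len {μ = μ} {a} p (here {v = v})
  rewrite <ᵇ-true p | <ᵇ-false (ℕP.<⇒≤ p) = s≤s (ℕP.≤-reflexive (begin
    countLess μ v + (countLess a v + len v) ≡⟨ ℕP.+-assoc (countLess μ v) _ _ ⟨
    (countLess μ v + countLess a v) + len v ≡⟨ cong (_+ len v) (ℕP.+-comm (countLess μ v) _) ⟩
    (countLess a v + countLess μ v) + len v ≡⟨ ℕP.+-assoc (countLess a v) _ _ ⟩
    countLess a v + (countLess μ v + len v) ∎))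
  where open ≡-Reasoning
replace-len {μ = μ} {a} p (there {b = b} {u} {v} q) = begin-strict
  (M + countLess μ v) + (countLess b v + len v) ≡⟨ solve 4 (λ a b c d → (a :+ b) :+ (c :+ d) := a :+ (c :+ (b :+ d))) refl M (countLess μ v) (countLess b v) (len v) ⟩
  M + (countLess b v + (countLess μ v + len v)) <⟨ ℕP.+-mono-≤-< (≤-if {toℕ b} {toℕ b} {toℕ a} {toℕ μ} λ r → ℕP.≤-trans (ℕP.<⇒≤ p) r)
                                                     (ℕP.+-mono-≤-< (replace-countLess b p q) (replace-len p q)) ⟩
  A + (countLess b u + (countLess a u + len u)) ≡⟨ solve 4 (λ a b c d → a :+ (c :+ (b :+ d)) := (a :+ b) :+ (c :+ d)) refl A (countLess a u) (countLess b u) (len u) ⟩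
  (A + countLess a u) + (countLess b u + len u) ∎
  where
  open ℕP.≤-Reasoning
  open import Data.Nat.Solver using (module +-*-Solver)
  open +-*-Solver using (solve; _:+_; _:=_)
  M = if b <f μ then 1 else 0
  A = if b <f a then 1 else 0

∈-split : ∀ {A : Set} {m r k} (M : Mask m r k) (v : Vec A k) {x} → x ∈ V.toList v → x ∈ V.toList (trues M v) ⊎ x ∈ V.toList (falses M v)
∈-split [] [] ()
∈-split (tt∷ M) (a ∷ v) (here p) = inj₁ (here p)
∈-split (ff∷ M) (a ∷ v) (here p) = inj₂ (here p)
∈-split (tt∷ M) (a ∷ v) (there p) with ∈-split M v p
... | inj₁ q = inj₁ (there q)
... | inj₂ q = inj₂ q
∈-split (ff∷ M) (a ∷ v) (there p) with ∈-split M v p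
... | inj₁ q = inj₁ q
... | inj₂ q = inj₂ (there q)

∈-falses : ∀ {A : Set} {m r k} (M : Mask m r k) (v : Vec A k) {x} → x ∈ V.toList (falses M v) → x ∈ V.toList v
∈-falses [] [] ()
∈-falses (tt∷ M) (a ∷ v) p = there (∈-falses M v p)
∈-falses (ff∷ M) (a ∷ v) (here p) = here p
∈-falses (ff∷ M) (a ∷ v) (there p) = there (∈-falses M v p)

replace-true : ∀ {A : Set} {m r k} (M : Mask m r k) (v : Vec A k) {μ} a → μ ∈ V.toList (trues M v) →
  ∃ λ v' → Replace μ a v v' × falses M v' ≡ falses M v
replace-true [] [] a ()
replace-true (tt∷ M) (x ∷ v) a (here refl) = a ∷ v , here , refl
replace-true (tt∷ M) (x ∷ v) a (there p) with replace-true M v a p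
... | v' , q , e = x ∷ v' , there q , e
replace-true (ff∷ M) (x ∷ v) a p with replace-true M v a p
... | v' , q , e = x ∷ v' , there q , cong (x ∷_) e

All-∈ : ∀ {A : Set} {P : A → Set} {k} {v : Vec A k} → All P v → ∀ {x} → x ∈ V.toList v → P x
All-∈ (p ∷ ps) (here refl) = p
All-∈ (p ∷ ps) (there q) = All-∈ ps q

inc-All : ∀ {n k lo} {v : Vec (Fin n) k} → Inc lo v → All (λ x → lo ≤ toℕ x) v
inc-All [] = []
inc-All (p ∷ ps) = p ∷ VA.map (λ q → ℕP.≤-trans p (ℕP.≤-trans (ℕP.n≤1+n _) q)) (inc-All ps)

-- At the first selected place x has the smallest selected value μ. If w has another entry a there,
-- then a > μ and μ sits at a later selected place of w. Exchanging the two shortens w and keeps the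
-- unselected entries, so induction applies to the tail.
min-len : ∀ {n m r k lo} (M : Mask m r k) (x w : Vec (Fin n) k) → Unique x → V.toList x ↭ V.toList w →
  falses M x ≡ falses M w → Inc lo (trues M x) → len x ≤ len w × (len w ≤ len x → w ≡ x)
min-len [] [] [] _ _ _ _ = z≤n , λ _ → refl
min-len (ff∷ M) (a ∷ x) (b ∷ w) (a∉ ∷ u) p e i with VP.∷-injective e
... | refl , e' with min-len M x w u (PP.drop-∷ p) e' i
... | h , h' rewrite countLess-↭ a {x} {w} (PP.drop-∷ p) = ℕP.+-monoʳ-≤ (countLess a w) h , λ q → cong (a ∷_) (h' (ℕP.+-cancelˡ-≤ (countLess a w) _ _ q))
min-len (tt∷ M) (μ ∷ x) (a ∷ w) (μ∉ ∷ u) p e (q ∷ i) with μ F.≟ a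
min-len (tt∷ M) (μ ∷ x) (a ∷ w) (μ∉ ∷ u) p e (q ∷ i) | yes refl with min-len M x w u (PP.drop-∷ p) e i
... | h , h' rewrite countLess-↭ a {x} {w} (PP.drop-∷ p) = ℕP.+-monoʳ-≤ (countLess a w) h , λ q → cong (a ∷_) (h' (ℕP.+-cancelˡ-≤ (countLess a w) _ _ q))
min-len (tt∷ M) (μ ∷ x) (a ∷ w) ux@(μ∉ ∷ u) p e (q ∷ i) | no μ≢a = ℕP.<⇒≤ shorter , λ l → ⊥-elim (ℕP.<⇒≱ shorter l)
  where
  a∉w : a ∈ V.toList w → ⊥
  a∉w r with Unique-↭ {u = μ ∷ x} {v = a ∷ w} ux p
  ... | a∉ ∷ _ = All-∈ a∉ r refl
  μ∈w : μ ∈ V.toList w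
  μ∈w with PP.∈-resp-↭ p (here refl)
  ... | here r = ⊥-elim (μ≢a r)
  ... | there r = r
  μ∈trues : μ ∈ V.toList (trues M w)
  μ∈trues with ∈-split M w μ∈w
  ... | inj₁ r = r
  ... | inj₂ r = ⊥-elim (All-∈ μ∉ (∈-falses M x (subst (λ f → μ ∈ V.toList f) (sym e) r)) refl)
  a∈x : a ∈ V.toList x
  a∈x with PP.∈-resp-↭ (↭-sym p) (here refl)
  ... | here r = ⊥-elim (μ≢a (sym r))
  ... | there r = r
  μ<a : toℕ μ < toℕ a
  μ<a with ∈-split M x a∈x
  ... | inj₁ r = All-∈ (inc-All i) r
  ... | inj₂ r = ⊥-elim (a∉w (∈-falses M w (subst (λ f → a ∈ V.toList f) e r)))
  shorter : len (μ ∷ x) < len (a ∷ w)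
  shorter with replace-true M w a μ∈trues
  ... | w' , rp , e' = ℕP.≤-<-trans
    (ℕP.+-mono-≤ (ℕP.≤-reflexive (countLess-↭ μ {x} {w'} x↭w'))
       (proj₁ (min-len M x w' u x↭w' (trans e (sym e')) i)))
    (replace-len μ<a rp)
    where x↭w' = PP.drop-∷ (↭trans p (replace-↭ rp))

map-injective : ∀ {A B : Set} {f : A → B} → (∀ {x y} → f x ≡ f y → x ≡ y) → ∀ {k} {u v : Vec A k} → V.map f u ≡ V.map f v → u ≡ v
map-injective inj {u = []} {[]} _ = refl
map-injective inj {u = x ∷ u} {y ∷ v} e = cong₂ _∷_ (inj (VP.∷-injectiveˡ e)) (map-injective inj (VP.∷-injectiveʳ e))

open ℤ using (ℤ; +_; -[1+_])

-- Commutative rings: integer coefficients, finite sums, triangular systems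

module RingKit {c ℓ} (R : CommutativeRing c ℓ) where
  open CommutativeRing R renaming (_+_ to _⊕_; _*_ to _⊛_; -_ to ⊖_; refl to ≈refl; sym to ≈sym; trans to ≈trans; zero to zero-laws) hiding (_-_) public
  open Algebra.Properties.Ring ring public using (-‿distribˡ-*; -‿distribʳ-*; -0#≈0#; -‿involutive; -‿+-comm)
  open Relation.Binary.Reasoning.Setoid setoid public using (begin_; step-≈; step-≈-⟩; step-≈-⟨; step-≡; step-≡-⟩; step-≡-⟨; _∎)
  open OverRing R public using (ιℕ; ιℤ)

  ≡⇒≈ : ∀ {x y} → x ≡ y → x ≈ y
  ≡⇒≈ refl = ≈refl

  medial : ∀ a b c d → (a ⊕ b) ⊕ (c ⊕ d) ≈ (a ⊕ c) ⊕ (b ⊕ d)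
  medial a b c d = ≈trans (+-assoc a b _) (≈trans (+-congˡ (≈trans (≈sym (+-assoc b c d)) (≈trans (+-congʳ (+-comm b c)) (+-assoc c b d)))) (≈sym (+-assoc a c _)))

  ιℕ-+ : ∀ m n → ιℕ (m + n) ≈ ιℕ m ⊕ ιℕ n
  ιℕ-+ zero n = ≈sym (+-identityˡ _)
  ιℕ-+ (suc m) n = ≈trans (+-congˡ (ιℕ-+ m n)) (≈sym (+-assoc _ _ _))

  ιℕ-* : ∀ m n → ιℕ (m ℕ.* n) ≈ ιℕ m ⊛ ιℕ n
  ιℕ-* zero n = ≈sym (zeroˡ _)
  ιℕ-* (suc m) n = begin
    ιℕ (n + m ℕ.* n) ≈⟨ ιℕ-+ n (m ℕ.* n) ⟩
    ιℕ n ⊕ ιℕ (m ℕ.* n) ≈⟨ +-cong (≈sym (*-identityˡ _)) (ιℕ-* m n) ⟩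
    1# ⊛ ιℕ n ⊕ ιℕ m ⊛ ιℕ n ≈⟨ distribʳ _ _ _ ⟨
    (1# ⊕ ιℕ m) ⊛ ιℕ n ∎

  ιℤ-⊖ : ∀ m n → ιℤ (m ℤ.⊖ n) ≈ ιℕ m ⊕ ⊖ ιℕ n
  ιℤ-⊖ zero zero = ≈sym (-‿inverseʳ _)
  ιℤ-⊖ zero (suc n) = ≈sym (+-identityˡ _)
  ιℤ-⊖ (suc m) zero = ≈sym (≈trans (+-congˡ -0#≈0#) (+-identityʳ _))
  ιℤ-⊖ (suc m) (suc n) = begin
    ιℤ (suc m ℤ.⊖ suc n) ≡⟨ cong ιℤ (ℤP.[1+m]⊖[1+n]≡m⊖n m n) ⟩
    ιℤ (m ℤ.⊖ n) ≈⟨ ιℤ-⊖ m n ⟩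
    ιℕ m ⊕ ⊖ ιℕ n ≈⟨ +-identityˡ _ ⟨
    0# ⊕ (ιℕ m ⊕ ⊖ ιℕ n) ≈⟨ +-congʳ (-‿inverseʳ 1#) ⟨
    (1# ⊕ ⊖ 1#) ⊕ (ιℕ m ⊕ ⊖ ιℕ n) ≈⟨ medial _ _ _ _ ⟩
    (1# ⊕ ιℕ m) ⊕ (⊖ 1# ⊕ ⊖ ιℕ n) ≈⟨ +-congˡ (-‿+-comm _ _) ⟩
    (1# ⊕ ιℕ m) ⊕ ⊖ (1# ⊕ ιℕ n) ∎

  ιℤ-+ : ∀ x y → ιℤ (x ℤ.+ y) ≈ ιℤ x ⊕ ιℤ y
  ιℤ-+ (+ m) (+ n) = ιℕ-+ m n
  ιℤ-+ (+ m) (-[1+ n ]) = ιℤ-⊖ m (suc n)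
  ιℤ-+ (-[1+ m ]) (+ n) = ≈trans (ιℤ-⊖ n (suc m)) (+-comm _ _)
  ιℤ-+ (-[1+ m ]) (-[1+ n ]) = ≈trans (-‿cong (≈trans (≡⇒≈ (cong (ιℕ ∘ suc) (sym (ℕP.+-suc m n)))) (ιℕ-+ (suc m) (suc n)))) (≈sym (-‿+-comm _ _))

  ιℤ-neg : ∀ x → ιℤ (ℤ.- x) ≈ ⊖ ιℤ x
  ιℤ-neg (+ zero) = ≈sym -0#≈0#
  ιℤ-neg (+ suc n) = ≈refl
  ιℤ-neg (-[1+ n ]) = ≈sym (-‿involutive _)

  ιℕ-*ιℤ : ∀ m y → ιℤ (+ m ℤ.* y) ≈ ιℕ m ⊛ ιℤ y
  ιℕ-*ιℤ m (+ n) = ≈trans (≡⇒≈ (cong ιℤ (sym (ℤP.pos-* m n)))) (ιℕ-* m n)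
  ιℕ-*ιℤ m (-[1+ n ]) = begin
    ιℤ (+ m ℤ.* (ℤ.- (+ suc n))) ≡⟨ cong ιℤ (ℤP.neg-distribʳ-* (+ m) (+ suc n)) ⟨
    ιℤ (ℤ.- (+ m ℤ.* + suc n)) ≈⟨ ιℤ-neg (+ m ℤ.* + suc n) ⟩
    ⊖ ιℤ (+ m ℤ.* + suc n) ≈⟨ -‿cong (ιℕ-*ιℤ m (+ suc n)) ⟩
    ⊖ (ιℕ m ⊛ ιℕ (suc n)) ≈⟨ -‿distribʳ-* _ _ ⟩
    ιℕ m ⊛ ⊖ ιℕ (suc n) ∎

  ιℤ-* : ∀ x y → ιℤ (x ℤ.* y) ≈ ιℤ x ⊛ ιℤ y
  ιℤ-* (+ m) y = ιℕ-*ιℤ m y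
  ιℤ-* (-[1+ m ]) y = begin
    ιℤ ((ℤ.- (+ suc m)) ℤ.* y) ≡⟨ cong ιℤ (ℤP.neg-distribˡ-* (+ suc m) y) ⟨
    ιℤ (ℤ.- (+ suc m ℤ.* y)) ≈⟨ ιℤ-neg (+ suc m ℤ.* y) ⟩
    ⊖ ιℤ (+ suc m ℤ.* y) ≈⟨ -‿cong (ιℕ-*ιℤ (suc m) y) ⟩
    ⊖ (ιℕ (suc m) ⊛ ιℤ y) ≈⟨ -‿distribˡ-* _ _ ⟩
    (⊖ ιℕ (suc m)) ⊛ ιℤ y ∎

  ιℤ-1 : ιℤ (+ 1) ≈ 1#
  ιℤ-1 = +-identityʳ 1#

  ιℤ-≟ : ∀ x y → Maybe (ιℤ x ≈ ιℤ y)
  ιℤ-≟ x y with x ℤ.≟ y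
  ... | yes refl = just ≈refl
  ... | no _ = nothing

  -- Integer coefficients give the ring solver a coefficient ring with decidable equality, which R
  -- itself may not have.
  ιℤ-hom : CommutativeRing.rawRing ℤP.+-*-commutativeRing -Raw-AlmostCommutative⟶ fromCommutativeRing R
  ιℤ-hom = record { ⟦_⟧ = ιℤ ; +-homo = ιℤ-+ ; *-homo = ιℤ-* ; -‿homo = ιℤ-neg ; 0-homo = ≈refl ; 1-homo = ιℤ-1 }

  module Solver = Algebra.Solver.Ring (CommutativeRing.rawRing ℤP.+-*-commutativeRing) (fromCommutativeRing R) ιℤ-hom ιℤ-≟

  -- Finite sums

  Σ[_] : ∀ {A : Set} → List A → (A → Carrier) → Carrier
  Σ[ xs ] f = foldr (λ x acc → f x ⊕ acc) 0# xs

  Σ-cong : ∀ {A : Set} {xs : List A} {f g} → (∀ x → x ∈ xs → f x ≈ g x) → Σ[ xs ] f ≈ Σ[ xs ] g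
  Σ-cong {xs = []} _ = ≈refl
  Σ-cong {xs = x ∷ xs} h = +-cong (h x (here refl)) (Σ-cong λ y p → h y (there p))

  Σ-0 : ∀ {A : Set} {xs : List A} {f} → (∀ x → x ∈ xs → f x ≈ 0#) → Σ[ xs ] f ≈ 0#
  Σ-0 {xs = []} _ = ≈refl
  Σ-0 {xs = x ∷ xs} h = ≈trans (+-cong (h x (here refl)) (Σ-0 λ y p → h y (there p))) (+-identityˡ _)

  Σ-+ : ∀ {A : Set} (xs : List A) f g → Σ[ xs ] (λ x → f x ⊕ g x) ≈ Σ[ xs ] f ⊕ Σ[ xs ] g
  Σ-+ [] f g = ≈sym (+-identityˡ _)
  Σ-+ (x ∷ xs) f g = ≈trans (+-congˡ (Σ-+ xs f g)) (medial _ _ _ _)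

  Σ-*ˡ : ∀ {A : Set} (xs : List A) k f → Σ[ xs ] (λ x → k ⊛ f x) ≈ k ⊛ Σ[ xs ] f
  Σ-*ˡ [] k f = ≈sym (zeroʳ _)
  Σ-*ˡ (x ∷ xs) k f = ≈trans (+-congˡ (Σ-*ˡ xs k f)) (≈sym (distribˡ _ _ _))

  Σ-*ʳ : ∀ {A : Set} (xs : List A) k f → Σ[ xs ] (λ x → f x ⊛ k) ≈ Σ[ xs ] f ⊛ k
  Σ-*ʳ [] k f = ≈sym (zeroˡ _)
  Σ-*ʳ (x ∷ xs) k f = ≈trans (+-congˡ (Σ-*ʳ xs k f)) (≈sym (distribʳ _ _ _))

  Σ-swap : ∀ {A B : Set} (xs : List A) (ys : List B) (f : A → B → Carrier) → Σ[ xs ] (λ x → Σ[ ys ] (f x)) ≈ Σ[ ys ] (λ y → Σ[ xs ] (λ x → f x y))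
  Σ-swap [] ys f = ≈sym (Σ-0 {xs = ys} λ _ _ → ≈refl)
  Σ-swap (x ∷ xs) ys f = ≈trans (+-congˡ (Σ-swap xs ys f)) (≈sym (Σ-+ ys (f x) _))

  Σ-++ : ∀ {A : Set} (xs ys : List A) f → Σ[ xs ++ ys ] f ≈ Σ[ xs ] f ⊕ Σ[ ys ] f
  Σ-++ [] ys f = ≈sym (+-identityˡ _)
  Σ-++ (x ∷ xs) ys f = ≈trans (+-congˡ (Σ-++ xs ys f)) (≈sym (+-assoc _ _ _))

  Σ-map : ∀ {A B : Set} (g : A → B) (xs : List A) f → Σ[ List.map g xs ] f ≡ Σ[ xs ] (f ∘ g)
  Σ-map g [] f = refl
  Σ-map g (x ∷ xs) f = cong (f (g x) ⊕_) (Σ-map g xs f)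

  Σ-concatMap : ∀ {A B : Set} (g : A → List B) (xs : List A) f → Σ[ concatMap g xs ] f ≈ Σ[ xs ] (λ x → Σ[ g x ] f)
  Σ-concatMap g [] f = ≈refl
  Σ-concatMap g (x ∷ xs) f = ≈trans (Σ-++ (g x) (concatMap g xs) f) (+-congˡ (Σ-concatMap g xs f))

  Σ-filterᵇ : ∀ {A : Set} (p : A → Bool) (xs : List A) f → Σ[ filterᵇ p xs ] f ≈ Σ[ xs ] (λ x → if p x then f x else 0#)
  Σ-filterᵇ p [] f = ≈refl
  Σ-filterᵇ p (x ∷ xs) f with p x
  ... | true = +-congˡ (Σ-filterᵇ p xs f)
  ... | false = ≈trans (Σ-filterᵇ p xs f) (≈sym (+-identityˡ _))

  Σ-allFin-single : ∀ {n} (a : Fin n) f → (∀ b → b ≢ a → f b ≈ 0#) → Σ[ allFin n ] f ≈ f a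
  Σ-allFin-single {suc n} a f h rewrite sym (LP.map-tabulate {n = n} id F.suc) | Σ-map F.suc (allFin n) f = go a h
    where

    go : ∀ a → (∀ b → b ≢ a → f b ≈ 0#) → f zero ⊕ Σ[ allFin n ] (f ∘ suc) ≈ f a
    go zero h = ≈trans (+-congˡ (Σ-0 {xs = allFin n} λ b _ → h (suc b) λ ())) (+-identityʳ _)
    go (suc a) h = ≈trans (+-cong (h zero λ ()) (Σ-allFin-single a (f ∘ suc) λ b q → h (suc b) (q ∘ FP.suc-injective))) (+-identityˡ _)

  Σ-allVecs-single : ∀ {n} k (u : Vec (Fin n) k) f → (∀ w → w ≢ u → f w ≈ 0#) → Σ[ allVecs k ] f ≈ f u
  Σ-allVecs-single zero [] f h = +-identityʳ _
  Σ-allVecs-single {n} (suc k) (a ∷ u) f h = begin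
    Σ[ allVecs (suc k) ] f ≈⟨ Σ-concatMap (λ b → List.map (b ∷_) (allVecs k)) (allFin n) f ⟩
    Σ[ allFin n ] (λ b → Σ[ List.map (b ∷_) (allVecs k) ] f) ≈⟨ Σ-cong {xs = allFin n} (λ b _ → ≡⇒≈ (Σ-map (b ∷_) (allVecs k) f)) ⟩
    Σ[ allFin n ] (λ b → Σ[ allVecs k ] (f ∘ (b ∷_))) ≈⟨ Σ-allFin-single a _ (λ b q → Σ-0 {xs = allVecs k} λ w _ → h (b ∷ w) (q ∘ VP.∷-injectiveˡ)) ⟩
    Σ[ allVecs k ] (f ∘ (a ∷_)) ≈⟨ Σ-allVecs-single k u _ (λ w q → h (a ∷ w) (q ∘ VP.∷-injectiveʳ)) ⟩
    f (a ∷ u) ∎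

  Σ-perms-single : ∀ {n} {u : Perm n} → u ∈ perms n → ∀ f → (∀ w → w ∈ perms n → w ≢ u → f w ≈ 0#) → Σ[ perms n ] f ≈ f u
  Σ-perms-single {n} {u} p f h = ≈trans (Σ-filterᵇ distinctB (allVecs n) f)
    (≈trans (Σ-allVecs-single n u _ other) self)
    where
    other : ∀ w → w ≢ u → (if distinctB w then f w else 0#) ≈ 0#
    other w q with distinctB w in e
    ... | true = h w (unique-perms (distinctB-sound w e)) q
    ... | false = ≈refl
    self : (if distinctB u then f u else 0#) ≈ f u
    self rewrite distinctB-complete (perms-unique p) = ≈refl

  -- Unitriangular systems

  module Triangular {n} (N : ℕ) (rank : Perm n → ℕ) (rank< : ∀ {u} → u ∈ perms n → rank u < N) (M : Perm n → Perm n → Carrier)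
    (diag : ∀ {u} → u ∈ perms n → M u u ≈ 1#)
    (off : ∀ {w u} → w ∈ perms n → u ∈ perms n → w ≢ u → rank w ≤ rank u → M w u ≈ 0#) where

    -- Back substitution from the top rank down. At stage k the equations of rank at least N - k
    -- hold. The next correction `e` lives on the single rank N - k - 1, where the matrix is the
    -- identity, and cannot disturb equations of higher rank.
    solvable-from : ∀ k (b : Perm n → Carrier) → ∃ λ (c : Perm n → Carrier) →
      ∀ u → u ∈ perms n → N ≤ rank u + k → Σ[ perms n ] (λ w → c w ⊛ M w u) ≈ b u
    solvable-from zero b = (λ _ → 0#) , λ u p q → ⊥-elim (ℕP.<⇒≱ (rank< p) (ℕP.≤-trans q (ℕP.≤-reflexive (ℕP.+-identityʳ _))))
    solvable-from (suc k) b with solvable-from k b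
    ... | c , h = (λ w → c w ⊕ e w) , eq
      where
      S : Perm n → Carrier
      S u = Σ[ perms n ] (λ w → c w ⊛ M w u)
      e : Perm n → Carrier
      e w = if does (rank w + suc k ℕ.≟ N) then b w ⊕ ⊖ S w else 0#
      split : ∀ u → Σ[ perms n ] (λ w → (c w ⊕ e w) ⊛ M w u) ≈ S u ⊕ Σ[ perms n ] (λ w → e w ⊛ M w u)
      split u = ≈trans (Σ-cong {xs = perms n} λ w _ → distribʳ _ _ _) (Σ-+ (perms n) _ _)
      e-0 : ∀ {w} → rank w + suc k ≢ N → e w ≈ 0#
      e-0 {w} q rewrite dec-false (rank w + suc k ℕ.≟ N) q = ≈refl
      e-1 : ∀ {w} → rank w + suc k ≡ N → e w ≈ b w ⊕ ⊖ S w
      e-1 {w} q rewrite dec-true (rank w + suc k ℕ.≟ N) q = ≈refl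
      eq : ∀ u → u ∈ perms n → N ≤ rank u + suc k → Σ[ perms n ] (λ w → (c w ⊕ e w) ⊛ M w u) ≈ b u
      eq u p q with rank u + suc k ℕ.≟ N
      ... | yes r = begin
        _ ≈⟨ split u ⟩
        S u ⊕ Σ[ perms n ] (λ w → e w ⊛ M w u) ≈⟨ +-congˡ (Σ-perms-single p _ other) ⟩
        S u ⊕ e u ⊛ M u u ≈⟨ +-congˡ (*-cong (e-1 r) (diag p)) ⟩
        S u ⊕ (b u ⊕ ⊖ S u) ⊛ 1# ≈⟨ +-congˡ (*-identityʳ _) ⟩
        S u ⊕ (b u ⊕ ⊖ S u) ≈⟨ solve 2 (λ s b → s :+ (b :- s) := b) ≈refl (S u) (b u) ⟩
        b u ∎
        where
        open Solver using (solve; _:+_; _:-_; _:=_)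
        other : ∀ w → w ∈ perms n → w ≢ u → e w ⊛ M w u ≈ 0#
        other w pw w≢u with rank w + suc k ℕ.≟ N
        ... | no s = ≈trans (*-congʳ (e-0 s)) (zeroˡ _)
        ... | yes s = ≈trans (*-congˡ (off pw p w≢u (ℕP.≤-reflexive (ℕP.+-cancelʳ-≡ (suc k) _ _ (trans s (sym r)))))) (zeroʳ _)
      ... | no r = ≈trans (split u) (≈trans (+-cong (h u p q') (Σ-0 {xs = perms n} other)) (+-identityʳ _))
        where
        q' : N ≤ rank u + k
        q' = ℕP.≤-pred (ℕP.≤-trans (ℕP.≤∧≢⇒< q (r ∘ sym)) (ℕP.≤-reflexive (ℕP.+-suc _ _)))
        other : ∀ w → w ∈ perms n → e w ⊛ M w u ≈ 0#
        other w pw with rank w + suc k ℕ.≟ N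
        ... | no s = ≈trans (*-congʳ (e-0 s)) (zeroˡ _)
        ... | yes s = ≈trans (*-congˡ (off pw p (λ { refl → r s }) (ℕP.≤-trans (ℕP.n≤1+n _) w<u))) (zeroʳ _)
          where
          w<u : rank w < rank u
          w<u = ℕP.+-cancelʳ-≤ k _ _ (ℕP.≤-trans (ℕP.≤-reflexive (trans (sym (ℕP.+-suc _ k)) s)) q')

    solvable : ∀ (b : Perm n → Carrier) → ∃ λ (c : Perm n → Carrier) →
      ∀ u → u ∈ perms n → Σ[ perms n ] (λ w → c w ⊛ M w u) ≈ b u
    solvable b with solvable-from N b
    ... | c , h = c , λ u p → h u p (ℕP.m≤n+m N (rank u))

    independent : ∀ (c : Perm n → Carrier) → (∀ u → u ∈ perms n → Σ[ perms n ] (λ w → c w ⊛ M w u) ≈ 0#) →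
      ∀ u → u ∈ perms n → c u ≈ 0#
    independent c h = λ u p → go N u p (ℕP.m≤n+m N (rank u))
      where
      go : ∀ k u → u ∈ perms n → N ≤ rank u + k → c u ≈ 0#
      go zero u p q = ⊥-elim (ℕP.<⇒≱ (rank< p) (ℕP.≤-trans q (ℕP.≤-reflexive (ℕP.+-identityʳ _))))
      go (suc k) u p q = begin
        c u ≈⟨ *-identityʳ _ ⟨
        c u ⊛ 1# ≈⟨ *-congˡ (diag p) ⟨
        c u ⊛ M u u ≈⟨ Σ-perms-single p _ other ⟨
        Σ[ perms n ] (λ w → c w ⊛ M w u) ≈⟨ h u p ⟩
        0# ∎
        where
        other : ∀ w → w ∈ perms n → w ≢ u → c w ⊛ M w u ≈ 0#
        other w pw w≢u with rank w ℕ.≤? rank u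
        ... | yes r = ≈trans (*-congˡ (off pw p w≢u r)) (zeroʳ _)
        ... | no r = ≈trans (*-congʳ (go k w pw (ℕP.≤-trans q (ℕP.≤-trans (ℕP.≤-reflexive (ℕP.+-suc _ k)) (ℕP.+-monoˡ-≤ k (ℕP.≰⇒> r)))))) (zeroˡ _)

-- Left against right descents, and further induction principles

sL∈ : ∀ {n} j {u : Perm n} → u ∈ perms n → sL j u ∈ perms n
sL∈ j p = unique-perms (sL-unique j (perms-unique p))

swapPos∈ : ∀ {n} j {u : Perm n} → u ∈ perms n → swapPos j u ∈ perms n
swapPos∈ j p = unique-perms (swapPos-unique j (perms-unique p))

act∈ : ∀ {n} ω {u : Perm n} → u ∈ perms n → foldr sL u ω ∈ perms n
act∈ ω p = unique-perms (act-unique ω (perms-unique p))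

id∈ : ∀ n → idPerm n ∈ perms n
id∈ n = unique-perms (idUnique n)

reverse∈ : ∀ {n} {u : Perm n} → u ∈ perms n → V.reverse u ∈ perms n
reverse∈ p = unique-perms (reverse-unique (perms-unique p))

lenB : ∀ {n} → ℕ → Perm n → Bool
lenB i u = len (sL i u) <ᵇ len u

-- These are the data needed to compare T_i (h T_j) with (T_i h) T_j at u: generically the two
-- descent tests do not influence each other, and in the exceptional case s_i u = u s_j they agree.
descents-commute : ∀ {n} i j {u : Perm n} → Unique u →
  (descB j (sL i u) ≡ descB j u × lenB i (swapPos j u) ≡ lenB i u)
  ⊎ (sL i u ≡ swapPos j u × lenB i u ≡ descB j u × lenB i (swapPos j u) ≡ descB j (swapPos j u))
descents-commute {n} i j {u} p with descB-sL i j p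
... | inj₂ e = inj₂ (e , trans (cong (λ z → len z <ᵇ len u) e) (len-swapPos-<ᵇ j p)
      , trans (cong (λ z → len z <ᵇ len (swapPos j u)) (trans (cong (sL i) (sym e)) (trans (sL-invol i u) (sym (swapPos-invol j u))))) (len-swapPos-<ᵇ j (swapPos-unique j p)))
... | inj₁ e with suc j ℕ.<? n
... | no q = inj₁ (e , cong (lenB i) (swapPos-out j u (ℕP.≮⇒≥ q)))
... | yes q = inj₁ (e , trans (cong (λ z → len z <ᵇ len (swapPos j u)) (sL-swapPos i j u)) (same (descB j u) refl))
  where
  pi : Unique (sL i u)
  pi = sL-unique i p
  same : ∀ b → descB j u ≡ b → (len (swapPos j (sL i u)) <ᵇ len (swapPos j u)) ≡ lenB i u
  same false d rewrite len-swapPos-asc j p q d | len-swapPos-asc j pi q (trans e d) = refl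
  same true d rewrite len-swapPos-desc j u d | len-swapPos-desc j (sL i u) (trans e d) = refl

left-ind : ∀ {n} {q} (Q : Perm n → Set q) → Q (idPerm n) →
  (∀ j w → w ∈ perms n → suc j < n → len w < len (sL j w) → Q w → Q (sL j w)) → ∀ {w} → w ∈ perms n → Q w
left-ind {n} Q base step {w} p = subst Q (isProd r) (go (redWord w) (ℕP.≤-reflexive (trans (length≡ r) (cong len (sym (isProd r))))) (inRange r))
  where
  r = redWord-red (perms-unique p)
  -- The bound says that the word is reduced. It passes to suffixes because one letter lengthens a
  -- permutation by at most one.
  go : ∀ ω → length ω ≤ len (prod {n} ω) → LA.All (InR n) ω → Q (prod ω)
  go [] _ _ = base
  go (j ∷ ω) l (q ∷ qs) = step j (prod ω) (act∈ ω (id∈ n)) q (ℕP.≤-<-trans (len-prod ω) l)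
    (go ω (ℕP.≤-pred (ℕP.≤-trans l (len-sL-≤ j (act-unique ω (idUnique n))))) qs)

len-≤-tri : ∀ {n} {u : Perm n} → u ∈ perms n → len u ≤ tri n
len-≤-tri {u = u} p = ℕP.m+n≤o⇒n≤o (len (V.reverse u)) (ℕP.≤-reflexive (len-reverse (perms-unique p)))

desc-ind : ∀ {n q} (Q : Perm n → Set q) → (∀ u → u ∈ perms n → (∀ z → z ∈ perms n → len u < len z → Q z) → Q u) → ∀ u → u ∈ perms n → Q u
desc-ind {n} Q step u p = go (suc (tri n)) u p (ℕP.m≤n+m (suc (tri n)) (len u))
  where
  go : ∀ k u → u ∈ perms n → suc (tri n) ≤ len u + k → Q u
  go zero u p q = ⊥-elim (ℕP.<⇒≱ (s≤s (len-≤-tri p)) (ℕP.≤-trans q (ℕP.≤-reflexive (ℕP.+-identityʳ _))))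
  go (suc k) u p q = step u p λ z r l → go k z r (ℕP.≤-trans q (ℕP.≤-trans (ℕP.≤-reflexive (ℕP.+-suc _ k)) (ℕP.+-monoˡ-≤ k l)))

-- Entries, adjacent values, and the parabolic subgroup

swapF-fix : ∀ {n} j {x : Fin n} → toℕ x ≢ j → toℕ x ≢ suc j → swapF j x ≡ x
swapF-fix {suc zero} zero {x} _ _ = refl
swapF-fix {suc (suc n)} zero {zero} p _ = ⊥-elim (p refl)
swapF-fix {suc (suc n)} zero {suc zero} _ q = ⊥-elim (q refl)
swapF-fix {suc (suc n)} zero {suc (suc x)} _ _ = refl
swapF-fix {suc zero} (suc j) {zero} _ _ = refl
swapF-fix {suc (suc n)} (suc j) {zero} _ _ = refl
swapF-fix {suc (suc n)} (suc j) {suc x} p q = cong suc (swapF-fix j (p ∘ cong suc) (q ∘ cong suc))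

swapF-down : ∀ {n} j {x : Fin n} → toℕ x ≡ suc j → toℕ (swapF j x) ≡ j
swapF-down {suc (suc n)} zero {suc zero} refl = refl
swapF-down {suc (suc n)} (suc j) {suc x} e = cong suc (swapF-down j (ℕP.suc-injective e))

swapF-up : ∀ {n} j {x : Fin n} → suc j < n → toℕ x ≡ j → toℕ (swapF j x) ≡ suc j
swapF-up {suc (suc n)} zero {zero} _ refl = refl
swapF-up {suc (suc n)} (suc j) {suc x} (s≤s r) e = cong suc (swapF-up j r (ℕP.suc-injective e))
swapF-up {suc zero} zero {zero} (s≤s ()) e
swapF-up {suc zero} (suc j) {x} (s≤s ()) e

-- junk value 0 beyond the end
entry : ∀ {n k} → Vec (Fin n) k → ℕ → ℕ
entry [] _ = 0
entry (a ∷ v) zero = toℕ a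
entry (a ∷ v) (suc p) = entry v p

entry< : ∀ {n k} (u : Vec (Fin n) k) p → p < k → entry u p < n
entry< (a ∷ u) zero _ = FP.toℕ<n a
entry< (a ∷ u) (suc p) (s≤s q) = entry< u p q

descB-entry : ∀ {n k} p (u : Vec (Fin n) k) → suc p < k → descB p u ≡ (entry u (suc p) <ᵇ entry u p)
descB-entry zero (a ∷ []) (s≤s ())
descB-entry zero (a ∷ b ∷ u) _ = refl
descB-entry (suc p) (a ∷ u) (s≤s q) = descB-entry p u q

entry-∉ : ∀ {n k} {a : Fin n} {u : Vec (Fin n) k} → All (a ≢_) u → ∀ q → q < k → toℕ a ≢ entry u q
entry-∉ (p ∷ _) zero _ e = p (FP.toℕ-injective e)
entry-∉ (_ ∷ ps) (suc q) (s≤s r) e = entry-∉ ps q r e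

entry-injective : ∀ {n k} {u : Vec (Fin n) k} → Unique u → ∀ p q → p < k → q < k → entry u p ≡ entry u q → p ≡ q
entry-injective {u = a ∷ u} _ zero zero _ _ _ = refl
entry-injective {u = a ∷ u} (a∉ ∷ _) zero (suc q) _ (s≤s r) e = ⊥-elim (entry-∉ a∉ q r e)
entry-injective {u = a ∷ u} (a∉ ∷ _) (suc p) zero (s≤s r) _ e = ⊥-elim (entry-∉ a∉ p r (sym e))
entry-injective {u = a ∷ u} (_ ∷ u') (suc p) (suc q) (s≤s r) (s≤s s) e = cong suc (entry-injective u' p q r s e)

entry-sL-fix : ∀ {n k} j (u : Vec (Fin n) k) p → entry u p ≢ j → entry u p ≢ suc j → entry (V.map (swapF j) u) p ≡ entry u p
entry-sL-fix j [] p _ _ = refl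
entry-sL-fix j (a ∷ u) zero q r = cong toℕ (swapF-fix j q r)
entry-sL-fix j (a ∷ u) (suc p) q r = entry-sL-fix j u p q r

entry-sL-down : ∀ {n k} j (u : Vec (Fin n) k) p → entry u p ≡ suc j → entry (V.map (swapF j) u) p ≡ j
entry-sL-down j (a ∷ u) zero e = swapF-down j e
entry-sL-down j (a ∷ u) (suc p) e = entry-sL-down j u p e

entry-swapPos-fix : ∀ {n k} j (u : Vec (Fin n) k) p → p ≢ j → p ≢ suc j → entry (swapPos j u) p ≡ entry u p
entry-swapPos-fix zero [] p _ _ = refl
entry-swapPos-fix zero (x ∷ []) p _ _ = refl
entry-swapPos-fix zero (x ∷ y ∷ u) zero q _ = ⊥-elim (q refl)
entry-swapPos-fix zero (x ∷ y ∷ u) (suc zero) _ q = ⊥-elim (q refl)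
entry-swapPos-fix zero (x ∷ y ∷ u) (suc (suc p)) _ _ = refl
entry-swapPos-fix (suc j) [] p _ _ = refl
entry-swapPos-fix (suc j) (x ∷ u) zero _ _ = refl
entry-swapPos-fix (suc j) (x ∷ u) (suc p) q r = entry-swapPos-fix j u p (q ∘ cong suc) (r ∘ cong suc)

entry-swapPos-0 : ∀ {n k} j (u : Vec (Fin n) k) → suc j < k → entry (swapPos j u) j ≡ entry u (suc j)
entry-swapPos-0 zero (x ∷ []) (s≤s ())
entry-swapPos-0 zero (x ∷ y ∷ u) _ = refl
entry-swapPos-0 (suc j) (x ∷ u) (s≤s r) = entry-swapPos-0 j u r

entry-swapPos-1 : ∀ {n k} j (u : Vec (Fin n) k) → suc j < k → entry (swapPos j u) (suc j) ≡ entry u j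
entry-swapPos-1 zero (x ∷ []) (s≤s ())
entry-swapPos-1 zero (x ∷ y ∷ u) _ = refl
entry-swapPos-1 (suc j) (x ∷ u) (s≤s r) = entry-swapPos-1 j u r

adjacent-swap : ∀ {n k} t p {u : Vec (Fin n) k} → Unique u → suc p < k → suc t < n → entry u p ≡ t → entry u (suc p) ≡ suc t →
  V.map (swapF t) u ≡ swapPos p u
adjacent-swap t zero {a ∷ []} _ (s≤s ()) _ _ _
adjacent-swap t zero {a ∷ b ∷ u} ((_ ∷ a∉) ∷ b∉ ∷ _) _ r e e' =
  cong₂ _∷_ (FP.toℕ-injective (trans (swapF-up t r e) (sym e'))) (cong₂ _∷_ (FP.toℕ-injective (trans (swapF-down t e') (sym e)))
    (map-fixed (swapF t) (VA.map (λ (p , q) → swapF-fix t (λ h → p (FP.toℕ-injective (trans e (sym h)))) (λ h → q (FP.toℕ-injective (trans e' (sym h))))) (VA.zip (a∉ , b∉)))))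
adjacent-swap {k = suc (suc k)} t (suc p) {a ∷ u} (a∉ ∷ u') (s≤s q) r e e' =
  cong₂ _∷_ (swapF-fix t (λ h → ℕP.0≢1+n (inj zero (suc p) (s≤s z≤n) (ℕP.m<n⇒m<1+n q) (trans h (sym e))))
                         (λ h → ℕP.0≢1+n (inj zero (suc (suc p)) (s≤s z≤n) (s≤s q) (trans h (sym e')))))
            (adjacent-swap t p u' q r e e')
  where inj = entry-injective (a∉ ∷ u')

Fixes : ∀ {n k} → ℕ → ℕ → Vec (Fin n) k → Set
Fixes {k = k} m pos u = ∀ p → p < k → m ≤ pos + p → entry u p ≡ pos + p

fixes-sound : ∀ {n k} m pos (u : Vec (Fin n) k) → fixesFromB m pos u ≡ true → Fixes m pos u
fixes-sound m pos (a ∷ u) e with m ℕ.≤ᵇ pos in le | toℕ a ℕ.≡ᵇ pos in eq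
fixes-sound m pos (a ∷ u) e | true | true = λ
  { zero _ _ → trans (ℕP.≡ᵇ⇒≡ _ _ (Equivalence.from T-≡ eq)) (sym (ℕP.+-identityʳ pos))
  ; (suc p) (s≤s q) r → trans (fixes-sound m (suc pos) u e p q (subst (m ≤_) (ℕP.+-suc pos p) r)) (sym (ℕP.+-suc pos p)) }
fixes-sound m pos (a ∷ u) e | false | _ = λ
  { zero _ r → ⊥-elim (false≢true (trans (sym le) (Equivalence.to T-≡ (ℕP.≤⇒≤ᵇ (subst (m ≤_) (ℕP.+-identityʳ pos) r)))))
  ; (suc p) (s≤s q) r → trans (fixes-sound m (suc pos) u e p q (subst (m ≤_) (ℕP.+-suc pos p) r)) (sym (ℕP.+-suc pos p)) }

fixes-complete : ∀ {n k} m pos (u : Vec (Fin n) k) → Fixes m pos u → fixesFromB m pos u ≡ true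
fixes-complete m pos [] _ = refl
fixes-complete m pos (a ∷ u) f with m ℕ.≤ᵇ pos in le
... | false = fixes-complete m (suc pos) u λ p q r → trans (f (suc p) (s≤s q) (subst (m ≤_) (sym (ℕP.+-suc pos p)) r)) (ℕP.+-suc pos p)
... | true rewrite Equivalence.to T-≡ (ℕP.≡⇒≡ᵇ (toℕ a) pos (trans (f zero (s≤s z≤n) (subst (m ≤_) (sym (ℕP.+-identityʳ pos)) (ℕP.≤ᵇ⇒≤ m pos (Equivalence.from T-≡ le)))) (ℕP.+-identityʳ pos))) =
  fixes-complete m (suc pos) u λ p q r → trans (f (suc p) (s≤s q) (subst (m ≤_) (sym (ℕP.+-suc pos p)) r)) (ℕP.+-suc pos p)

Bool-iff : ∀ {a b : Bool} → (a ≡ true → b ≡ true) → (b ≡ true → a ≡ true) → a ≡ b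
Bool-iff {true} f _ = sym (f refl)
Bool-iff {false} {true} _ g = g refl
Bool-iff {false} {false} _ _ = refl

fixes-swapPos : ∀ {n} m j (u : Perm n) → suc j < m → fixesFromB m 0 (swapPos j u) ≡ fixesFromB m 0 u
fixes-swapPos m j u r = Bool-iff (λ e → subst (λ z → fixesFromB m 0 z ≡ true) (swapPos-invol j u) (go (swapPos j u) e)) (go u)
  where
  go : ∀ u → fixesFromB m 0 u ≡ true → fixesFromB m 0 (swapPos j u) ≡ true
  go u e = fixes-complete m 0 (swapPos j u) λ p q l → trans (entry-swapPos-fix j u p (λ { refl → ℕP.<⇒≱ r (ℕP.≤-trans l (ℕP.n≤1+n _)) }) (λ { refl → ℕP.<⇒≱ r l }))
                                                 (fixes-sound m 0 u e p q l)

fixes-sL : ∀ {n} m j (u : Perm n) → suc j < m → fixesFromB m 0 (sL j u) ≡ fixesFromB m 0 u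
fixes-sL m j u r = Bool-iff (λ e → subst (λ z → fixesFromB m 0 z ≡ true) (sL-invol j u) (go (sL j u) e)) (go u)
  where
  go : ∀ u → fixesFromB m 0 u ≡ true → fixesFromB m 0 (sL j u) ≡ true
  go u e = fixes-complete m 0 (sL j u) λ p q l → let f = fixes-sound m 0 u e p q l in
    trans (entry-sL-fix j u p (λ h → ℕP.<⇒≱ r (ℕP.≤-trans l (ℕP.≤-trans (ℕP.≤-reflexive (trans (sym f) h)) (ℕP.n≤1+n _))))
                              (λ h → ℕP.<⇒≱ r (ℕP.≤-trans l (ℕP.≤-reflexive (trans (sym f) h))))) f

-- If position j + 1 is fixed, a descent at j puts a value above j + 1 at position j. A value that
-- is at least m already occurs at its own position, so injectivity excludes this.
fixes-descent : ∀ {n} m j {u : Perm n} → Unique u → fixesFromB m 0 u ≡ true → descB j u ≡ true → suc j < m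
fixes-descent {n} m j {u} p e d with suc j ℕ.<? m
... | yes r = r
... | no r = ⊥-elim (contra (m ℕ.≤? j))
  where
  F = fixes-sound m 0 u e
  q : suc j < n
  q = descB-inRange j u d
  f₁ : entry u (suc j) ≡ suc j
  f₁ = F (suc j) q (ℕP.≮⇒≥ r)
  gt : entry u (suc j) < entry u j
  gt = <ᵇ-true⁻ (trans (sym (descB-entry j u q)) d)
  contra : Dec (m ≤ j) → ⊥
  contra (yes l) = ℕP.<-asym gt (subst₂ _<_ (sym (F j (ℕP.<⇒≤ q) l)) (sym f₁) ℕP.≤-refl)
  contra (no l) = l (subst (m ≤_) x≡j m≤x)
    where
    m≤x : m ≤ entry u j
    m≤x = ℕP.≤-trans (ℕP.≮⇒≥ r) (ℕP.≤-trans (ℕP.≤-reflexive (sym f₁)) (ℕP.<⇒≤ gt))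
    x<n = entry< u j (ℕP.<⇒≤ q)
    x≡j : entry u j ≡ j
    x≡j = entry-injective p (entry u j) j x<n (ℕP.<⇒≤ q) (F (entry u j) x<n m≤x)

len-0 : ∀ {n} {w : Perm n} → Unique w → len w ≡ 0 → w ≡ idPerm n
len-0 {w = w} p e with findDesc w in eq
... | nothing = findDesc-nothing-id p eq
... | just j with () ← trans (sym e) (len-swapPos-desc j w (findDesc-just w eq))

-- Numbers the descending runs of `y`: two positions lie in the same run exactly when their counts
-- agree.
ascents : ∀ {n} → Perm n → ℕ → ℕ
ascents y zero = 0
ascents y (suc t) = ascents y t + (if descB t y then 0 else 1)

ascents-mono : ∀ {n} (y : Perm n) {s t} → s ≤ t → ascents y s ≤ ascents y t
ascents-mono y {s} {zero} z≤n = ℕP.≤-refl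
ascents-mono y {s} {suc t} l with s ℕ.≟ suc t
... | yes refl = ℕP.≤-refl
... | no q = ℕP.≤-trans (ascents-mono y (ℕP.≤-pred (ℕP.≤∧≢⇒< l q))) (ℕP.m≤m+n _ _)

-- Three consecutive positions and cosets of the rank two subgroup

data At {n} : ∀ {k} → ℕ → Vec (Fin n) k → Fin n → Fin n → Fin n → Set where
  here : ∀ {k x y z} {v : Vec (Fin n) k} → At 0 (x ∷ y ∷ z ∷ v) x y z
  there : ∀ {k j a x y z} {v : Vec (Fin n) k} → At j v x y z → At (suc j) (a ∷ v) x y z

module _ {n : ℕ} where

  at-exists : ∀ {k} j (u : Vec (Fin n) k) → suc (suc j) < k → ∃ λ x → ∃ λ y → ∃ λ z → At j u x y z
  at-exists zero (x ∷ y ∷ z ∷ u) _ = x , y , z , here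
  at-exists zero (x ∷ y ∷ []) (s≤s (s≤s ()))
  at-exists zero (x ∷ []) (s≤s ())
  at-exists (suc j) (a ∷ u) (s≤s r) with at-exists j u r
  ... | x , y , z , p = x , y , z , there p

  at-range : ∀ {k j x y z} {u : Vec (Fin n) k} → At j u x y z → suc (suc j) < k
  at-range here = s≤s (s≤s (s≤s z≤n))
  at-range (there p) = s≤s (at-range p)

  at-s : ∀ {k j x y z} {u : Vec (Fin n) k} → At j u x y z → At j (swapPos j u) y x z
  at-s here = here
  at-s (there p) = there (at-s p)

  at-t : ∀ {k j x y z} {u : Vec (Fin n) k} → At j u x y z → At j (swapPos (suc j) u) x z y
  at-t here = here
  at-t (there p) = there (at-t p)

  at-desc-s : ∀ {k j x y z} {u : Vec (Fin n) k} → At j u x y z → descB j u ≡ (y <f x)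
  at-desc-s here = refl
  at-desc-s (there p) = at-desc-s p

  at-desc-t : ∀ {k j x y z} {u : Vec (Fin n) k} → At j u x y z → descB (suc j) u ≡ (z <f y)
  at-desc-t here = refl
  at-desc-t (there p) = at-desc-t p

  at-braid : ∀ {k j x y z} {u : Vec (Fin n) k} → At j u x y z →
    swapPos (suc j) (swapPos j (swapPos (suc j) u)) ≡ swapPos j (swapPos (suc j) (swapPos j u))
  at-braid here = refl
  at-braid (there {a = a} p) = cong (a ∷_) (at-braid p)

  at-functional : ∀ {k j x y z x' y' z'} {u : Vec (Fin n) k} → At j u x y z → At j u x' y' z' → x ≡ x' × y ≡ y' × z ≡ z'
  at-functional here here = refl , refl , refl
  at-functional (there p) (there q) = at-functional p q

  at-unique : ∀ {k j x y z} {u : Vec (Fin n) k} → Unique u → At j u x y z → x ≢ y × x ≢ z × y ≢ z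
  at-unique ((p ∷ q ∷ _) ∷ (r ∷ _) ∷ _) here = p , q , r
  at-unique (_ ∷ u) (there p) = at-unique u p

-- `d` is the shortest element of the coset of u modulo ⟨s,t⟩, recognised by increasing entries at
-- positions j, j + 1, j + 2; the six alternatives run through the coset.
data Arrangement {n} (j : ℕ) (u : Perm n) : Set where
  arr : ∀ (s t : Perm n → Perm n) → s ≡ swapPos j → t ≡ swapPos (suc j) → ∀ {a b c d} → At j d a b c → toℕ a < toℕ b → toℕ b < toℕ c → d ∈ perms n →
    u ≡ d ⊎ u ≡ s d ⊎ u ≡ t d ⊎ u ≡ t (s d) ⊎ u ≡ s (t d) ⊎ u ≡ s (t (s d)) → Arrangement j u

arrange : ∀ {n} j (u : Perm n) → u ∈ perms n → suc (suc j) < n → Arrangement j u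
arrange {n} j u p r with at-exists j u r
... | x , y , z , q with at-unique (perms-unique p) q
... | x≢y , x≢z , y≢z with <ᵇ-dec x y x≢y | <ᵇ-dec y z y≢z | <ᵇ-dec x z x≢z
  where
  <ᵇ-dec : ∀ (a b : Fin n) → a ≢ b → toℕ a < toℕ b ⊎ toℕ b < toℕ a
  <ᵇ-dec a b a≢b with ℕP.<-cmp (toℕ a) (toℕ b)
  ... | tri< l _ _ = inj₁ l
  ... | tri≈ _ e _ = ⊥-elim (a≢b (FP.toℕ-injective e))
  ... | tri> _ _ g = inj₂ g
... | inj₁ xy | inj₁ yz | _ = arr _ _ refl refl q xy yz p (inj₁ refl)
... | inj₂ yx | _ | inj₁ xz = arr _ _ refl refl (at-s q) yx xz (swapPos∈ j p) (inj₂ (inj₁ (sym (swapPos-invol j u))))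
... | _ | inj₂ zy | inj₁ xz = arr _ _ refl refl (at-t q) xz zy (swapPos∈ (suc j) p) (inj₂ (inj₂ (inj₁ (sym (swapPos-invol (suc j) u)))))
... | inj₁ xy | _ | inj₂ zx = arr _ _ refl refl (at-s (at-t q)) zx xy (swapPos∈ j (swapPos∈ (suc j) p))
  (inj₂ (inj₂ (inj₂ (inj₁ (sym (trans (cong (swapPos (suc j)) (swapPos-invol j _)) (swapPos-invol (suc j) u)))))))
... | _ | inj₁ yz | inj₂ zx = arr _ _ refl refl (at-t (at-s q)) yz zx (swapPos∈ (suc j) (swapPos∈ j p))
  (inj₂ (inj₂ (inj₂ (inj₂ (inj₁ (sym (trans (cong (swapPos j) (swapPos-invol (suc j) _)) (swapPos-invol j u))))))))
... | inj₂ yx | inj₂ zy | _ = arr _ _ refl refl (at-s (at-t (at-s q))) zy yx (swapPos∈ j (swapPos∈ (suc j) (swapPos∈ j p)))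
  (inj₂ (inj₂ (inj₂ (inj₂ (inj₂ (sym (trans (cong (swapPos j ∘ swapPos (suc j)) (swapPos-invol j _)) (trans (cong (swapPos j) (swapPos-invol (suc j) _)) (swapPos-invol j u)))))))))

-- Modelled on ℤ[v,v⁻¹], with Val k p for p ∈ v^k ℤ[v].
record Laurent {c ℓ} (A : CommutativeRing c ℓ) : Set (Level.suc (c ⊔ ℓ)) where
  open CommutativeRing A using (Carrier; _≈_; 0#; 1#) renaming (_+_ to _⊕_; _*_ to _⊛_; -_ to ⊖_)
  field
    v vi : Carrier
    v*vi : v ⊛ vi ≈ 1#
    bar : Carrier → Carrier
    bar-cong : ∀ {x y} → x ≈ y → bar x ≈ bar y
    bar-+ : ∀ x y → bar (x ⊕ y) ≈ bar x ⊕ bar y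
    bar-* : ∀ x y → bar (x ⊛ y) ≈ bar x ⊛ bar y
    bar-1 : bar 1# ≈ 1#
    bar-v : bar v ≈ vi
    bar-invol : ∀ x → bar (bar x) ≈ x
    Val : ℕ → Carrier → Set ℓ
    Val-cong : ∀ {k x y} → x ≈ y → Val k x → Val k y
    Val-0 : ∀ k → Val k 0#
    Val-1 : Val 0 1#
    Val-v : Val 1 v
    Val-+ : ∀ {k x y} → Val k x → Val k y → Val k (x ⊕ y)
    Val-neg : ∀ {k x} → Val k x → Val k (⊖ x)
    Val-* : ∀ {j k x y} → Val j x → Val k y → Val (j + k) (x ⊛ y)
    Val-pred : ∀ {k x} → Val (suc k) x → Val k x
    Val-bound : ∀ x → ∃ λ d → ∀ {k y} → Val (d + k) y → Val k (x ⊛ y)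
    Val-sep : ∀ {x} → (∀ k → Val k x) → x ≈ 0#
    Val-bar : ∀ {x} → Val 1 x → bar x ≈ x → x ≈ 0#

-- The Hecke algebra as operators on coefficient functions

module HeckeTheory {c ℓ} {A : CommutativeRing c ℓ} (LA : Laurent A) (n m : ℕ) where
  open RingKit A public
  open Laurent LA public
  open Solver using (solve; _:+_; _:-_; _:*_; _:=_; con; :-_)

  ξ : Carrier
  ξ = v ⊕ ⊖ vi

  HA : Set c
  HA = Perm n → Carrier

  infix 4 _≋_
  -- Only values on permutations carry meaning. A record instead of the bare function type lets both
  -- sides be recovered from a proof.
  record _≋_ (h g : HA) : Set (c ⊔ ℓ) where
    constructor mk
    field at : ∀ u → u ∈ perms n → h u ≈ g u
  open _≋_ public

  ≋refl : ∀ {h} → h ≋ h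
  ≋refl = mk λ _ _ → ≈refl

  ≋sym : ∀ {h g} → h ≋ g → g ≋ h
  ≋sym p = mk λ u q → ≈sym (at p u q)

  infixr 2 _∙≋_
  _∙≋_ : ∀ {f g h} → f ≋ g → g ≋ h → f ≋ h
  p ∙≋ q = mk λ u r → ≈trans (at p u r) (at q u r)

  0H : HA
  0H _ = 0#

  infixl 6 _⊞_
  _⊞_ : HA → HA → HA
  (h ⊞ g) u = h u ⊕ g u

  infixr 7 _·_
  _·_ : Carrier → HA → HA
  (k · h) u = k ⊛ h u

  ⊞-cong : ∀ {h h' g g'} → h ≋ h' → g ≋ g' → h ⊞ g ≋ h' ⊞ g'
  ⊞-cong p q = mk λ u r → +-cong (at p u r) (at q u r)

  ·-cong : ∀ {k k' h h'} → k ≈ k' → h ≋ h' → k · h ≋ k' · h'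
  ·-cong p q = mk λ u r → *-cong p (at q u r)

  T' : Perm n → HA
  T' w u = if does (u ≟V w) then 1# else 0#

  T1 : HA
  T1 = T' (idPerm n)

  T'-self : ∀ w → T' w w ≈ 1#
  T'-self w rewrite dec-true (w ≟V w) refl = ≈refl

  T'-other : ∀ {w u} → u ≢ w → T' w u ≈ 0#
  T'-other {w} {u} q rewrite dec-false (u ≟V w) q = ≈refl

  T'-transport : ∀ {w u w' u'} → (u ≡ w → u' ≡ w') → (u' ≡ w' → u ≡ w) → T' w u ≈ T' w' u'
  T'-transport {w} {u} {w'} {u'} f g with u ≟V w
  ... | yes e rewrite dec-true (u' ≟V w') (f e) = ≈refl
  ... | no e rewrite dec-false (u' ≟V w') (e ∘ g) = ≈refl

  expand : ∀ (h : HA) {u} → u ∈ perms n → Σ[ perms n ] (λ w → h w ⊛ T' w u) ≈ h u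
  expand h {u} p = ≈trans (Σ-perms-single p _ λ w _ q → ≈trans (*-congˡ (T'-other (q ∘ sym))) (zeroʳ _))
                          (≈trans (*-congˡ (T'-self u)) (*-identityʳ _))

  -- Both h ↦ T_s h and h ↦ h T_s have this form.
  op : (Perm n → Perm n) → (Perm n → Bool) → HA → HA
  op s b h u = h (s u) ⊕ (if b u then ξ ⊛ h u else 0#)

  κ : Bool → Carrier
  κ b = if b then ξ else 0#

  op-κ : ∀ s b h u → op s b h u ≈ h (s u) ⊕ κ (b u) ⊛ h u
  op-κ s b h u with b u
  ... | true = ≈refl
  ... | false = +-congˡ (≈sym (zeroˡ _))

  lm : ℕ → HA → HA
  lm j = op (sL j) (lenB j)

  rm : ℕ → HA → HA
  rm j = op (swapPos j) (descB j)

  -- By the quadratic relation F² = 1 + ξF this is the inverse of F.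
  inv : (HA → HA) → HA → HA
  inv F h = F h ⊞ (⊖ ξ) · h

  lm-κ : ∀ j h u → lm j h u ≈ h (sL j u) ⊕ κ (lenB j u) ⊛ h u
  lm-κ j = op-κ (sL j) (lenB j)

  rm-κ : ∀ j h u → rm j h u ≈ h (swapPos j u) ⊕ κ (descB j u) ⊛ h u
  rm-κ j = op-κ (swapPos j) (descB j)

  lmi rmi : ℕ → HA → HA
  lmi j = inv (lm j)
  rmi j = inv (rm j)

  record SemiLin (σ : Carrier → Carrier) (Φ : HA → HA) : Set (c ⊔ ℓ) where
    field
      cong-op : ∀ {h g} → h ≋ g → Φ h ≋ Φ g
      add-op : ∀ h g → Φ (h ⊞ g) ≋ Φ h ⊞ Φ g
      scale-op : ∀ k h → Φ (k · h) ≋ σ k · Φ h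
  open SemiLin public

  Lin = SemiLin id

  op-lin : ∀ {s b} → (∀ {u} → u ∈ perms n → s u ∈ perms n) → Lin (op s b)
  op-lin {s} {b} s∈ = record
    { cong-op = λ {h} {g} p → mk λ u q → ≈trans (op-κ s b h u) (≈trans (+-cong (at p (s u) (s∈ q)) (*-congˡ (at p u q))) (≈sym (op-κ s b g u)))
    ; add-op = λ h g → mk λ u q → ≈trans (op-κ s b (h ⊞ g) u) (≈trans
        (solve 5 (λ a b c d k → (a :+ b) :+ k :* (c :+ d) := (a :+ k :* c) :+ (b :+ k :* d)) ≈refl (h (s u)) (g (s u)) (h u) (g u) (κ (b u)))
        (+-cong (≈sym (op-κ s b h u)) (≈sym (op-κ s b g u))))
    ; scale-op = λ k h → mk λ u q → ≈trans (op-κ s b (k · h) u) (≈trans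
        (solve 4 (λ a c k m → m :* a :+ k :* (m :* c) := m :* (a :+ k :* c)) ≈refl (h (s u)) (h u) (κ (b u)) k)
        (*-congˡ (≈sym (op-κ s b h u))))
    }

  L-lin : ∀ j → Lin (lm j)
  L-lin j = op-lin (sL∈ j)

  R-lin : ∀ j → Lin (rm j)
  R-lin j = op-lin (swapPos∈ j)

  inv-lin : ∀ {F} → Lin F → Lin (inv F)
  inv-lin {F} l = record
    { cong-op = λ p → ⊞-cong (cong-op l p) (·-cong ≈refl p)
    ; add-op = λ h g → mk λ u q → ≈trans (+-cong (at (add-op l h g) u q) (distribˡ _ _ _)) (medial _ _ _ _)
    ; scale-op = λ k h → mk λ u q → ≈trans (+-congʳ (at (scale-op l k h) u q))
        (solve 4 (λ k a x b → k :* a :+ x :* (k :* b) := k :* (a :+ x :* b)) ≈refl k (F h u) (⊖ ξ) (h u))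
    }

  id-lin : Lin id
  id-lin = record { cong-op = id ; add-op = λ _ _ → ≋refl ; scale-op = λ _ _ → ≋refl }

  ∘-lin : ∀ {Φ Ψ} → Lin Φ → Lin Ψ → Lin (Φ ∘ Ψ)
  ∘-lin l m = record
    { cong-op = cong-op l ∘ cong-op m
    ; add-op = λ h g → cong-op l (add-op m h g) ∙≋ add-op l _ _
    ; scale-op = λ k h → cong-op l (scale-op m k h) ∙≋ scale-op l k _ }

  ∘-semilin : ∀ {σ Φ Ψ} → Lin Φ → SemiLin σ Ψ → SemiLin σ (Φ ∘ Ψ)
  ∘-semilin l m = record
    { cong-op = cong-op l ∘ cong-op m
    ; add-op = λ h g → cong-op l (add-op m h g) ∙≋ add-op l _ _
    ; scale-op = λ k h → cong-op l (scale-op m k h) ∙≋ scale-op l _ _ }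

  semilin-∘ : ∀ {σ Φ Ψ} → SemiLin σ Φ → Lin Ψ → SemiLin σ (Φ ∘ Ψ)
  semilin-∘ l m = record
    { cong-op = cong-op l ∘ cong-op m
    ; add-op = λ h g → cong-op l (add-op m h g) ∙≋ add-op l _ _
    ; scale-op = λ k h → cong-op l (scale-op m k h) ∙≋ scale-op l k _ }

  word-lin : ∀ {F : ℕ → HA → HA} → (∀ j → Lin (F j)) → ∀ ω → Lin (λ g → foldr F g ω)
  word-lin l [] = id-lin
  word-lin l (j ∷ ω) = ∘-lin (l j) (word-lin l ω)

  semilin-zero : ∀ {σ Φ} → σ 0# ≈ 0# → SemiLin σ Φ → Φ 0H ≋ 0H
  semilin-zero {σ} {Φ} σ0 l = cong-op l (mk λ u _ → ≈sym (zeroˡ 0#)) ∙≋ scale-op l 0# 0H ∙≋ mk λ u _ → ≈trans (*-congʳ σ0) (zeroˡ _)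

  semilin-Σ : ∀ {σ Φ} → σ 0# ≈ 0# → SemiLin σ Φ → ∀ {X : Set} (xs : List X) (k : X → Carrier) (F : X → HA) →
    Φ (λ u → Σ[ xs ] (λ x → k x ⊛ F x u)) ≋ (λ u → Σ[ xs ] (λ x → σ (k x) ⊛ Φ (F x) u))
  semilin-Σ σ0 l [] k F = semilin-zero σ0 l
  semilin-Σ σ0 l (x ∷ xs) k F = add-op l (k x · F x) (λ u → Σ[ xs ] (λ x → k x ⊛ F x u))
    ∙≋ ⊞-cong (scale-op l (k x) (F x)) (semilin-Σ σ0 l xs k F)

  semilin-expand : ∀ {σ Φ} → σ 0# ≈ 0# → SemiLin σ Φ → ∀ h → Φ h ≋ (λ u → Σ[ perms n ] (λ w → σ (h w) ⊛ Φ (T' w) u))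
  semilin-expand σ0 l h = cong-op l (mk λ u p → ≈sym (expand h p)) ∙≋ semilin-Σ σ0 l (perms n) h T'

  semilin-ext : ∀ {σ Φ Ψ} → σ 0# ≈ 0# → SemiLin σ Φ → SemiLin σ Ψ → (∀ {w} → w ∈ perms n → Φ (T' w) ≋ Ψ (T' w)) → ∀ h → Φ h ≋ Ψ h
  semilin-ext σ0 l m e h = semilin-expand σ0 l h ∙≋ (mk λ u p → Σ-cong {xs = perms n} λ w q → *-congˡ (at (e q) u p)) ∙≋ ≋sym (semilin-expand σ0 m h)

  T'-R : ∀ j {w} → w ∈ perms n → suc j < n → descB j w ≡ false → rm j (T' w) ≋ T' (swapPos j w)
  T'-R j {w} p r d = mk go
    where
    go : ∀ u → u ∈ perms n → rm j (T' w) u ≈ T' (swapPos j w) u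
    go u q with descB j u in e
    ... | false = ≈trans (+-identityʳ _) (T'-transport (λ h → trans (sym (swapPos-invol j u)) (cong (swapPos j) h)) (λ h → trans (cong (swapPos j) h) (swapPos-invol j w)))
    ... | true = ≈trans (+-congˡ (≈trans (*-congˡ (T'-other {w} {u} λ { refl → true≢false (trans (sym e) d) })) (zeroʳ _)))
           (≈trans (+-identityʳ _) (T'-transport (λ h → trans (sym (swapPos-invol j u)) (cong (swapPos j) h)) (λ h → trans (cong (swapPos j) h) (swapPos-invol j w))))

  T'-L : ∀ j {w} → w ∈ perms n → len w < len (sL j w) → lm j (T' w) ≋ T' (sL j w)
  T'-L j {w} p l = mk go
    where
    tr : ∀ u → T' w (sL j u) ≈ T' (sL j w) u
    tr u = T'-transport (λ h → trans (sym (sL-invol j u)) (cong (sL j) h)) (λ h → trans (cong (sL j) h) (sL-invol j w))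
    go : ∀ u → u ∈ perms n → lm j (T' w) u ≈ T' (sL j w) u
    go u q with lenB j u in e
    ... | false = ≈trans (+-identityʳ _) (tr u)
    ... | true = ≈trans (+-congˡ (≈trans (*-congˡ (T'-other {w} {u} λ { refl → ℕP.<-asym l (<ᵇ-true⁻ e) })) (zeroʳ _))) (≈trans (+-identityʳ _) (tr u))

  -- Compared coefficientwise through `descents-commute`: generically the diagonal factors are
  -- carried along unchanged, and where s_i u = u s_j both expressions coincide term by term. All
  -- associativity statements rest on this.
  LR : ∀ i j h → lm i (rm j h) ≋ rm j (lm i h)
  LR i j h = mk λ u p → begin
    lm i (rm j h) u ≈⟨ lm-κ i (rm j h) u ⟩
    rm j h (sL i u) ⊕ κ (lenB i u) ⊛ rm j h u ≈⟨ +-cong (rm-κ j h (sL i u)) (*-congˡ (rm-κ j h u)) ⟩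
    (h (swapPos j (sL i u)) ⊕ κ (descB j (sL i u)) ⊛ h (sL i u)) ⊕ κ (lenB i u) ⊛ (h (swapPos j u) ⊕ κ (descB j u) ⊛ h u)
                                                                            ≈⟨ middle u (descents-commute i j (perms-unique p)) ⟩
    (h (sL i (swapPos j u)) ⊕ κ (lenB i (swapPos j u)) ⊛ h (swapPos j u)) ⊕ κ (descB j u) ⊛ (h (sL i u) ⊕ κ (lenB i u) ⊛ h u)
                                                                            ≈⟨ +-cong (lm-κ i h (swapPos j u)) (*-congˡ (lm-κ i h u)) ⟨
    lm i h (swapPos j u) ⊕ κ (descB j u) ⊛ lm i h u ≈⟨ rm-κ j (lm i h) u ⟨
    rm j (lm i h) u ∎
    where
    middle : ∀ u → (descB j (sL i u) ≡ descB j u × lenB i (swapPos j u) ≡ lenB i u)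
      ⊎ (sL i u ≡ swapPos j u × lenB i u ≡ descB j u × lenB i (swapPos j u) ≡ descB j (swapPos j u)) →
      (h (swapPos j (sL i u)) ⊕ κ (descB j (sL i u)) ⊛ h (sL i u)) ⊕ κ (lenB i u) ⊛ (h (swapPos j u) ⊕ κ (descB j u) ⊛ h u)
      ≈ (h (sL i (swapPos j u)) ⊕ κ (lenB i (swapPos j u)) ⊛ h (swapPos j u)) ⊕ κ (descB j u) ⊛ (h (sL i u) ⊕ κ (lenB i u) ⊛ h u)
    middle u (inj₁ (e , e')) rewrite e | e' | sL-swapPos i j u =
      solve 6 (λ a b c d k l → (a :+ k :* b) :+ l :* (c :+ k :* d) := (a :+ l :* c) :+ k :* (b :+ l :* d)) ≈refl _ (h (sL i u)) (h (swapPos j u)) (h u) (κ (descB j u)) (κ (lenB i u))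
    middle u (inj₂ (e , e' , e'')) rewrite sL-swapPos i j u | e | e' | e'' = ≈refl

  κ-not : ∀ b → κ (not b) ⊕ κ b ≈ ξ
  κ-not true = +-identityˡ _
  κ-not false = +-identityʳ _

  κ² : ∀ b → κ b ⊛ κ b ≈ ξ ⊛ κ b
  κ² true = ≈refl
  κ² false = ≈trans (zeroˡ _) (≈sym (zeroʳ _))

  -- Exactly one of u and s u passes the test b, so the two diagonal factors add up to ξ; this sum
  -- is the coefficient of h(s u) after applying the operator twice.
  op-quadratic : ∀ {s b} → (∀ {u} → u ∈ perms n → s (s u) ≡ u) → (∀ {u} → u ∈ perms n → b (s u) ≡ not (b u)) →
    ∀ h → op s b (op s b h) ≋ h ⊞ ξ · op s b h
  op-quadratic {s} {b} ss bs h = mk λ u p → begin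
    op s b (op s b h) u ≈⟨ op-κ s b (op s b h) u ⟩
    op s b h (s u) ⊕ κ (b u) ⊛ op s b h u ≈⟨ +-cong (op-κ s b h (s u)) (*-congˡ (op-κ s b h u)) ⟩
    (h (s (s u)) ⊕ κ (b (s u)) ⊛ h (s u)) ⊕ κ (b u) ⊛ (h (s u) ⊕ κ (b u) ⊛ h u)
                                                                            ≈⟨ +-congʳ (+-cong (≡⇒≈ (cong h (ss p))) (*-congʳ (≡⇒≈ (cong κ (bs p))))) ⟩
    (h u ⊕ κ (not (b u)) ⊛ h (s u)) ⊕ κ (b u) ⊛ (h (s u) ⊕ κ (b u) ⊛ h u)
                                                                            ≈⟨ solve 5 (λ a c k l x → (a :+ l :* c) :+ k :* (c :+ k :* a) := a :+ ((l :+ k) :* c :+ (k :* k) :* a)) ≈refl (h u) (h (s u)) (κ (b u)) (κ (not (b u))) ξ ⟩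
    h u ⊕ ((κ (not (b u)) ⊕ κ (b u)) ⊛ h (s u) ⊕ (κ (b u) ⊛ κ (b u)) ⊛ h u) ≈⟨ +-congˡ (+-cong (*-congʳ (κ-not (b u))) (*-congʳ (κ² (b u)))) ⟩
    h u ⊕ (ξ ⊛ h (s u) ⊕ (ξ ⊛ κ (b u)) ⊛ h u) ≈⟨ +-congˡ (+-congˡ (*-assoc _ _ _)) ⟩
    h u ⊕ (ξ ⊛ h (s u) ⊕ ξ ⊛ (κ (b u) ⊛ h u)) ≈⟨ +-congˡ (distribˡ _ _ _) ⟨
    h u ⊕ ξ ⊛ (h (s u) ⊕ κ (b u) ⊛ h u) ≈⟨ +-congˡ (*-congˡ (op-κ s b h u)) ⟨
    h u ⊕ ξ ⊛ op s b h u ∎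

  R-quadratic : ∀ j → suc j < n → ∀ h → rm j (rm j h) ≋ h ⊞ ξ · rm j h
  R-quadratic j r = op-quadratic (λ {u} _ → swapPos-invol j u) λ p → descB-swapPos j (perms-unique p) r

  inv-left : ∀ {F} → (∀ h → F (F h) ≋ h ⊞ ξ · F h) → ∀ h → inv F (F h) ≋ h
  inv-left {F} q h = mk λ u p → ≈trans (+-congʳ (at (q h) u p)) (solve 3 (λ a x b → (a :+ x :* b) :+ (:- x) :* b := a) ≈refl (h u) ξ (F h u))

  Ri-R : ∀ j → suc j < n → ∀ h → rmi j (rm j h) ≋ h
  Ri-R j r = inv-left (R-quadratic j r)

  inv-commute : ∀ {F G} → Lin G → (∀ h → F (G h) ≋ G (F h)) → ∀ h → inv F (G h) ≋ G (inv F h)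
  inv-commute l e h = ⊞-cong (e h) (≋sym (scale-op l _ h)) ∙≋ ≋sym (add-op l _ _)

  L-Ri : ∀ i j h → lm i (rmi j h) ≋ rmi j (lm i h)
  L-Ri i j h = ≋sym (inv-commute (L-lin i) (λ h → ≋sym (LR i j h)) h)

  Li-Ri : ∀ i j h → lmi i (rmi j h) ≋ rmi j (lmi i h)
  Li-Ri i j = inv-commute (inv-lin (R-lin j)) (L-Ri i j)

  -- Every T_w arises from `T1` by lengthening right multiplications, so a semilinear map is known
  -- from its value at `T1` and from the operator `G` into which it turns right multiplication.
  R-ext : ∀ {σ Φ Ψ} → σ 0# ≈ 0# → SemiLin σ Φ → SemiLin σ Ψ → (G : ℕ → HA → HA) → (∀ j {h g} → h ≋ g → G j h ≋ G j g) →
    (∀ j → suc j < n → ∀ h → Φ (rm j h) ≋ G j (Φ h)) → (∀ j → suc j < n → ∀ h → Ψ (rm j h) ≋ G j (Ψ h)) → Φ T1 ≋ Ψ T1 → ∀ h → Φ h ≋ Ψ h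
  R-ext {σ} {Φ} {Ψ} σ0 l m G G-cong cΦ cΨ base = semilin-ext σ0 l m λ p →
    perm-ind (λ w → Φ (T' w) ≋ Ψ (T' w)) base
      (λ j w u r d e → let t = T'-R j (unique-perms u) r d in
         cong-op l (≋sym t) ∙≋ cΦ j r _ ∙≋ G-cong j e ∙≋ ≋sym (cΨ j r _) ∙≋ cong-op m t)
      (perms-unique p)

  L-ext : ∀ {σ Φ Ψ} → σ 0# ≈ 0# → SemiLin σ Φ → SemiLin σ Ψ → (G : ℕ → HA → HA) → (∀ j {h g} → h ≋ g → G j h ≋ G j g) →
    (∀ j → suc j < n → ∀ h → Φ (lm j h) ≋ G j (Φ h)) → (∀ j → suc j < n → ∀ h → Ψ (lm j h) ≋ G j (Ψ h)) → Φ T1 ≋ Ψ T1 → ∀ h → Φ h ≋ Ψ h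
  L-ext {σ} {Φ} {Ψ} σ0 l m G G-cong cΦ cΨ base = semilin-ext σ0 l m
    (left-ind (λ w → Φ (T' w) ≋ Ψ (T' w)) base
      (λ j w p r d e → let t = T'-L j p d in
         cong-op l (≋sym t) ∙≋ cΦ j r _ ∙≋ G-cong j e ∙≋ ≋sym (cΨ j r _) ∙≋ cong-op m t))

  L-T1 : ∀ j → suc j < n → lm j T1 ≋ rm j T1
  L-T1 j r with descB j (idPerm n) in e
  ... | true = ⊥-elim (ℕP.0≢1+n (trans (sym (len-idPerm n)) (len-swapPos-desc j (idPerm n) e)))
  ... | false = T'-L j (id∈ n) (subst (λ z → len (idPerm n) < len z) (sym (sL-idPerm j)) (ℕP.≤-reflexive (sym (len-swapPos-asc j (idUnique n) r e))))
      ∙≋ mk (λ u _ → ≡⇒≈ (cong (λ z → T' z u) (sL-idPerm j))) ∙≋ ≋sym (T'-R j (id∈ n) r e)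

  -- Multiplication in the Hecke algebra

  W : Perm n → HA → HA
  W w g = foldr lm g (redWord w)

  infixl 7 _∙_
  _∙_ : HA → HA → HA
  (a ∙ g) u = Σ[ perms n ] (λ w → a w ⊛ W w g u)

  ∙-linʳ : ∀ a → Lin (a ∙_)
  ∙-linʳ a = record
    { cong-op = λ p → mk λ u q → Σ-cong {xs = perms n} λ w _ → *-congˡ (at (cong-op (l w) p) u q)
    ; add-op = λ h g → mk λ u q → ≈trans (Σ-cong {xs = perms n} λ w _ → ≈trans (*-congˡ (at (add-op (l w) h g) u q)) (distribˡ _ _ _)) (Σ-+ (perms n) _ _)
    ; scale-op = λ k h → mk λ u q → ≈trans (Σ-cong {xs = perms n} λ w _ → ≈trans (*-congˡ (at (scale-op (l w) k h) u q))
        (solve 3 (λ a k x → a :* (k :* x) := k :* (a :* x)) ≈refl (a w) k (W w h u))) (Σ-*ˡ (perms n) k _)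
    }
    where l : ∀ w → Lin (W w)
          l w = word-lin L-lin (redWord w)

  ∙-linˡ : ∀ g → Lin (_∙ g)
  ∙-linˡ g = record
    { cong-op = λ p → mk λ u q → Σ-cong {xs = perms n} λ w r → *-congʳ (at p w r)
    ; add-op = λ h g → mk λ u q → ≈trans (Σ-cong {xs = perms n} λ w _ → distribʳ _ _ _) (Σ-+ (perms n) _ _)
    ; scale-op = λ k h → mk λ u q → ≈trans (Σ-cong {xs = perms n} λ w _ → *-assoc _ _ _) (Σ-*ˡ (perms n) k _)
    }

  word-R : ∀ ω j g → foldr lm (rm j g) ω ≋ rm j (foldr lm g ω)
  word-R [] j g = ≋refl
  word-R (i ∷ ω) j g = cong-op (L-lin i) (word-R ω j g) ∙≋ LR i j _

  ∙-R : ∀ a j g → a ∙ rm j g ≋ rm j (a ∙ g)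
  ∙-R a j g = (mk λ u p → Σ-cong {xs = perms n} λ w _ → *-congˡ (at (word-R (redWord w) j g) u p))
    ∙≋ ≋sym (semilin-Σ ≈refl (R-lin j) (perms n) a (λ w → W w g))

  word-T1 : ∀ ω → LA.All (InR n) ω → length ω ≤ len (prod {n} ω) → foldr lm T1 ω ≋ T' (prod ω)
  word-T1 [] _ _ = ≋refl
  word-T1 (j ∷ ω) (r ∷ rs) l = cong-op (L-lin j) (word-T1 ω rs (ℕP.≤-pred (ℕP.≤-trans l (len-sL-≤ j (act-unique ω (idUnique n))))))
    ∙≋ T'-L j (act∈ ω (id∈ n)) (ℕP.≤-<-trans (len-prod ω) l)

  W-T1 : ∀ {w} → w ∈ perms n → W w T1 ≋ T' w
  W-T1 {w} p = subst (λ z → W w T1 ≋ T' z) (isProd r) (word-T1 (redWord w) (inRange r) (ℕP.≤-reflexive (trans (length≡ r) (cong len (sym (isProd r))))))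
    where r = redWord-red (perms-unique p)

  ∙-T1 : ∀ a → a ∙ T1 ≋ a
  ∙-T1 a = (mk λ u p → Σ-cong {xs = perms n} λ w q → *-congˡ (at (W-T1 q) u p)) ∙≋ mk λ u p → expand a p

  private
    ext : ∀ {Φ Ψ} → Lin Φ → Lin Ψ → (∀ j h → Φ (rm j h) ≋ rm j (Φ h)) → (∀ j h → Ψ (rm j h) ≋ rm j (Ψ h)) → Φ T1 ≋ Ψ T1 → ∀ h → Φ h ≋ Ψ h
    ext l m a b = R-ext ≈refl l m rm (λ j → cong-op (R-lin j)) (λ j _ → a j) (λ j _ → b j)

  -- As maps in g both sides commute with right multiplications, so g = T_1 suffices; there T_s may
  -- be moved from the right of T_1 to the left.
  R-∙ : ∀ j → suc j < n → ∀ a g → rm j a ∙ g ≋ a ∙ lm j g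
  R-∙ j r a = ext (∙-linʳ (rm j a)) (∘-lin (∙-linʳ a) (L-lin j)) (∙-R (rm j a))
    (λ i h → cong-op (∙-linʳ a) (LR j i h) ∙≋ ∙-R a i (lm j h))
    (∙-T1 (rm j a) ∙≋ cong-op (R-lin j) (≋sym (∙-T1 a)) ∙≋ ≋sym (∙-R a j T1) ∙≋ cong-op (∙-linʳ a) (≋sym (L-T1 j r)))

  L-∙ : ∀ j a g → lm j a ∙ g ≋ lm j (a ∙ g)
  L-∙ j a = ext (∙-linʳ (lm j a)) (∘-lin (L-lin j) (∙-linʳ a)) (∙-R (lm j a))
    (λ i h → cong-op (L-lin j) (∙-R a i h) ∙≋ LR j i (a ∙ h))
    (∙-T1 (lm j a) ∙≋ cong-op (L-lin j) (≋sym (∙-T1 a)))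

  -- The bar involution

  bar-0 : bar 0# ≈ 0#
  bar-0 = begin
    bar 0# ≈⟨ solve 1 (λ x → x := (x :+ x) :+ (:- x)) ≈refl (bar 0#) ⟩
    (bar 0# ⊕ bar 0#) ⊕ ⊖ bar 0# ≈⟨ +-congʳ (bar-+ 0# 0#) ⟨
    bar (0# ⊕ 0#) ⊕ ⊖ bar 0# ≈⟨ +-congʳ (bar-cong (+-identityˡ 0#)) ⟩
    bar 0# ⊕ ⊖ bar 0# ≈⟨ -‿inverseʳ _ ⟩
    0# ∎

  bar-neg : ∀ x → bar (⊖ x) ≈ ⊖ bar x
  bar-neg x = begin
    bar (⊖ x) ≈⟨ solve 2 (λ a b → a := (b :+ a) :+ (:- b)) ≈refl (bar (⊖ x)) (bar x) ⟩
    (bar x ⊕ bar (⊖ x)) ⊕ ⊖ bar x ≈⟨ +-congʳ (bar-+ _ _) ⟨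
    bar (x ⊕ ⊖ x) ⊕ ⊖ bar x ≈⟨ +-congʳ (≈trans (bar-cong (-‿inverseʳ x)) bar-0) ⟩
    0# ⊕ ⊖ bar x ≈⟨ +-identityˡ _ ⟩
    ⊖ bar x ∎

  bar-vi : bar vi ≈ v
  bar-vi = ≈trans (bar-cong (≈sym bar-v)) (bar-invol v)

  bar-ξ : bar ξ ≈ ⊖ ξ
  bar-ξ = ≈trans (bar-+ v (⊖ vi)) (≈trans (+-cong bar-v (≈trans (bar-neg vi) (-‿cong bar-vi))) (solve 2 (λ a b → b :- a := :- (a :- b)) ≈refl v vi))

  bar-κ : ∀ b → bar (κ (not b)) ≈ κ b ⊕ ⊖ ξ
  bar-κ true = ≈trans bar-0 (≈sym (-‿inverseʳ ξ))
  bar-κ false = ≈trans bar-ξ (≈sym (+-identityˡ _))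

  -- Since T_{w⁻¹}⁻¹ T_{w₀} = T_{w w₀} and reversal of one-line notation is right multiplication by
  -- w₀, multiplying bar(h) by T_{w₀} reduces to a change of indices and bar on coefficients.
  η : HA → HA
  η h u = bar (h (V.reverse u))

  η-semilin : SemiLin bar η
  η-semilin = record
    { cong-op = λ p → mk λ u q → bar-cong (at p (V.reverse u) (reverse∈ q))
    ; add-op = λ h g → mk λ u q → bar-+ _ _
    ; scale-op = λ k h → mk λ u q → bar-* _ _ }

  -- Reversal exchanges left ascents and descents, so the factor κ(not b) appears. Its bar is κ(b) -
  -- ξ because bar ξ = -ξ, and this is the diagonal factor of T_s⁻¹ = T_s - ξ.
  η-lm : ∀ j → suc j < n → ∀ h → η (lm j h) ≋ lmi j (η h)
  η-lm j r h = mk λ u p → begin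
    bar (lm j h (V.reverse u)) ≈⟨ bar-cong (lm-κ j h (V.reverse u)) ⟩
    bar (h (sL j (V.reverse u)) ⊕ κ (lenB j (V.reverse u)) ⊛ h (V.reverse u)) ≈⟨ ≈trans (bar-+ _ _) (+-congˡ (bar-* _ _)) ⟩
    bar (h (sL j (V.reverse u))) ⊕ bar (κ (lenB j (V.reverse u))) ⊛ η h u ≈⟨ +-cong (≡⇒≈ (cong (bar ∘ h) (VP.map-reverse (swapF j) u)))
                                                                                 (*-congʳ (≈trans (≡⇒≈ (cong (bar ∘ κ) (sL-reverse-<ᵇ j r (perms-unique p)))) (bar-κ (lenB j u)))) ⟩
    η h (sL j u) ⊕ (κ (lenB j u) ⊕ ⊖ ξ) ⊛ η h u ≈⟨ solve 4 (λ a k x b → a :+ (k :+ x) :* b := (a :+ k :* b) :+ x :* b) ≈refl (η h (sL j u)) (κ (lenB j u)) (⊖ ξ) (η h u) ⟩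
    (η h (sL j u) ⊕ κ (lenB j u) ⊛ η h u) ⊕ (⊖ ξ) ⊛ η h u ≈⟨ +-congʳ (lm-κ j (η h) u) ⟨
    lmi j (η h) u ∎

  T'-rword : ∀ {w} → w ∈ perms n → ∃ λ ω → LA.All (InR n) ω × (T' w ≋ List.foldl (λ g j → rm j g) T1 ω)
  T'-rword p = perm-ind (λ w → ∃ λ ω → LA.All (InR n) ω × (T' w ≋ List.foldl (λ g j → rm j g) T1 ω))
    ([] , [] , ≋refl)
    (λ { j w u r d (ω , rs , e) → ω ++ [ j ] , LAP.++⁺ rs (r ∷ [])
       , (≋sym (T'-R j (unique-perms u) r d) ∙≋ cong-op (R-lin j) e ∙≋ mk λ u _ → ≡⇒≈ (cong (λ z → z u) (sym (LP.foldl-++ (λ g j → rm j g) T1 ω [ j ])))) })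
    (perms-unique p)

  abstract
    w₀ : ∃ λ ω → LA.All (InR n) ω × (T' (V.reverse (idPerm n)) ≋ List.foldl (λ g j → rm j g) T1 ω)
    w₀ = T'-rword (reverse∈ (id∈ n))

    undo : HA → HA
    undo g = foldr rmi g (proj₁ w₀)

    undo-lin : Lin undo
    undo-lin = word-lin (λ j → inv-lin (R-lin j)) (proj₁ w₀)

    -- Left multiplication by T_s turns into left multiplication by T_s⁻¹ under h ↦ η h, because
    -- right multiplication by the longest element w₀ reverses the order; η h equals (bar h) T_{w₀}.
    β : HA → HA
    β h = undo (η h)

    β-semilin : SemiLin bar β
    β-semilin = ∘-semilin undo-lin η-semilin

    β-lm : ∀ j → suc j < n → ∀ h → β (lm j h) ≋ lmi j (β h)
    β-lm j r h = cong-op undo-lin (η-lm j r h) ∙≋ go (proj₁ w₀) (η h)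
      where
      go : ∀ ω g → foldr rmi (lmi j g) ω ≋ lmi j (foldr rmi g ω)
      go [] g = ≋refl
      go (i ∷ ω) g = cong-op (inv-lin (R-lin i)) (go ω g) ∙≋ ≋sym (Li-Ri j i _)

    β-T1 : β T1 ≋ T1
    β-T1 = cong-op undo-lin (η-T1 ∙≋ proj₂ (proj₂ w₀)) ∙≋ go (proj₁ w₀) (proj₁ (proj₂ w₀)) T1
      where
      η-T1 : η T1 ≋ T' (V.reverse (idPerm n))
      η-T1 = mk λ u p → bar-T u
        where
        bar-T : ∀ u → bar (T1 (V.reverse u)) ≈ T' (V.reverse (idPerm n)) u
        bar-T u with V.reverse u ≟V idPerm n
        ... | yes e = ≈trans bar-1 (≈sym (≈trans (≡⇒≈ (cong (T' (V.reverse (idPerm n))) (trans (sym (VP.reverse-involutive u)) (cong V.reverse e)))) (T'-self (V.reverse (idPerm n)))))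
        ... | no q = ≈trans bar-0 (≈sym (T'-other {V.reverse (idPerm n)} {u} λ e → q (trans (cong V.reverse e) (VP.reverse-involutive _))))
      go : ∀ ω → LA.All (InR n) ω → ∀ g → foldr rmi (List.foldl (λ g j → rm j g) g ω) ω ≋ g
      go [] _ g = ≋refl
      go (i ∷ ω) (r ∷ rs) g = cong-op (inv-lin (R-lin i)) (go ω rs (rm i g)) ∙≋ Ri-R i r g

  β-lmi : ∀ j → suc j < n → ∀ h → β (lmi j h) ≋ lm j (β h)
  β-lmi j r h = add-op β-semilin (lm j h) ((⊖ ξ) · h) ∙≋ ⊞-cong (β-lm j r h) (scale-op β-semilin (⊖ ξ) h) ∙≋ mk λ u p →
    ≈trans (+-congˡ (*-congʳ (≈trans (bar-neg ξ) (-‿cong bar-ξ)))) (solve 3 (λ a x b → (a :+ (:- x) :* b) :+ (:- (:- x)) :* b := a) ≈refl (lm j (β h) u) ξ (β h u))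

  τ : Perm n → HA
  τ w = foldr lmi T1 (redWord w)

  β-T' : ∀ {w} → w ∈ perms n → β (T' w) ≋ τ w
  β-T' {w} p = cong-op β-semilin (≋sym (W-T1 p)) ∙≋ go (redWord w) (inRange (redWord-red (perms-unique p)))
    where
    go : ∀ ω → LA.All (InR n) ω → β (foldr lm T1 ω) ≋ foldr lmi T1 ω
    go [] _ = β-T1
    go (j ∷ ω) (r ∷ rs) = β-lm j r _ ∙≋ cong-op (inv-lin (L-lin j)) (go ω rs)

  -- `τ w` is T_{w⁻¹}⁻¹, so the map built from w₀ is the bar involution as defined.
  β-formula : ∀ h → β h ≋ (λ u → Σ[ perms n ] (λ w → bar (h w) ⊛ τ w u))
  β-formula h = semilin-expand bar-0 β-semilin h ∙≋ mk λ u p → Σ-cong {xs = perms n} λ w q → *-congˡ (at (β-T' q) u p)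

  β-invol : ∀ h → β (β h) ≋ h
  β-invol = L-ext ≈refl
    (record { cong-op = cong-op β-semilin ∘ cong-op β-semilin
            ; add-op = λ h g → cong-op β-semilin (add-op β-semilin h g) ∙≋ add-op β-semilin _ _
            ; scale-op = λ k h → cong-op β-semilin (scale-op β-semilin k h) ∙≋ scale-op β-semilin _ _ ∙≋ ·-cong (bar-invol k) ≋refl })
    id-lin lm (λ j → cong-op (L-lin j)) (λ j r h → cong-op β-semilin (β-lm j r h) ∙≋ β-lmi j r (β h)) (λ _ _ _ → ≋refl)
    (cong-op β-semilin β-T1 ∙≋ β-T1)

  β-rm : ∀ j → suc j < n → ∀ h → β (rm j h) ≋ rmi j (β h)
  β-rm j r = L-ext bar-0 (semilin-∘ β-semilin (R-lin j)) (∘-semilin (inv-lin (R-lin j)) β-semilin) lmi (λ i → cong-op (inv-lin (L-lin i)))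
    (λ i s h → cong-op β-semilin (≋sym (LR i j h)) ∙≋ β-lm i s (rm j h))
    (λ i s h → cong-op (inv-lin (R-lin j)) (β-lm i s h) ∙≋ ≋sym (Li-Ri i j (β h)))
    (cong-op β-semilin (≋sym (L-T1 j r)) ∙≋ β-lm j r T1 ∙≋ cong-op (inv-lin (L-lin j)) β-T1
      ∙≋ ⊞-cong (L-T1 j r) ≋refl ∙≋ cong-op (inv-lin (R-lin j)) (≋sym β-T1))

  T1-∙ : ∀ g → T1 ∙ g ≋ g
  T1-∙ = R-ext ≈refl (∙-linʳ T1) id-lin rm (λ j → cong-op (R-lin j)) (λ j _ → ∙-R T1 j) (λ _ _ _ → ≋refl) (∙-T1 T1)

  β-∙ : ∀ a g → β (a ∙ g) ≋ β a ∙ β g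
  β-∙ a g = L-ext bar-0 (semilin-∘ β-semilin (∙-linˡ g)) (∘-semilin (∙-linˡ (β g)) β-semilin) lmi (λ i → cong-op (inv-lin (L-lin i)))
    (λ j r h → cong-op β-semilin (L-∙ j h g) ∙≋ β-lm j r (h ∙ g))
    (λ j r h → cong-op (∙-linˡ (β g)) (β-lm j r h) ∙≋ add-op (∙-linˡ (β g)) _ _ ∙≋ ⊞-cong (L-∙ j (β h) (β g)) (scale-op (∙-linˡ (β g)) _ _))
    (cong-op β-semilin (T1-∙ g) ∙≋ ≋sym (cong-op (∙-linˡ (β g)) β-T1 ∙≋ T1-∙ (β g))) a

  -- Each factor T_s⁻¹ = T_s - ξ raises lengths by at most one, and never through its diagonal part.
  -- At length at least that of the word, only the product of all letters survives.
  τ-top : ∀ ω {u} → u ∈ perms n → length ω ≤ len u → foldr lmi T1 ω u ≈ T' (prod ω) u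
  τ-top [] p _ = ≈refl
  τ-top (j ∷ ω) {u} p l = begin
    (lm j f u ⊕ (⊖ ξ) ⊛ f u) ≈⟨ +-cong (lm-κ j f u) (≈trans (*-congˡ fu) (zeroʳ _)) ⟩
    (f (sL j u) ⊕ κ (lenB j u) ⊛ f u) ⊕ 0# ≈⟨ +-identityʳ _ ⟩
    f (sL j u) ⊕ κ (lenB j u) ⊛ f u ≈⟨ +-congˡ (≈trans (*-congˡ fu) (zeroʳ _)) ⟩
    f (sL j u) ⊕ 0# ≈⟨ +-identityʳ _ ⟩
    f (sL j u) ≈⟨ τ-top ω (sL∈ j p) (ℕP.≤-pred (ℕP.≤-trans l (subst (λ z → len z ≤ suc (len (sL j u))) (sL-invol j u) (len-sL-≤ j (sL-unique j (perms-unique p)))))) ⟩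
    T' (prod ω) (sL j u) ≈⟨ T'-transport {prod ω} {sL j u} {prod (j ∷ ω)} {u} (λ h → trans (sym (sL-invol j u)) (cong (sL j) h)) (λ h → trans (cong (sL j) h) (sL-invol j _)) ⟩
    T' (prod (j ∷ ω)) u ∎
    where
    f = foldr lmi T1 ω
    fu : f u ≈ 0#
    fu = ≈trans (τ-top ω p (ℕP.≤-trans (ℕP.n≤1+n _) l)) (T'-other {prod ω} {u} λ { refl → ℕP.<⇒≱ l (len-prod ω) })

  τ-T' : ∀ {w u} → w ∈ perms n → u ∈ perms n → len w ≤ len u → τ w u ≈ T' w u
  τ-T' {w} {u} p q l = ≈trans (τ-top (redWord w) q (ℕP.≤-trans (ℕP.≤-reflexive (length≡ r)) l)) (≡⇒≈ (cong (λ z → T' z u) (isProd r)))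
    where r = redWord-red (perms-unique p)

  -- T_{w⁻¹}⁻¹ has no terms longer than w and agrees with T_w at that length. Where h vanishes on
  -- everything longer than u, bar h = h therefore compares a single coefficient with its own bar.
  bar-top : ∀ {h u} → β h ≋ h → u ∈ perms n → (∀ z → z ∈ perms n → len u < len z → h z ≈ 0#) → bar (h u) ≈ h u
  bar-top {h} {u} e p f = begin
    bar (h u) ≈⟨ *-identityʳ _ ⟨
    bar (h u) ⊛ 1# ≈⟨ *-congˡ (≈trans (τ-T' p p ℕP.≤-refl) (T'-self u)) ⟨
    bar (h u) ⊛ τ u u ≈⟨ Σ-perms-single p _ other ⟨
    Σ[ perms n ] (λ w → bar (h w) ⊛ τ w u) ≈⟨ at (β-formula h) u p ⟨
    β h u ≈⟨ at e u p ⟩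
    h u ∎
    where
    other : ∀ w → w ∈ perms n → w ≢ u → bar (h w) ⊛ τ w u ≈ 0#
    other w q w≢u with len w ℕ.≤? len u
    ... | yes l = ≈trans (*-congˡ (≈trans (τ-T' q p l) (T'-other (w≢u ∘ sym)))) (zeroʳ _)
    ... | no l = ≈trans (*-congʳ (≈trans (bar-cong (f w q (ℕP.≰⇒> l))) bar-0)) (zeroˡ _)

  -- Kazhdan-Lusztig elements: triangularity and right descents

  module KL (C : Perm n → HA) (C-bar : ∀ {w} → w ∈ perms n → β (C w) ≋ C w)
    (C-val : ∀ {w y} → w ∈ perms n → y ∈ perms n → Val 1 (C w y ⊕ ⊖ T' w y)) where

    C-val-other : ∀ {w y} → w ∈ perms n → y ∈ perms n → y ≢ w → Val 1 (C w y)
    C-val-other p q e = Val-cong (≈trans (+-congˡ (≈trans (-‿cong (T'-other e)) -0#≈0#)) (+-identityʳ _)) (C-val p q)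

    C-val-0 : ∀ {w y} → w ∈ perms n → y ∈ perms n → Val 0 (C w y)
    C-val-0 {w} {y} p q = Val-cong (solve 2 (λ a b → (a :- b) :+ b := a) ≈refl (C w y) (T' w y)) (Val-+ (Val-pred (C-val p q)) (T-val w y))
      where
      T-val : ∀ w y → Val 0 (T' w y)
      T-val w y with does (y ≟V w)
      ... | true = Val-1
      ... | false = Val-0 0

    -- Downward induction on length: at the longest remaining place the coefficient is bar invariant
    -- by `bar-top` and has positive valuation, hence is zero.
    C-off : ∀ {w} → w ∈ perms n → ∀ u → u ∈ perms n → u ≢ w → len w ≤ len u → C w u ≈ 0#
    C-off {w} p = desc-ind (λ u → u ≢ w → len w ≤ len u → C w u ≈ 0#) λ u q IH u≢w l →
      Val-bar (C-val-other p q u≢w) (bar-top (C-bar p) q λ z r l' → IH z r l' (λ { refl → ℕP.<⇒≱ l' l }) (ℕP.≤-trans l (ℕP.<⇒≤ l')))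

    C-diag : ∀ {w} → w ∈ perms n → C w w ≈ 1#
    C-diag {w} p = begin
      C w w ≈⟨ solve 2 (λ a b → a := (a :- b) :+ b) ≈refl (C w w) 1# ⟩
      (C w w ⊕ ⊖ 1#) ⊕ 1# ≈⟨ +-congʳ (Val-bar (Val-cong (+-congˡ (-‿cong (T'-self w))) (C-val p p)) b) ⟩
      0# ⊕ 1# ≈⟨ +-identityˡ _ ⟩
      1# ∎
      where
      b : bar (C w w ⊕ ⊖ 1#) ≈ C w w ⊕ ⊖ 1#
      b = ≈trans (bar-+ _ _) (+-cong (bar-top (C-bar p) p λ z r l → C-off p z r (λ { refl → ℕP.<-irrefl refl l }) (ℕP.<⇒≤ l)) (≈trans (bar-neg 1#) (-‿cong bar-1)))

    -- The element h = C_y (T_s + v⁻¹) is bar invariant. At u with us < u its coefficient C_y(us) +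
    -- v C_y(u) has positive valuation, because y descends at s and us does not, so us ≠ y. At other
    -- u it is v⁻¹ times the coefficient at the longer us. Downward induction gives h = 0.
    C-desc : ∀ {y} → y ∈ perms n → ∀ j → descB j y ≡ true → rm j (C y) ≋ (⊖ vi) · C y
    C-desc {y} p j d = mk λ u q → begin
      rm j (C y) u ≈⟨ solve 3 (λ a b c → a := (a :+ b :* c) :+ (:- b) :* c) ≈refl (rm j (C y) u) vi (C y u) ⟩
      h u ⊕ (⊖ vi) ⊛ C y u ≈⟨ +-congʳ (h-0 u q) ⟩
      0# ⊕ (⊖ vi) ⊛ C y u ≈⟨ +-identityˡ _ ⟩
      (⊖ vi) ⊛ C y u ∎
      where
      r : suc j < n
      r = descB-inRange j y d
      h : HA
      h = rm j (C y) ⊞ vi · C y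
      β-h : β h ≋ h
      β-h = add-op β-semilin _ _ ∙≋ ⊞-cong (β-rm j r (C y) ∙≋ cong-op (inv-lin (R-lin j)) (C-bar p)) (scale-op β-semilin vi (C y) ∙≋ ·-cong bar-vi (C-bar p))
        ∙≋ mk λ u q → solve 4 (λ a x y b → (a :+ (:- (x :- y)) :* b) :+ x :* b := a :+ y :* b) ≈refl (rm j (C y) u) v vi (C y u)
      false-other : ∀ {u} → descB j u ≡ false → u ≢ y
      false-other e refl with () ← trans (sym e) d
      high : ∀ {u} → u ∈ perms n → descB j u ≡ true → Val 1 (h u)
      high {u} q e = Val-cong (≈sym eq) (Val-+ (C-val-other p (swapPos∈ j q) (false-other (trans (descB-swapPos j (perms-unique q) r) (cong not e)))) (Val-* Val-v (C-val-0 p q)))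
        where
        eq : h u ≈ C y (swapPos j u) ⊕ v ⊛ C y u
        eq = ≈trans (+-congʳ (≈trans (rm-κ j (C y) u) (+-congˡ (*-congʳ (≡⇒≈ (cong κ e)))))) (solve 4 (λ a x y b → (a :+ (x :- y) :* b) :+ y :* b := a :+ x :* b) ≈refl (C y (swapPos j u)) v vi (C y u))
      lower : ∀ {u} → u ∈ perms n → descB j u ≡ false → h u ≈ vi ⊛ h (swapPos j u)
      lower {u} q e = ≈sym (begin
        vi ⊛ h u' ≈⟨ *-congˡ (+-congʳ (≈trans (rm-κ j (C y) u') (+-congˡ (*-congʳ (≡⇒≈ (cong κ e')))))) ⟩
        vi ⊛ ((C y (swapPos j u') ⊕ ξ ⊛ C y u') ⊕ vi ⊛ C y u') ≈⟨ solve 4 (λ a x y b → y :* ((a :+ (x :- y) :* b) :+ y :* b) := y :* a :+ (x :* y) :* b) ≈refl (C y (swapPos j u')) v vi (C y u') ⟩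
        vi ⊛ C y (swapPos j u') ⊕ (v ⊛ vi) ⊛ C y u' ≈⟨ +-cong (*-congˡ (≡⇒≈ (cong (C y) (swapPos-invol j u)))) (*-congʳ v*vi) ⟩
        vi ⊛ C y u ⊕ 1# ⊛ C y u' ≈⟨ +-congˡ (*-identityˡ _) ⟩
        vi ⊛ C y u ⊕ C y u' ≈⟨ solve 2 (λ a b → a :+ b := b :+ a) ≈refl (vi ⊛ C y u) (C y u') ⟩
        C y u' ⊕ vi ⊛ C y u ≈⟨ +-congʳ (≈trans (rm-κ j (C y) u) (≈trans (+-congˡ (≈trans (*-congʳ (≡⇒≈ (cong κ e))) (zeroˡ _))) (+-identityʳ _))) ⟨
        h u ∎)
        where
        u' = swapPos j u
        e' : descB j u' ≡ true
        e' = trans (descB-swapPos j (perms-unique q) r) (cong not e)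
      h-0 : ∀ u → u ∈ perms n → h u ≈ 0#
      h-0 = desc-ind (λ u → h u ≈ 0#) step
        where
        step : ∀ u → u ∈ perms n → (∀ z → z ∈ perms n → len u < len z → h z ≈ 0#) → h u ≈ 0#
        step u q IH = by-descent (descB j u) refl
          where
          by-descent : ∀ b → descB j u ≡ b → h u ≈ 0#
          by-descent true e = Val-bar (high q e) (bar-top β-h q IH)
          by-descent false e = ≈trans (lower q e) (≈trans (*-congˡ (IH _ (swapPos∈ j q) (ℕP.≤-reflexive (sym (len-swapPos-asc j (perms-unique q) r e))))) (zeroʳ _))

  -- Right-symmetric functions and the annihilator

  pw : ℕ → Carrier
  pw zero = 1#
  pw (suc k) = v ⊛ pw k

  Val-pw : ∀ k → Val k (pw k)
  Val-pw zero = Val-1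
  Val-pw (suc k) = Val-* Val-v (Val-pw k)

  vi-v : ∀ x → vi ⊛ (v ⊛ x) ≈ x
  vi-v x = ≈trans (solve 3 (λ a b c → b :* (a :* c) := (a :* b) :* c) ≈refl v vi x) (≈trans (*-congʳ v*vi) (*-identityˡ x))

  v-vi : ∀ x → v ⊛ (vi ⊛ x) ≈ x
  v-vi x = ≈trans (≈sym (*-assoc v vi x)) (≈trans (*-congʳ v*vi) (*-identityˡ x))

  v-cancel : ∀ {x} → v ⊛ x ≈ 0# → x ≈ 0#
  v-cancel {x} e = ≈trans (≈sym (vi-v x)) (≈trans (*-congˡ e) (zeroʳ _))

  pw-cancel : ∀ k {x} → pw k ⊛ x ≈ 0# → x ≈ 0#
  pw-cancel zero e = ≈trans (≈sym (*-identityˡ _)) e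
  pw-cancel (suc k) e = pw-cancel k (v-cancel (≈trans (≈sym (*-assoc _ _ _)) e))

  -- If (1 + e) x = 0, then y = x v^d satisfies y = -e y, so every valuation bound for y improves by
  -- one; d is chosen to make the first bound 0.
  regular : ∀ {e x} → Val 1 e → (1# ⊕ e) ⊛ x ≈ 0# → x ≈ 0#
  regular {e} {x} ve h with Val-bound x
  ... | d , f = pw-cancel d (≈trans (*-comm _ _) (Val-sep go))
    where
    y = x ⊛ pw d
    y≈ : ⊖ (e ⊛ y) ≈ y
    y≈ = begin
      ⊖ (e ⊛ (x ⊛ pw d)) ≈⟨ solve 3 (λ e x p → :- (e :* (x :* p)) := x :* p :- (x :+ e :* x) :* p) ≈refl e x (pw d) ⟩
      x ⊛ pw d ⊕ ⊖ ((x ⊕ e ⊛ x) ⊛ pw d) ≈⟨ +-congˡ (-‿cong (*-congʳ (≈trans (+-congʳ (≈sym (*-identityˡ x))) (≈trans (≈sym (distribʳ x 1# e)) h)))) ⟩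
      x ⊛ pw d ⊕ ⊖ (0# ⊛ pw d) ≈⟨ +-congˡ (≈trans (-‿cong (zeroˡ _)) -0#≈0#) ⟩
      x ⊛ pw d ⊕ 0# ≈⟨ +-identityʳ _ ⟩
      y ∎
    go : ∀ k → Val k y
    go zero = f (subst (λ i → Val i (pw d)) (sym (ℕP.+-identityʳ d)) (Val-pw d))
    go (suc k) = Val-cong y≈ (Val-neg (Val-* ve (go k)))

  regular-v+vi : ∀ {x} → (v ⊕ vi) ⊛ x ≈ 0# → x ≈ 0#
  regular-v+vi {x} h = regular {v ⊛ v} (Val-pred (Val-* Val-v Val-v)) (begin
    (1# ⊕ v ⊛ v) ⊛ x ≈⟨ *-congʳ (+-congʳ v*vi) ⟨
    (v ⊛ vi ⊕ v ⊛ v) ⊛ x ≈⟨ solve 3 (λ v w x → (v :* w :+ v :* v) :* x := v :* ((v :+ w) :* x)) ≈refl v vi x ⟩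
    v ⊛ ((v ⊕ vi) ⊛ x) ≈⟨ ≈trans (*-congˡ h) (zeroʳ _) ⟩
    0# ∎)

  op-eigen : ∀ s b h u → (b u ≡ false → h (s u) ≈ v ⊛ h u) → (b u ≡ true → h u ≈ v ⊛ h (s u)) → op s b h u ≈ v ⊛ h u
  op-eigen s b h u f g with b u
  ... | false = ≈trans (+-identityʳ _) (f refl)
  ... | true = begin
    h (s u) ⊕ ξ ⊛ h u ≈⟨ +-congʳ (vi-v _) ⟨
    vi ⊛ (v ⊛ h (s u)) ⊕ ξ ⊛ h u ≈⟨ +-congʳ (*-congˡ (g refl)) ⟨
    vi ⊛ h u ⊕ (v ⊕ ⊖ vi) ⊛ h u ≈⟨ solve 3 (λ v w x → w :* x :+ (v :- w) :* x := v :* x) ≈refl v vi (h u) ⟩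
    v ⊛ h u ∎

  fx : Perm n → Bool
  fx = fixesFromB m 0

  x' : HA
  x' u = if fx u then pw (len u) else 0#

  -- Satisfied by all elements of M = H x_α, which is what makes it a substitute for membership in
  -- M.
  RightSym : HA → Set _
  RightSym g = ∀ j → suc j < m → suc j < n → rm j g ≋ v · g

  x'-right : RightSym x'
  x'-right j r r' = mk λ u p → op-eigen (swapPos j) (descB j) x' u (asc u p) (desc u p)
    where
    asc : ∀ u → u ∈ perms n → descB j u ≡ false → x' (swapPos j u) ≈ v ⊛ x' u
    asc u p d rewrite fixes-swapPos m j u r with fx u
    ... | true rewrite len-swapPos-asc j (perms-unique p) r' d = ≈refl
    ... | false = ≈sym (zeroʳ _)
    desc : ∀ u → u ∈ perms n → descB j u ≡ true → x' u ≈ v ⊛ x' (swapPos j u)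
    desc u p d rewrite fixes-swapPos m j u r with fx u
    ... | true rewrite len-swapPos-desc j u d = ≈refl
    ... | false = ≈sym (zeroʳ _)

  x'-left : ∀ j → suc j < m → suc j < n → lm j x' ≋ v · x'
  x'-left j r r' = mk λ u p → op-eigen (sL j) (lenB j) x' u (asc u p) (desc u p)
    where
    asc : ∀ u → u ∈ perms n → lenB j u ≡ false → x' (sL j u) ≈ v ⊛ x' u
    asc u p d rewrite fixes-sL m j u r with fx u
    ... | false = ≈sym (zeroʳ _)
    ... | true with len-sL j r' (perms-unique p)
    ... | inj₁ e rewrite e = ≈refl
    ... | inj₂ e = ⊥-elim (ℕP.<⇒≱ (ℕP.≤-reflexive (sym e)) (<ᵇ-false⁻ d))
    desc : ∀ u → u ∈ perms n → lenB j u ≡ true → x' u ≈ v ⊛ x' (sL j u)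
    desc u p d rewrite fixes-sL m j u r with fx u
    ... | false = ≈sym (zeroʳ _)
    ... | true with len-sL j r' (perms-unique p)
    ... | inj₂ e rewrite e = ≈refl
    ... | inj₁ e = ⊥-elim (ℕP.<-asym (ℕP.≤-reflexive (sym e)) (<ᵇ-true⁻ d))

  right-T' : ∀ {g} → RightSym g → ∀ {w} → w ∈ perms n → fx w ≡ true → g ∙ T' w ≋ pw (len w) · g
  right-T' {g} rs p = perm-ind (λ w → fx w ≡ true → g ∙ T' w ≋ pw (len w) · g)
    (λ _ → ∙-T1 g ∙≋ mk λ u _ → ≈sym (≈trans (*-congʳ (≡⇒≈ (cong pw (len-idPerm n)))) (*-identityˡ _)))
    (λ j w u r d IH e → let
        r' = fixes-descent m j (swapPos-unique j u) e (trans (descB-swapPos j u r) (cong not d))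
        ih = IH (trans (sym (fixes-swapPos m j w r')) e)
      in cong-op (∙-linʳ g) (≋sym (T'-R j (unique-perms u) r d)) ∙≋ ∙-R g j (T' w) ∙≋ cong-op (R-lin j) ih
         ∙≋ scale-op (R-lin j) _ g ∙≋ ·-cong ≈refl (rs j r' r)
         ∙≋ mk λ z _ → ≈trans (solve 3 (λ a b c → a :* (b :* c) := (b :* a) :* c) ≈refl (pw (len w)) v (g z)) (*-congʳ (≡⇒≈ (cong pw (sym (len-swapPos-asc j u r d))))))
    (perms-unique p)

  -- The sum of v^{2ℓ(w)} over the parabolic subgroup, since `x'` is v^{ℓ(w)} there and zero
  -- elsewhere.
  Poincaré : Carrier
  Poincaré = Σ[ perms n ] (λ w → x' w ⊛ x' w)

  right-x' : ∀ {g} → RightSym g → g ∙ x' ≋ Poincaré · g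
  right-x' {g} rs = semilin-expand ≈refl (∙-linʳ g) x' ∙≋ mk λ u p →
    ≈trans (Σ-cong {xs = perms n} λ w q → ≈trans (term w q u p (fx w) refl) (≈sym (*-assoc _ _ _))) (Σ-*ʳ (perms n) (g u) (λ w → x' w ⊛ x' w))
    where
    term : ∀ w → w ∈ perms n → ∀ u → u ∈ perms n → ∀ b → fx w ≡ b → x' w ⊛ (g ∙ T' w) u ≈ x' w ⊛ (x' w ⊛ g u)
    term w q u p true e = *-congˡ (≈trans (at (right-T' rs q e) u p) (*-congʳ (≡⇒≈ (sym (cong (λ b → if b then pw (len w) else 0#) e)))))
    term w q u p false e = ≈trans (*-congʳ z) (≈trans (zeroˡ _) (≈sym (≈trans (*-congʳ z) (zeroˡ _))))
      where z : x' w ≈ 0#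
            z = ≡⇒≈ (cong (λ b → if b then pw (len w) else 0#) e)

  Val-Σ : ∀ {k} {X : Set} (xs : List X) {f} → (∀ x → x ∈ xs → Val k (f x)) → Val k (Σ[ xs ] f)
  Val-Σ [] _ = Val-0 _
  Val-Σ (x ∷ xs) h = Val-+ (h x (here refl)) (Val-Σ xs λ y p → h y (there p))

  Val-wk : ∀ {k x} j → Val (j + k) x → Val k x
  Val-wk zero p = p
  Val-wk (suc j) p = Val-wk j (Val-pred p)

  fx-id : fx (idPerm n) ≡ true
  fx-id = fixes-complete m 0 (idPerm n) λ p q _ → entry-id n p q
    where
    entry-map-suc : ∀ {n k} (u : Vec (Fin n) k) p → p < k → entry (V.map F.suc u) p ≡ suc (entry u p)
    entry-map-suc (a ∷ u) zero _ = refl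
    entry-map-suc (a ∷ u) (suc p) (s≤s q) = entry-map-suc u p q
    entry-id : ∀ n p → p < n → entry (idPerm n) p ≡ p
    entry-id (suc n) zero _ = refl
    entry-id (suc n) (suc p) (s≤s q) = trans (cong (λ z → entry z p) (allFin-suc n)) (trans (entry-map-suc (idPerm n) p q) (cong suc (entry-id n p q)))

  Poincaré-1 : ∃ λ e → Val 1 e × Poincaré ≈ 1# ⊕ e
  Poincaré-1 = Σ[ perms n ] (λ w → x' w ⊛ x' w ⊕ ⊖ T1 w) , Val-Σ (perms n) term , eq
    where
    term : ∀ w → w ∈ perms n → Val 1 (x' w ⊛ x' w ⊕ ⊖ T1 w)
    term w p = go (w ≟V idPerm n)
      where
      go : Dec (w ≡ idPerm n) → Val 1 (x' w ⊛ x' w ⊕ ⊖ T1 w)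
      go (yes refl) = Val-cong (≈sym (begin
        x' (idPerm n) ⊛ x' (idPerm n) ⊕ ⊖ T1 (idPerm n) ≈⟨ +-cong (*-cong one one) (-‿cong (T'-self (idPerm n))) ⟩
        1# ⊛ 1# ⊕ ⊖ 1# ≈⟨ +-congʳ (*-identityˡ 1#) ⟩
        1# ⊕ ⊖ 1# ≈⟨ -‿inverseʳ 1# ⟩
        0# ∎)) (Val-0 1)
        where one : x' (idPerm n) ≈ 1#
              one = ≡⇒≈ (trans (cong (λ b → if b then pw (len (idPerm n)) else 0#) fx-id) (cong pw (len-idPerm n)))
      go (no q) = Val-+ (Val-wk 1 (Val-* xv xv)) (Val-neg (Val-cong (≈sym (T'-other {idPerm n} {w} q)) (Val-0 1)))
        where
        pos : 1 ≤ len w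
        pos = ℕP.n≢0⇒n>0 λ e → q (len-0 (perms-unique p) e)
        xv : Val 1 (x' w)
        xv with fx w
        ... | false = Val-0 1
        ... | true = Val-wk (ℕ.pred (len w)) (subst (λ k → Val k (pw (len w))) (sym (trans (ℕP.+-comm (ℕ.pred (len w)) 1) (ℕP.suc-pred (len w) {{ℕ.>-nonZero pos}}))) (Val-pw (len w)))
    eq : Poincaré ≈ 1# ⊕ Σ[ perms n ] (λ w → x' w ⊛ x' w ⊕ ⊖ T1 w)
    eq = begin
      Poincaré ≈⟨ Σ-cong {xs = perms n} (λ w _ → solve 2 (λ a b → a := b :+ (a :- b)) ≈refl (x' w ⊛ x' w) (T1 w)) ⟩
      Σ[ perms n ] (λ w → T1 w ⊕ (x' w ⊛ x' w ⊕ ⊖ T1 w)) ≈⟨ Σ-+ (perms n) _ _ ⟩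
      Σ[ perms n ] T1 ⊕ Σ[ perms n ] (λ w → x' w ⊛ x' w ⊕ ⊖ T1 w) ≈⟨ +-congʳ (≈trans (Σ-perms-single (id∈ n) T1 λ w _ q → T'-other {idPerm n} {w} q) (T'-self (idPerm n))) ⟩
      1# ⊕ Σ[ perms n ] (λ w → x' w ⊛ x' w ⊕ ⊖ T1 w) ∎

  Ann : HA → Set _
  Ann a = ∀ h → a ∙ (h ∙ x') ≋ 0H

  right-∙x' : ∀ h → RightSym (h ∙ x')
  right-∙x' h j r r' = ≋sym (∙-R h j x') ∙≋ cong-op (∙-linʳ h) (x'-right j r r') ∙≋ scale-op (∙-linʳ h) v x'

  -- For the Poincaré polynomial P, P · (a g) = a (g x') = 0, and P is regular. Right symmetry is
  -- easily checked after left multiplication and under bar, whereas an expression as a multiple of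
  -- x' is not at hand there.
  Ann-right : ∀ {a} → Ann a → ∀ {g} → RightSym g → a ∙ g ≋ 0H
  Ann-right {a} aa {g} rs = mk λ u p → regular (proj₁ (proj₂ Poincaré-1)) (begin
    (1# ⊕ proj₁ Poincaré-1) ⊛ (a ∙ g) u ≈⟨ *-congʳ (proj₂ (proj₂ Poincaré-1)) ⟨
    Poincaré ⊛ (a ∙ g) u ≈⟨ at (scale-op (∙-linʳ a) Poincaré g) u p ⟨
    (a ∙ (Poincaré · g)) u ≈⟨ at (cong-op (∙-linʳ a) (right-x' rs)) u p ⟨
    (a ∙ (g ∙ x')) u ≈⟨ at (aa g) u p ⟩
    0# ∎)

  Ann-cong : ∀ {a b} → a ≋ b → Ann a → Ann b
  Ann-cong e aa h = cong-op (∙-linˡ (h ∙ x')) (≋sym e) ∙≋ aa h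

  Ann-⊞ : ∀ {a b} → Ann a → Ann b → Ann (a ⊞ b)
  Ann-⊞ aa ab h = add-op (∙-linˡ (h ∙ x')) _ _ ∙≋ ⊞-cong (aa h) (ab h) ∙≋ mk λ _ _ → +-identityˡ _

  Ann-· : ∀ k {a} → Ann a → Ann (k · a)
  Ann-· k aa h = scale-op (∙-linˡ (h ∙ x')) k _ ∙≋ ·-cong ≈refl (aa h) ∙≋ mk λ _ _ → zeroʳ _

  Ann-Σ : ∀ {X : Set} (xs : List X) (k : X → Carrier) (F : X → HA) → (∀ x → x ∈ xs → Ann (F x)) → Ann (λ u → Σ[ xs ] (λ x → k x ⊛ F x u))
  Ann-Σ [] k F _ h = semilin-zero ≈refl (∙-linˡ (h ∙ x'))
  Ann-Σ (x ∷ xs) k F f = Ann-⊞ {k x · F x} (Ann-· (k x) (f x (here refl))) (Ann-Σ xs k F λ y p → f y (there p))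

  Ann-rm : ∀ j → suc j < n → ∀ {a} → Ann a → Ann (rm j a)
  Ann-rm j r {a} aa h = R-∙ j r a (h ∙ x') ∙≋ Ann-right aa λ i s s' →
    ≋sym (LR j i _) ∙≋ cong-op (L-lin j) (right-∙x' h i s s') ∙≋ scale-op (L-lin j) v _

  Ann-β : ∀ {a} → Ann a → Ann (β a)
  Ann-β {a} aa h = ≋sym (β-∙ a (β g) ∙≋ cong-op (∙-linʳ (β a)) (β-invol g)) ∙≋ cong-op β-semilin (Ann-right aa rs) ∙≋ semilin-zero bar-0 β-semilin
    where
    g = h ∙ x'
    -- Under bar, g T_s = v g becomes bar(g) T_s⁻¹ = v⁻¹ bar(g); adding ξ bar(g) on both sides turns
    -- this into bar(g) T_s = v bar(g).
    rs : RightSym (β g)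
    rs j r r' = mk λ u p → begin
      rm j (β g) u ≈⟨ solve 3 (λ a x b → a := (a :+ (:- x) :* b) :+ x :* b) ≈refl (rm j (β g) u) ξ (β g u) ⟩
      rmi j (β g) u ⊕ ξ ⊛ β g u ≈⟨ +-congʳ (at (≋sym (β-rm j r' g) ∙≋ cong-op β-semilin (right-∙x' h j r r') ∙≋ scale-op β-semilin v g) u p) ⟩
      bar v ⊛ β g u ⊕ ξ ⊛ β g u ≈⟨ +-congʳ (*-congʳ bar-v) ⟩
      vi ⊛ β g u ⊕ (v ⊕ ⊖ vi) ⊛ β g u ≈⟨ solve 3 (λ v w x → w :* x :+ (v :- w) :* x := v :* x) ≈refl v vi (β g u) ⟩
      v ⊛ β g u ∎

  -- If y has too few ascents, two of the values u(1),…,u(m) lie in the same descending run of y.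
  module Pigeonhole (0<m : 0 < m) (m≤n : m ≤ n) (y : Perm n) (a : HA) (anti : ∀ t → descB t y ≡ true → rm t a ≋ (⊖ vi) · a)
    (few : ∀ t → t < n → suc (ascents y t) < m) where

    -- Two rules for `Z` are played against each other: lengthening u by s_t on the left, t a
    -- descent of y, multiplies by -v⁻¹; lengthening it by s_j in S_m on the right multiplies by v.
    Z : Perm n → HA
    Z u = a ∙ (T' u ∙ x')

    Z-left : ∀ t {u} → u ∈ perms n → descB t y ≡ true → len u < len (sL t u) → Z (sL t u) ≋ (⊖ vi) · Z u
    Z-left t {u} p d l = cong-op (∙-linʳ a) (cong-op (∙-linˡ x') (≋sym (T'-L t p l)) ∙≋ L-∙ t (T' u) x')
      ∙≋ ≋sym (R-∙ t (descB-inRange t y d) a (T' u ∙ x')) ∙≋ cong-op (∙-linˡ _) (anti t d) ∙≋ scale-op (∙-linˡ _) (⊖ vi) a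

    Z-right : ∀ j {u} → u ∈ perms n → suc j < m → descB j u ≡ false → Z (swapPos j u) ≋ v · Z u
    Z-right j {u} p r d = cong-op (∙-linʳ a)
      (cong-op (∙-linˡ x') (≋sym (T'-R j p r' d)) ∙≋ R-∙ j r' (T' u) x' ∙≋ cong-op (∙-linʳ (T' u)) (x'-left j r r') ∙≋ scale-op (∙-linʳ (T' u)) v x')
      ∙≋ scale-op (∙-linʳ a) v _
      where r' = ℕP.<-≤-trans r m≤n

    Z-equal : ∀ {u w} → u ≡ w → Z u ≋ Z w
    Z-equal refl = ≋refl

    Sorted : Perm n → Set
    Sorted u = ∀ j → suc j < m → descB j u ≡ false

    sorted-< : ∀ {u} → u ∈ perms n → Sorted u → ∀ p → suc p < m → entry u p < entry u (suc p)
    sorted-< {u} q s p r = ℕP.≤∧≢⇒< (<ᵇ-false⁻ (trans (sym (descB-entry p u r')) (s p r)))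
      λ e → ℕP.1+n≢n (sym (entry-injective (perms-unique q) p (suc p) (ℕP.<⇒≤ r') r' e))
      where r' = ℕP.<-≤-trans r m≤n

    -- The values at p and p + 1 lie in one descending run of y, with k values strictly between
    -- them. The larger one is lowered by s_t until they are neighbours; then s_t u = u s_p, so v
    -- Z(u) = -v⁻¹ Z(u), and v + v⁻¹ is regular.
    loop : ∀ k {u} → u ∈ perms n → Sorted u → ∀ p → suc p < m → entry u (suc p) ≡ suc (entry u p + k) →
      ascents y (entry u p) ≡ ascents y (entry u (suc p)) → Z u ≋ 0H
    loop k {u} q s p r e ea = go k e
      where
      r' = ℕP.<-≤-trans r m≤n
      t = entry u p + k
      t<n : suc t < n
      t<n = subst (_< n) e (entry< u (suc p) r')
      -- The ascent count is monotone and equal at both ends, hence constant in between; in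
      -- particular y descends at t.
      same : ascents y (entry u p) ≡ ascents y t × ascents y t ≡ ascents y (suc t)
      same = ℕP.≤-antisym (ascents-mono y (ℕP.m≤m+n (entry u p) k)) (ℕP.≤-trans (ascents-mono y (ℕP.n≤1+n t)) (ℕP.≤-reflexive (sym ea')))
           , ℕP.≤-antisym (ascents-mono y (ℕP.n≤1+n t)) (ℕP.≤-trans (ℕP.≤-reflexive (sym ea')) (ascents-mono y (ℕP.m≤m+n (entry u p) k)))
        where ea' : ascents y (entry u p) ≡ ascents y (suc t)
              ea' = trans ea (cong (ascents y) e)
      desc : descB t y ≡ true
      desc with descB t y in d
      ... | true = refl
      ... | false = ⊥-elim (ℕP.1+n≢n (trans (sym (ℕP.+-comm (ascents y t) 1)) (trans (sym (cong (λ b → ascents y t + (if b then 0 else 1)) d)) (sym (proj₂ same)))))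
      go : ∀ k' → entry u (suc p) ≡ suc (entry u p + k') → Z u ≋ 0H
      go zero e' = mk λ z pz → regular-v+vi (begin
          (v ⊕ vi) ⊛ Z u z ≈⟨ solve 3 (λ v w x → (v :+ w) :* x := v :* x :- (:- w) :* x) ≈refl v vi (Z u z) ⟩
          v ⊛ Z u z ⊕ ⊖ ((⊖ vi) ⊛ Z u z) ≈⟨ +-congʳ (at (≋sym (Z-right p q r (s p r)) ∙≋ Z-equal (sym swapped) ∙≋ Z-left t q desc longer) z pz) ⟩
          (⊖ vi) ⊛ Z u z ⊕ ⊖ ((⊖ vi) ⊛ Z u z) ≈⟨ -‿inverseʳ _ ⟩
          0# ∎)
        where
        k≡0 : k ≡ 0
        k≡0 = ℕP.+-cancelˡ-≡ (entry u p) _ _ (ℕP.suc-injective (trans (sym e) e'))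
        swapped : sL t u ≡ swapPos p u
        swapped = adjacent-swap t p (perms-unique q) r' t<n (sym (trans (cong (λ z → entry u p + z) k≡0) (ℕP.+-identityʳ _))) e
        longer : len u < len (sL t u)
        longer = subst (λ w → len u < len w) (sym swapped) (ℕP.≤-reflexive (sym (len-swapPos-asc p (perms-unique q) r' (s p r))))
      go (suc k') e' = step (len-sL t t<n (perms-unique q))
        where
        k≡ : k ≡ suc k'
        k≡ = ℕP.+-cancelˡ-≡ (entry u p) _ _ (ℕP.suc-injective (trans (sym e) e'))
        u' = sL t u
        q' = sL∈ t q
        a<t : entry u p < t
        a<t = ℕP.≤-trans (ℕP.≤-reflexive (ℕP.+-comm 1 _)) (ℕP.+-monoʳ-≤ (entry u p) (subst (1 ≤_) (sym k≡) (s≤s z≤n)))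
        e₁ : entry u' (suc p) ≡ t
        e₁ = entry-sL-down t u (suc p) e
        e₀ : entry u' p ≡ entry u p
        e₀ = entry-sL-fix t u p (ℕP.<⇒≢ a<t) (ℕP.<⇒≢ (ℕP.m<n⇒m<1+n a<t))
        -- s_t reverses only the order of t and t + 1. The value t + 1 stands at p + 1, and its
        -- sorted neighbours are below t or above t + 1, so no adjacent comparison changes.
        s' : Sorted u'
        s' j rj with descB-sL t j (perms-unique q)
        ... | inj₁ h = trans h (s j rj)
        ... | inj₂ h = ⊥-elim (bad (suc p ℕ.≟ j) (p ℕ.≟ j))
          where
          ej : entry (swapPos j u) (suc p) ≡ t
          ej = trans (cong (λ z → entry z (suc p)) (sym h)) e₁
          rj' = ℕP.<-≤-trans rj m≤n
          bad : Dec (suc p ≡ j) → Dec (p ≡ j) → ⊥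
          bad (yes refl) _ = ℕP.<⇒≢ (ℕP.<-trans (subst (t <_) (sym e) ℕP.≤-refl) (sorted-< q s j rj)) (sym (trans (sym (entry-swapPos-0 j u rj')) ej))
          bad (no _) (yes refl) = ℕP.<⇒≢ a<t (trans (sym (entry-swapPos-1 j u rj')) ej)
          bad (no x) (no x') = ℕP.1+n≢n (trans (sym (trans (entry-swapPos-fix j u (suc p) x (x' ∘ ℕP.suc-injective)) e)) ej)
        IH : Z u' ≋ 0H
        IH = loop k' q' s' p r (trans e₁ (trans (cong (λ z → entry u p + z) k≡) (trans (ℕP.+-suc _ k') (cong (λ z → suc (z + k')) (sym e₀)))))
               (trans (cong (ascents y) e₀) (trans (proj₁ same) (cong (ascents y) (sym e₁))))
        step : (len u' ≡ suc (len u)) ⊎ (len u ≡ suc (len u')) → Z u ≋ 0H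
        step (inj₁ l) = mk λ z pz → begin
          Z u z ≈⟨ v-vi (Z u z) ⟨
          v ⊛ (vi ⊛ Z u z) ≈⟨ solve 3 (λ v w x → v :* (w :* x) := (:- v) :* ((:- w) :* x)) ≈refl v vi (Z u z) ⟩
          (⊖ v) ⊛ ((⊖ vi) ⊛ Z u z) ≈⟨ *-congˡ (at (≋sym (Z-left t q desc (ℕP.≤-reflexive (sym l))) ∙≋ IH) z pz) ⟩
          (⊖ v) ⊛ 0# ≈⟨ zeroʳ _ ⟩
          0# ∎
        step (inj₂ l) = Z-equal (sym (sL-invol t u)) ∙≋ Z-left t q' desc (subst (λ w → len u' < len w) (sym (sL-invol t u)) (ℕP.≤-reflexive (sym l)))
          ∙≋ ·-cong ≈refl IH ∙≋ mk λ _ _ → zeroʳ _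

    -- If no two neighbours shared a run, the run numbers of the first m entries would increase
    -- strictly and reach at least m - 1, contradicting `few`.
    sorted-Z : ∀ {u} → u ∈ perms n → Sorted u → Z u ≋ 0H
    sorted-Z {u} q s with ℕP.anyUpTo? (λ p → (suc p ℕ.<? m) ×-dec (ascents y (entry u p) ℕ.≟ ascents y (entry u (suc p)))) m
    ... | yes (p , _ , r , e) = loop (entry u (suc p) ∸ suc (entry u p)) q s p r (sym (ℕP.m+[n∸m]≡n (sorted-< q s p r))) e
    ... | no none = absurd m refl
      where
      grow : ∀ p → p < m → p ≤ ascents y (entry u p)
      grow zero _ = z≤n
      grow (suc p) r = ℕP.≤-<-trans (grow p (ℕP.<⇒≤ r)) (ℕP.≤∧≢⇒< (ascents-mono y (ℕP.<⇒≤ (sorted-< q s p r))) λ e → none (p , ℕP.<⇒≤ r , r , e))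
      absurd : ∀ m' → m ≡ m' → Z u ≋ 0H
      absurd zero refl = ⊥-elim (ℕP.<-irrefl refl 0<m)
      absurd (suc m') refl = ⊥-elim (ℕP.<⇒≱ (few (entry u m') (entry< u m' m≤n)) (s≤s (grow m' ℕP.≤-refl)))

    -- Undoing descents among the first m positions changes `Z` only by powers of v.
    sort-Z : ∀ k {u} → u ∈ perms n → len u ≡ k → Z u ≋ 0H
    sort-Z k {u} q e with ℕP.anyUpTo? (λ j → (suc j ℕ.<? m) ×-dec (descB j u Bool.≟ true)) m
    ... | no none = sorted-Z q λ j r → ¬true (λ d → none (j , ℕP.<⇒≤ r , r , d))
      where ¬true : ∀ {b} → b ≢ true → b ≡ false
            ¬true {true} f = ⊥-elim (f refl)
            ¬true {false} _ = refl
    sort-Z zero {u} q e | yes (j , _ , r , d) with () ← trans (sym e) (len-swapPos-desc j u d)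
    sort-Z (suc k) {u} q e | yes (j , _ , r , d) = Z-equal (sym (swapPos-invol j u))
      ∙≋ Z-right j (swapPos∈ j q) r (trans (descB-swapPos j (perms-unique q) (ℕP.<-≤-trans r m≤n)) (cong not d))
      ∙≋ ·-cong ≈refl (sort-Z k (swapPos∈ j q) (ℕP.suc-injective (trans (sym (len-swapPos-desc j u d)) e))) ∙≋ mk λ _ _ → zeroʳ _

    annihilates : Ann a
    annihilates h = semilin-expand ≈refl (∘-lin (∙-linʳ a) (∙-linˡ x')) h ∙≋ mk λ u p →
      Σ-0 {xs = perms n} λ w q → ≈trans (*-congˡ (at (sort-Z (len w) q refl) u p)) (zeroʳ _)

  -- The star operation and lifts modulo v

  -- h C_s with C_s = T_s − v
  Cs : ℕ → HA → HA
  Cs j h = rm j h ⊞ (⊖ v) · h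

  Cs-low : ∀ j h {u} → descB j u ≡ false → Cs j h u ≈ h (swapPos j u) ⊕ (⊖ v) ⊛ h u
  Cs-low j h {u} d = +-congʳ (≈trans (rm-κ j h u) (≈trans (+-congˡ (≈trans (*-congʳ (≡⇒≈ (cong κ d))) (zeroˡ _))) (+-identityʳ _)))

  Cs-high : ∀ j h {u} → descB j u ≡ true → Cs j h u ≈ h (swapPos j u) ⊕ ⊖ (vi ⊛ h u)
  Cs-high j h {u} d = ≈trans (+-congʳ (≈trans (rm-κ j h u) (+-congˡ (*-congʳ (≡⇒≈ (cong κ d))))))
    (solve 4 (λ a v w b → (a :+ (v :- w) :* b) :+ (:- v) :* b := a :- w :* b) ≈refl (h (swapPos j u)) v vi (h u))

  -- `one` is the value that the ring solver gives to the constant 1, so that the polynomial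
  -- identities below match it literally.
  one D E : Carrier
  one = ιℤ (+ 1)
  D = one ⊕ (v ⊛ v ⊕ (v ⊛ v) ⊛ (v ⊛ v))
  E = v ⊕ v ⊛ (v ⊛ v)

  stage₁ : ℕ → HA → HA
  stage₁ j h = (⊖ v) · Cs j h

  stage₂ : ℕ → HA → HA
  stage₂ j h = Cs (suc j) (stage₁ j h)

  -- Right multiplication by an element of the Hecke algebra of ⟨s,t⟩ (s = s_j, t = s_{j+1}) that
  -- preserves ⊕ ℤ[v] T_w and modulo v acts as the star operation T_{ds} ↦ T_{dst}, T_{dts} ↦ T_{dt}
  -- and as 0 on the other basis elements of each coset: project to h C_s, multiply by C_t, and
  -- remove the sign component of ⟨s,t⟩ (D and E come from clearing the denominator 1 + v² + v⁴).
  star : ℕ → HA → HA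
  star j h = D · stage₂ j h ⊞ E · (Cs j (stage₂ j h) ⊞ (⊖ one) · stage₁ j h)

  Ann-Cs : ∀ j → suc j < n → ∀ {a} → Ann a → Ann (Cs j a)
  Ann-Cs j r {a} aa = Ann-⊞ (Ann-rm j r aa) (Ann-· (⊖ v) aa)

  Ann-star : ∀ j → suc (suc j) < n → ∀ {a} → Ann a → Ann (star j a)
  Ann-star j r {a} aa = Ann-⊞ (Ann-· D a₂) (Ann-· E (Ann-⊞ (Ann-Cs j (ℕP.<⇒≤ r) a₂) (Ann-· (⊖ one) a₁)))
    where
    a₁ : Ann (stage₁ j a)
    a₁ = Ann-· (⊖ v) (Ann-Cs j (ℕP.<⇒≤ r) aa)
    a₂ : Ann (stage₂ j a)
    a₂ = Ann-Cs (suc j) r a₁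

  module Coset (j : ℕ) (h : HA) {a b c : Fin n} {d : Perm n} (d-at : At j d a b c)
    (a<b : toℕ a < toℕ b) (b<c : toℕ b < toℕ c) where

    s t : Perm n → Perm n
    s = swapPos j
    t = swapPos (suc j)

    at₂ = at-s d-at
    at₃ = at-t d-at
    at₄ = at-t at₂
    at₅ = at-s at₃
    at₆ = at-s at₄

    dt : ∀ {x y : Fin n} → toℕ x < toℕ y → (x <f y) ≡ true
    dt = <ᵇ-true
    df : ∀ {x y : Fin n} → toℕ y < toℕ x → (x <f y) ≡ false
    df p = <ᵇ-false (ℕP.<⇒≤ p)
    a<c = ℕP.<-trans a<b b<c

    -- After projection to h C_s one parameter is left for each coset of ⟨s⟩. As C_t and C_s divide
    -- by v at descents, β' = v b' and γ = v² c' are rescaled to let the solver work without v⁻¹. In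
    -- the results b' and c' occur only as v b' and v² c', which have nonnegative valuation.
    a' β' γ b' c' : Carrier
    a' = h (s d) ⊕ ⊖ (v ⊛ h d)
    β' = h (s (t d)) ⊕ ⊖ (v ⊛ h (t d))
    γ = h (s (t (s d))) ⊕ ⊖ (v ⊛ h (t (s d)))
    b' = vi ⊛ β'
    c' = vi ⊛ (vi ⊛ γ)

    b-eq : β' ≈ v ⊛ b'
    b-eq = ≈sym (v-vi β')
    c-eq : γ ≈ v ⊛ (v ⊛ c')
    c-eq = ≈sym (≈trans (*-congˡ (v-vi (vi ⊛ γ))) (v-vi γ))

    h' = stage₁ j h
    g = stage₂ j h

    s₁-low : ∀ {u} → descB j u ≡ false → h' u ≈ ⊖ (v ⊛ (h (s u) ⊕ ⊖ (v ⊛ h u)))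
    s₁-low {u} e = ≈trans (*-congˡ (Cs-low j h e)) (solve 3 (λ v x y → (:- v) :* (x :+ (:- v) :* y) := :- (v :* (x :- v :* y))) ≈refl v (h (s u)) (h u))

    s₁-high : ∀ {u} → descB j u ≡ true → h' u ≈ h u ⊕ ⊖ (v ⊛ h (s u))
    s₁-high {u} e = ≈trans (*-congˡ (Cs-high j h e)) (≈trans (solve 4 (λ v w x y → (:- v) :* (x :- w :* y) := v :* (w :* y) :- v :* x) ≈refl v vi (h (s u)) (h u)) (+-congʳ (v-vi (h u))))

    ss : ∀ u → h (s (s u)) ≈ h u
    ss u = ≡⇒≈ (cong h (swapPos-invol j u))

    h₁ : h' d ≈ ⊖ (v ⊛ a')
    h₁ = s₁-low (trans (at-desc-s d-at) (df a<b))
    h₂ : h' (s d) ≈ a'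
    h₂ = ≈trans (s₁-high (trans (at-desc-s at₂) (dt a<b))) (+-congˡ (-‿cong (*-congˡ (ss d))))
    h₃ : h' (t d) ≈ ⊖ (v ⊛ (v ⊛ b'))
    h₃ = ≈trans (s₁-low (trans (at-desc-s at₃) (df a<c))) (-‿cong (*-congˡ b-eq))
    h₅ : h' (s (t d)) ≈ v ⊛ b'
    h₅ = ≈trans (s₁-high (trans (at-desc-s at₅) (dt a<c))) (≈trans (+-congˡ (-‿cong (*-congˡ (ss (t d))))) b-eq)
    h₄ : h' (t (s d)) ≈ ⊖ (v ⊛ (v ⊛ (v ⊛ c')))
    h₄ = ≈trans (s₁-low (trans (at-desc-s at₄) (df b<c))) (-‿cong (*-congˡ c-eq))
    h₆ : h' (s (t (s d))) ≈ v ⊛ (v ⊛ c')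
    h₆ = ≈trans (s₁-high (trans (at-desc-s at₆) (dt b<c))) (≈trans (+-congˡ (-‿cong (*-congˡ (ss (t (s d)))))) c-eq)

    th : ∀ u → h' (t (t u)) ≈ h' u
    th u = ≡⇒≈ (cong h' (swapPos-invol (suc j) u))

    g₁ : g d ≈ ⊖ (v ⊛ (v ⊛ b')) ⊕ (⊖ v) ⊛ (⊖ (v ⊛ a'))
    g₁ = ≈trans (Cs-low (suc j) h' (trans (at-desc-t d-at) (df b<c))) (+-cong h₃ (*-congˡ h₁))
    g₂ : g (s d) ≈ v ⊛ (⊖ (v ⊛ (v ⊛ c')) ⊕ ⊖ a')
    g₂ = ≈trans (Cs-low (suc j) h' (trans (at-desc-t at₂) (df a<c))) (≈trans (+-cong h₄ (*-congˡ h₂))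
      (solve 3 (λ v c a → :- (v :* (v :* (v :* c))) :+ (:- v) :* a := v :* (:- (v :* (v :* c)) :- a)) ≈refl v c' a'))
    g₃ : g (t d) ≈ v ⊛ b' ⊕ ⊖ (v ⊛ a')
    g₃ = ≈trans (Cs-high (suc j) h' (trans (at-desc-t at₃) (dt b<c))) (≈trans (+-cong (≈trans (th d) h₁) (-‿cong (*-congˡ h₃)))
      (≈trans (solve 4 (λ v w b a → :- (v :* a) :- w :* (:- (v :* (v :* b))) := w :* (v :* (v :* b)) :- v :* a) ≈refl v vi b' a') (+-congʳ (vi-v _))))
    g₄ : g (t (s d)) ≈ a' ⊕ v ⊛ (v ⊛ c')
    g₄ = ≈trans (Cs-high (suc j) h' (trans (at-desc-t at₄) (dt a<c))) (≈trans (+-cong (≈trans (th (s d)) h₂) (-‿cong (*-congˡ h₄)))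
      (≈trans (solve 4 (λ v w c a → a :- w :* (:- (v :* (v :* (v :* c)))) := a :+ w :* (v :* (v :* (v :* c)))) ≈refl v vi c' a') (+-congˡ (vi-v _))))
    t₅ : t (s (t d)) ≡ s (t (s d))
    t₅ = at-braid d-at
    g₅ : g (s (t d)) ≈ v ⊛ (v ⊛ c' ⊕ ⊖ (v ⊛ b'))
    g₅ = ≈trans (Cs-low (suc j) h' (trans (at-desc-t at₅) (df a<b))) (≈trans (+-cong (≈trans (≡⇒≈ (cong h' t₅)) h₆) (*-congˡ h₅))
      (solve 3 (λ v b c → v :* (v :* c) :+ (:- v) :* (v :* b) := v :* (v :* c :- v :* b)) ≈refl v b' c'))
    g₆ : g (s (t (s d))) ≈ v ⊛ (b' ⊕ ⊖ c')
    g₆ = ≈trans (Cs-high (suc j) h' (trans (at-desc-t at₆) (dt a<b))) (≈trans (+-cong (≈trans (≡⇒≈ (cong h' (trans (cong t (sym t₅)) (swapPos-invol (suc j) _)))) h₅) (-‿cong (*-congˡ h₆)))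
      (≈trans (+-congˡ (-‿cong (vi-v _))) (solve 3 (λ v b c → v :* b :- v :* c := v :* (b :- c)) ≈refl v b' c')))

    sg : ∀ u → g (s (s u)) ≈ g u
    sg u = ≡⇒≈ (cong g (swapPos-invol j u))

    k : HA
    k = star j h

    k-low : ∀ {u x y z} → descB j u ≡ false → g u ≈ x → g (s u) ≈ y → h' u ≈ z → k u ≈ D ⊛ x ⊕ E ⊛ ((y ⊕ (⊖ v) ⊛ x) ⊕ (⊖ one) ⊛ z)
    k-low e p q r = +-cong (*-congˡ p) (*-congˡ (+-cong (≈trans (Cs-low j g e) (+-cong q (*-congˡ p))) (*-congˡ r)))

    k-high : ∀ {u x y z} → descB j u ≡ true → g u ≈ v ⊛ x → g (s u) ≈ y → h' u ≈ z → k u ≈ D ⊛ (v ⊛ x) ⊕ E ⊛ ((y ⊕ ⊖ x) ⊕ (⊖ one) ⊛ z)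
    k-high e p q r = +-cong (*-congˡ p) (*-congˡ (+-cong (≈trans (Cs-high j g e) (+-cong q (-‿cong (≈trans (*-congˡ p) (vi-v _))))) (*-congˡ r)))

    private
      Dp Ep : ∀ {i} → Solver.Polynomial i → Solver.Polynomial i
      Dp v = con (+ 1) :+ (v :* v :+ (v :* v) :* (v :* v))
      Ep v = v :+ v :* (v :* v)

    k₁ : k d ≈ v ⊛ ⊖ (v ⊛ b' ⊕ ⊖ (v ⊛ a') ⊕ E ⊛ (v ⊛ (v ⊛ c')))
    k₁ = ≈trans (k-low (trans (at-desc-s d-at) (df a<b)) g₁ g₂ h₁)
      (solve 4 (λ v a b c → let x = :- (v :* (v :* b)) :+ (:- v) :* (:- (v :* a)) in
         Dp v :* x :+ Ep v :* ((v :* (:- (v :* (v :* c)) :- a) :+ (:- v) :* x) :+ (:- con (+ 1)) :* (:- (v :* a)))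
         := v :* (:- (v :* b :- v :* a :+ Ep v :* (v :* (v :* c))))) ≈refl v a' b' c')

    k₂ : k (s d) ≈ v ⊛ ⊖ (a' ⊕ E ⊛ (v ⊛ b') ⊕ (v ⊛ v) ⊛ (v ⊛ v) ⊛ (v ⊛ (v ⊛ c')))
    k₂ = ≈trans (k-high (trans (at-desc-s at₂) (dt a<b)) g₂ (≈trans (sg d) g₁) h₂)
      (solve 4 (λ v a b c → let x = :- (v :* (v :* c)) :- a in
         Dp v :* (v :* x) :+ Ep v :* (((:- (v :* (v :* b)) :+ (:- v) :* (:- (v :* a))) :- x) :+ (:- con (+ 1)) :* a)
         := v :* (:- (a :+ Ep v :* (v :* b) :+ (v :* v) :* (v :* v) :* (v :* (v :* c))))) ≈refl v a' b' c')

    -- Modulo v this is v b', that is h(dts), and `k₄` is a', that is h(ds); the other four values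
    -- vanish modulo v. These congruences are the star operation.
    k₃ : k (t d) ≈ v ⊛ b' ⊕ v ⊛ (⊖ a' ⊕ (one ⊕ v ⊛ v) ⊛ (v ⊛ (v ⊛ c')))
    k₃ = ≈trans (k-low (trans (at-desc-s at₃) (df a<c)) g₃ g₅ h₃)
      (solve 4 (λ v a b c → let x = v :* b :- v :* a in
         Dp v :* x :+ Ep v :* ((v :* (v :* c :- v :* b) :+ (:- v) :* x) :+ (:- con (+ 1)) :* (:- (v :* (v :* b))))
         := v :* b :+ v :* (:- a :+ (con (+ 1) :+ v :* v) :* (v :* (v :* c)))) ≈refl v a' b' c')

    k₄ : k (t (s d)) ≈ a' ⊕ v ⊛ ((one ⊕ v ⊛ v) ⊛ (v ⊛ b') ⊕ v ⊛ (v ⊛ v) ⊛ (v ⊛ (v ⊛ c')))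
    k₄ = ≈trans (k-low (trans (at-desc-s at₄) (df b<c)) g₄ g₆ h₄)
      (solve 4 (λ v a b c → let x = a :+ v :* (v :* c) in
         Dp v :* x :+ Ep v :* ((v :* (b :- c) :+ (:- v) :* x) :+ (:- con (+ 1)) :* (:- (v :* (v :* (v :* c)))))
         := a :+ v :* ((con (+ 1) :+ v :* v) :* (v :* b) :+ v :* (v :* v) :* (v :* (v :* c)))) ≈refl v a' b' c')

    k₅ : k (s (t d)) ≈ v ⊛ ⊖ (v ⊛ ((one ⊕ v ⊛ v) ⊛ a' ⊕ v ⊛ (v ⊛ v) ⊛ (v ⊛ b') ⊕ ⊖ (v ⊛ v ⊛ (v ⊛ (v ⊛ c')))))
    k₅ = ≈trans (k-high (trans (at-desc-s at₅) (dt a<c)) g₅ (≈trans (sg (t d)) g₃) h₅)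
      (solve 4 (λ v a b c → let x = v :* c :- v :* b in
         Dp v :* (v :* x) :+ Ep v :* (((v :* b :- v :* a) :- x) :+ (:- con (+ 1)) :* (v :* b))
         := v :* (:- (v :* ((con (+ 1) :+ v :* v) :* a :+ v :* (v :* v) :* (v :* b) :- (v :* v :* (v :* (v :* c))))))) ≈refl v a' b' c')

    k₆ : k (s (t (s d))) ≈ v ⊛ ((one ⊕ v ⊛ v) ⊛ a' ⊕ v ⊛ (v ⊛ v) ⊛ (v ⊛ b') ⊕ ⊖ (v ⊛ v ⊛ (v ⊛ (v ⊛ c'))))
    k₆ = ≈trans (k-high (trans (at-desc-s at₆) (dt b<c)) g₆ (≈trans (sg (t (s d))) g₄) h₆)
      (solve 4 (λ v a b c → let x = b :- c in
         Dp v :* (v :* x) :+ Ep v :* (((a :+ v :* (v :* c)) :- x) :+ (:- con (+ 1)) :* (v :* (v :* c)))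
         := v :* ((con (+ 1) :+ v :* v) :* a :+ v :* (v :* v) :* (v :* b) :- (v :* v :* (v :* (v :* c))))) ≈refl v a' b' c')

    module _ (h-val : ∀ u → u ∈ perms n → Val 0 (h u)) (p : d ∈ perms n) where

      Val-one : Val 0 one
      Val-one = Val-cong (≈sym ιℤ-1) Val-1
      V = Val-pred Val-v
      V² : Val 0 (v ⊛ v)
      V² = Val-* V V
      diff : ∀ {x y} → Val 0 x → Val 0 y → Val 0 (x ⊕ ⊖ (v ⊛ y))
      diff p q = Val-+ p (Val-neg (Val-* V q))
      pa' : Val 0 a'
      pa' = diff (h-val _ (swapPos∈ j p)) (h-val _ p)
      pβ : Val 0 (v ⊛ b')
      pβ = Val-cong b-eq (diff (h-val _ (swapPos∈ j (swapPos∈ (suc j) p))) (h-val _ (swapPos∈ (suc j) p)))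
      pγ : Val 0 (v ⊛ (v ⊛ c'))
      pγ = Val-cong c-eq (diff (h-val _ (swapPos∈ j (swapPos∈ (suc j) (swapPos∈ j p)))) (h-val _ (swapPos∈ (suc j) (swapPos∈ j p))))
      vE : Val 0 E
      vE = Val-+ V (Val-* V V²)
      p6 : Val 0 ((one ⊕ v ⊛ v) ⊛ a' ⊕ v ⊛ (v ⊛ v) ⊛ (v ⊛ b') ⊕ ⊖ (v ⊛ v ⊛ (v ⊛ (v ⊛ c'))))
      p6 = Val-+ (Val-+ (Val-* (Val-+ Val-one V²) pa') (Val-* (Val-* V V²) pβ)) (Val-neg (Val-* V² pγ))

      k₁-val : Val 1 (k d)
      k₁-val = Val-cong (≈sym k₁) (Val-* Val-v (Val-neg (Val-+ (Val-+ pβ (Val-neg (Val-* V pa'))) (Val-* vE pγ))))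
      k₂-val : Val 1 (k (s d))
      k₂-val = Val-cong (≈sym k₂) (Val-* Val-v (Val-neg (Val-+ (Val-+ pa' (Val-* vE pβ)) (Val-* (Val-* V² V²) pγ))))
      k₅-val : Val 1 (k (s (t d)))
      k₅-val = Val-cong (≈sym k₅) (Val-* Val-v (Val-neg (Val-* V p6)))
      k₆-val : Val 1 (k (s (t (s d))))
      k₆-val = Val-cong (≈sym k₆) (Val-* Val-v p6)
      k₃-val : Val 1 (k (t d) ⊕ ⊖ h (s (t d)))
      k₃-val = Val-cong (≈trans (solve 4 (λ x y v h → :- (v :* h) :+ y := ((x :- v :* h) :+ y) :- x) ≈refl (h (s (t d))) _ v (h (t d))) (+-congʳ (≈sym (≈trans k₃ (+-congʳ (≈sym b-eq))))))
        (Val-+ (Val-neg (Val-* Val-v (h-val _ (swapPos∈ (suc j) p)))) (Val-* Val-v (Val-+ (Val-neg pa') (Val-* (Val-+ Val-one V²) pγ))))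
      k₄-val : Val 1 (k (t (s d)) ⊕ ⊖ h (s d))
      k₄-val = Val-cong (≈trans (solve 4 (λ x y v h → :- (v :* h) :+ y := ((x :- v :* h) :+ y) :- x) ≈refl (h (s d)) _ v (h d)) (+-congʳ (≈sym k₄)))
        (Val-+ (Val-neg (Val-* Val-v (h-val _ p))) (Val-* Val-v (Val-+ (Val-* (Val-+ Val-one V²) pβ) (Val-* (Val-* V V²) pγ))))

  Approx : Perm n → HA → Set ℓ
  Approx y a = ∀ u → u ∈ perms n → Val 1 (a u ⊕ ⊖ T' y u)

  Lift : Perm n → Set _
  Lift y = ∃ λ a → Ann a × Approx y a

  Val-T' : ∀ w y → Val 0 (T' w y)
  Val-T' w y with does (y ≟V w)
  ... | true = Val-1
  ... | false = Val-0 0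

  approx-val : ∀ {y a} → Approx y a → ∀ u → u ∈ perms n → Val 0 (a u)
  approx-val {y} {a} ap u p = Val-cong (solve 2 (λ a b → (a :- b) :+ b := a) ≈refl (a u) (T' y u)) (Val-+ (Val-pred (ap u p)) (Val-T' y u))

  private
    via : ∀ {x y z w} → Val 1 (x ⊕ ⊖ y) → Val 1 (y ⊕ ⊖ z) → z ≈ w → Val 1 (x ⊕ ⊖ w)
    via {x} {y} {z} p q e = Val-cong (≈trans (solve 3 (λ x y z → (x :- y) :+ (y :- z) := x :- z) ≈refl x y z) (+-congˡ (-‿cong e))) (Val-+ p q)

    far : ∀ {x y u} → Val 1 x → u ≢ y → Val 1 (x ⊕ ⊖ T' y u)
    far p q = Val-+ p (Val-neg (Val-cong (≈sym (T'-other q)) (Val-0 1)))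

    mismatch : ∀ {j x y z x' y' z'} {u w : Perm n} → At j u x y z → At j w x' y' z' → (x ≡ x' → y ≡ y' → z ≡ z' → ⊥) → u ≢ w
    mismatch p q f refl with at-functional p q
    ... | e , e' , e'' = f e e' e''

    _↯_ : ∀ {x y : Fin n} → toℕ x < toℕ y → toℕ y < toℕ x → ⊥
    _↯_ = ℕP.<-asym

  -- In its coset y is ds and its image dst. The value at dt inherits the coefficient at dts, but
  -- comparing entries shows that dts is not y and dt is not the image.
  Lift-bac : ∀ {j y a b c} → At j y b a c → toℕ a < toℕ b → toℕ b < toℕ c → y ∈ perms n → Lift y → Lift (swapPos (suc j) y)
  Lift-bac {j} {y} q ab bc py (el , ael , ap) = star j el , Ann-star j r ael , λ u p → go u p (arrange j u p r)
    where
    r = at-range q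
    q' = at-t q
    go : ∀ u → u ∈ perms n → Arrangement j u → Val 1 (star j el u ⊕ ⊖ T' (swapPos (suc j) y) u)
    go u p (arr _ _ refl refl {d = d} dq xy yz pd w) = cases w
      where
      open Coset j el dq xy yz
      kv = approx-val {y} {el} ap
      cases : u ≡ d ⊎ u ≡ s d ⊎ u ≡ t d ⊎ u ≡ t (s d) ⊎ u ≡ s (t d) ⊎ u ≡ s (t (s d)) → Val 1 (star j el u ⊕ ⊖ T' (swapPos (suc j) y) u)
      cases (inj₁ refl) = far (k₁-val kv pd) (mismatch dq q' λ { refl refl refl → ab ↯ ℕP.<-trans xy yz })
      cases (inj₂ (inj₁ refl)) = far (k₂-val kv pd) (mismatch at₂ q' λ { refl refl refl → xy ↯ bc })
      cases (inj₂ (inj₂ (inj₁ refl))) = via (k₃-val kv pd) (ap _ (swapPos∈ j (swapPos∈ (suc j) pd)))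
        (≈trans (T'-other (mismatch at₅ q λ { refl refl refl → bc ↯ yz })) (≈sym (T'-other (mismatch at₃ q' λ { refl refl refl → ab ↯ xy }))))
      cases (inj₂ (inj₂ (inj₂ (inj₁ refl)))) = via (k₄-val kv pd) (ap _ (swapPos∈ j pd))
        (T'-transport {y} {s d} {t y} {t (s d)} (cong t) (λ e → trans (sym (swapPos-invol (suc j) _)) (trans (cong t e) (swapPos-invol (suc j) y))))
      cases (inj₂ (inj₂ (inj₂ (inj₂ (inj₁ refl))))) = far (k₅-val kv pd) (mismatch at₅ q' λ { refl refl refl → bc ↯ ℕP.<-trans xy yz })
      cases (inj₂ (inj₂ (inj₂ (inj₂ (inj₂ refl))))) = far (k₆-val kv pd) (mismatch at₆ q' λ { refl refl refl → bc ↯ yz })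

  -- The other half of the star operation: y is dts and its image dt.
  Lift-cab : ∀ {j y a b c} → At j y c a b → toℕ a < toℕ b → toℕ b < toℕ c → y ∈ perms n → Lift y → Lift (swapPos j y)
  Lift-cab {j} {y} q ab bc py (el , ael , ap) = star j el , Ann-star j r ael , λ u p → go u p (arrange j u p r)
    where
    r = at-range q
    q' = at-s q
    go : ∀ u → u ∈ perms n → Arrangement j u → Val 1 (star j el u ⊕ ⊖ T' (swapPos j y) u)
    go u p (arr _ _ refl refl {d = d} dq xy yz pd w) = cases w
      where
      open Coset j el dq xy yz
      kv = approx-val {y} {el} ap
      cases : u ≡ d ⊎ u ≡ s d ⊎ u ≡ t d ⊎ u ≡ t (s d) ⊎ u ≡ s (t d) ⊎ u ≡ s (t (s d)) → Val 1 (star j el u ⊕ ⊖ T' (swapPos j y) u)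
      cases (inj₁ refl) = far (k₁-val kv pd) (mismatch dq q' λ { refl refl refl → bc ↯ yz })
      cases (inj₂ (inj₁ refl)) = far (k₂-val kv pd) (mismatch at₂ q' λ { refl refl refl → xy ↯ ℕP.<-trans ab bc })
      cases (inj₂ (inj₂ (inj₁ refl))) = via (k₃-val kv pd) (ap _ (swapPos∈ j (swapPos∈ (suc j) pd)))
        (T'-transport {y} {s (t d)} {s y} {t d} (λ e → trans (sym (swapPos-invol j _)) (cong s e)) (λ e → trans (cong s e) (swapPos-invol j y)))
      cases (inj₂ (inj₂ (inj₂ (inj₁ refl)))) = via (k₄-val kv pd) (ap _ (swapPos∈ j pd))
        (≈trans (T'-other (mismatch at₂ q λ { refl refl refl → yz ↯ bc })) (≈sym (T'-other (mismatch at₄ q' λ { refl refl refl → ab ↯ xy }))))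
      cases (inj₂ (inj₂ (inj₂ (inj₂ (inj₁ refl))))) = far (k₅-val kv pd) (mismatch at₅ q' λ { refl refl refl → bc ↯ xy })
      cases (inj₂ (inj₂ (inj₂ (inj₂ (inj₂ refl))))) = far (k₆-val kv pd) (mismatch at₆ q' λ { refl refl refl → ab ↯ ℕP.<-trans xy yz })

  -- A linear functional is represented by its values on the basis T_w.

  ⟨_,_⟩ : HA → HA → Carrier
  ⟨ a , ψ ⟩ = Σ[ perms n ] (λ w → a w ⊛ ψ w)

  ⟨⟩-congˡ : ∀ {a b ψ} → a ≋ b → ⟨ a , ψ ⟩ ≈ ⟨ b , ψ ⟩
  ⟨⟩-congˡ e = Σ-cong {xs = perms n} λ w p → *-congʳ (at e w p)

  ⟨⟩-⊞ : ∀ a b ψ → ⟨ a ⊞ b , ψ ⟩ ≈ ⟨ a , ψ ⟩ ⊕ ⟨ b , ψ ⟩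
  ⟨⟩-⊞ a b ψ = ≈trans (Σ-cong {xs = perms n} λ w _ → distribʳ _ _ _) (Σ-+ (perms n) _ _)

  ⟨⟩-Σˡ : (k : Perm n → Carrier) (F : Perm n → HA) (ψ : HA) →
    ⟨ (λ u → Σ[ perms n ] (λ w → k w ⊛ F w u)) , ψ ⟩ ≈ Σ[ perms n ] (λ w → k w ⊛ ⟨ F w , ψ ⟩)
  ⟨⟩-Σˡ k F ψ = begin
    Σ[ perms n ] (λ u → Σ[ perms n ] (λ w → k w ⊛ F w u) ⊛ ψ u) ≈⟨ Σ-cong {xs = perms n} (λ u _ → ≈sym (Σ-*ʳ (perms n) (ψ u) (λ w → k w ⊛ F w u))) ⟩
    Σ[ perms n ] (λ u → Σ[ perms n ] (λ w → k w ⊛ F w u ⊛ ψ u)) ≈⟨ Σ-swap (perms n) (perms n) (λ u w → k w ⊛ F w u ⊛ ψ u) ⟩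
    Σ[ perms n ] (λ w → Σ[ perms n ] (λ u → k w ⊛ F w u ⊛ ψ u)) ≈⟨ Σ-cong {xs = perms n} (λ w _ → ≈trans (Σ-cong {xs = perms n} λ u _ → *-assoc _ _ _) (Σ-*ˡ (perms n) (k w) _)) ⟩
    Σ[ perms n ] (λ w → k w ⊛ ⟨ F w , ψ ⟩) ∎

  ⟨⟩-Σʳ : (k : Perm n → Carrier) (F : Perm n → HA) (a : HA) →
    ⟨ a , (λ u → Σ[ perms n ] (λ w → k w ⊛ F w u)) ⟩ ≈ Σ[ perms n ] (λ w → k w ⊛ ⟨ a , F w ⟩)
  ⟨⟩-Σʳ k F a = begin
    Σ[ perms n ] (λ u → a u ⊛ Σ[ perms n ] (λ w → k w ⊛ F w u)) ≈⟨ Σ-cong {xs = perms n} (λ u _ → ≈sym (Σ-*ˡ (perms n) (a u) (λ w → k w ⊛ F w u))) ⟩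
    Σ[ perms n ] (λ u → Σ[ perms n ] (λ w → a u ⊛ (k w ⊛ F w u))) ≈⟨ Σ-swap (perms n) (perms n) (λ u w → a u ⊛ (k w ⊛ F w u)) ⟩
    Σ[ perms n ] (λ w → Σ[ perms n ] (λ u → a u ⊛ (k w ⊛ F w u))) ≈⟨ Σ-cong {xs = perms n} (λ w _ → ≈trans (Σ-cong {xs = perms n} λ u _ → solve 3 (λ a k f → a :* (k :* f) := k :* (a :* f)) ≈refl (a u) (k w) (F w u)) (Σ-*ˡ (perms n) (k w) _)) ⟩
    Σ[ perms n ] (λ w → k w ⊛ ⟨ a , F w ⟩) ∎

  Kills : HA → Set _
  Kills ψ = ∀ a → Ann a → ⟨ a , ψ ⟩ ≈ 0#

  -- Pairing with a fixed functional loses a bounded power of v, since it has finitely many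
  -- coefficients.
  ⟨⟩-bound : ∀ ψ → ∃ λ d → ∀ {k} {e : HA} → (∀ w → w ∈ perms n → Val (d + k) (e w)) → Val k ⟨ e , ψ ⟩
  ⟨⟩-bound ψ = go (perms n)
    where
    go : ∀ xs → ∃ λ d → ∀ {k} {e : HA} → (∀ w → w ∈ xs → Val (d + k) (e w)) → Val k (Σ[ xs ] (λ w → e w ⊛ ψ w))
    go [] = 0 , λ _ → Val-0 _
    go (x ∷ xs) with Val-bound (ψ x) | go xs
    ... | d , f | d' , f' = d + d' , λ {k} {e} h → Val-+
      (Val-cong (*-comm _ _) (f (Val-wk d' (subst (λ i → Val i (e x)) (trans (cong (_+ k) (ℕP.+-comm d d')) (ℕP.+-assoc d' d k)) (h x (here refl))))))
      (f' λ w p → Val-wk d (subst (λ i → Val i (e w)) (ℕP.+-assoc d d' k) (h w (there p))))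

  -- The annihilator is pinned down from both sides: functionals ψ_x, dual to the C_x (x ∈ X) up to a
  -- unitriangular matrix, bound it from above, and lifts of the T_y (y ∉ X) modulo v from below.
  module Criterion
    (C : Perm n → HA) (C-bar : ∀ {w} → w ∈ perms n → β (C w) ≋ C w) (C-val : ∀ {w y} → w ∈ perms n → y ∈ perms n → Val 1 (C w y ⊕ ⊖ T' w y))
    (X : Perm n → Bool)
    (lift : ∀ {y} → y ∈ perms n → X y ≡ false → Lift y)
    (ψ : Perm n → HA)
    (ψ-kills : ∀ {x} → x ∈ perms n → X x ≡ true → Kills (ψ x))
    (ψ-diag : ∀ {x} → x ∈ perms n → X x ≡ true → ψ x x ≈ 1#)
    (ψ-off : ∀ {x w} → x ∈ perms n → X x ≡ true → w ∈ perms n → w ≢ x → len w ≤ len x → ψ x w ≈ 0#)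
    where
    module K = KL C C-bar C-val

    N : ℕ
    N = suc (tri n)

    -- Reversed length: ⟨C_u, ψ_w⟩ vanishes when u differs from w and is no longer than w, so the
    -- system is solved from short permutations to long ones.
    rank : Perm n → ℕ
    rank w = tri n ∸ len w

    -- The pairing matrix on X, completed by the identity so that one triangular system indexed by
    -- all permutations serves.
    M : Perm n → Perm n → Carrier
    M w u = if X w ∧ X u then ⟨ C u , ψ w ⟩ else T' w u

    -- C_u has no term longer than u, and ψ_w vanishes up to length ℓ(w) except at w; for u no
    -- longer than w only the term at w remains.
    C-ψ : ∀ {w u} → w ∈ perms n → u ∈ perms n → X w ≡ true → len u ≤ len w → ⟨ C u , ψ w ⟩ ≈ C u w ⊛ ψ w w
    C-ψ {w} {u} pw pu xw l = Σ-perms-single pw _ other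
      where
      other : ∀ z → z ∈ perms n → z ≢ w → C u z ⊛ ψ w z ≈ 0#
      other z pz z≢w with len z ℕ.≤? len w
      ... | yes l' = ≈trans (*-congˡ (ψ-off pw xw pz z≢w l')) (zeroʳ _)
      ... | no l' = ≈trans (*-congʳ (K.C-off pu z pz (λ { refl → l' l }) (ℕP.≤-trans l (ℕP.<⇒≤ (ℕP.≰⇒> l'))))) (zeroˡ _)

    M-diag : ∀ {u} → u ∈ perms n → M u u ≈ 1#
    M-diag {u} p = go (X u) refl
      where
      go : ∀ b → X u ≡ b → M u u ≈ 1#
      go true e rewrite e = ≈trans (C-ψ p p e ℕP.≤-refl) (≈trans (*-cong (K.C-diag p) (ψ-diag p e)) (*-identityˡ _))
      go false e rewrite e = T'-self u

    M-off : ∀ {w u} → w ∈ perms n → u ∈ perms n → w ≢ u → rank w ≤ rank u → M w u ≈ 0#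
    M-off {w} {u} pw pu w≢u l = go (X w) (X u) refl refl
      where
      l' : len u ≤ len w
      l' = ℕP.≮⇒≥ λ w<u → ℕP.<⇒≱ (ℕP.∸-monoʳ-< w<u (len-≤-tri pu)) l
      go : ∀ b b' → X w ≡ b → X u ≡ b' → M w u ≈ 0#
      go true true e e' rewrite e | e' = ≈trans (C-ψ pw pu e l') (≈trans (*-congʳ (K.C-off pu w pw w≢u l')) (zeroˡ _))
      go true false e e' rewrite e | e' = T'-other (w≢u ∘ sym)
      go false _ e e' rewrite e = T'-other (w≢u ∘ sym)

    rank<N : ∀ {u} → u ∈ perms n → rank u < N
    rank<N {u} _ = s≤s (ℕP.m∸n≤m (tri n) (len u))

    module Tri = Triangular N rank rank<N M M-diag M-off

    dual : ∀ {x} → x ∈ perms n → X x ≡ true → ∃ λ ψ' → Kills ψ' × (∀ u → u ∈ perms n → X u ≡ true → ⟨ C u , ψ' ⟩ ≈ T' x u)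
    dual {x} p xx with Tri.solvable (T' x)
    ... | k , h = (λ z → Σ[ perms n ] (λ w → k' w ⊛ ψ w z)) , kills , pairs
      where
      k' : Perm n → Carrier
      k' w = if X w then k w else 0#
      kills : Kills (λ z → Σ[ perms n ] (λ w → k' w ⊛ ψ w z))
      kills a aa = ≈trans (⟨⟩-Σʳ k' ψ a) (Σ-0 {xs = perms n} λ w pw → term w pw (X w) refl)
        where
        term : ∀ w → w ∈ perms n → ∀ b → X w ≡ b → k' w ⊛ ⟨ a , ψ w ⟩ ≈ 0#
        term w pw true e = ≈trans (*-congˡ (ψ-kills pw e a aa)) (zeroʳ _)
        term w pw false e rewrite e = zeroˡ _
      pairs : ∀ u → u ∈ perms n → X u ≡ true → ⟨ C u , (λ z → Σ[ perms n ] (λ w → k' w ⊛ ψ w z)) ⟩ ≈ T' x u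
      pairs u pu xu = ≈trans (⟨⟩-Σʳ k' ψ (C u)) (≈trans (Σ-cong {xs = perms n} λ w _ → term w (X w) refl) (h u pu))
        where
        term : ∀ w b → X w ≡ b → k' w ⊛ ⟨ C u , ψ w ⟩ ≈ k w ⊛ M w u
        term w true e rewrite e | xu = ≈refl
        term w false e rewrite e = ≈trans (zeroˡ _) (≈sym (≈trans (*-congˡ (T'-other {w} {u} λ { refl → false≢true (trans (sym e) xu) })) (zeroʳ _)))

    -- v-adic approximation of C_y modulo the annihilator
    record Expansion (y : Perm n) (k : ℕ) : Set (c ⊔ ℓ) where
      field
        coef : Perm n → Carrier
        coef-val : ∀ w → w ∈ perms n → Val 1 (coef w)
        coef-X : ∀ w → w ∈ perms n → X w ≡ false → coef w ≈ 0#
        ann rest : HA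
        isAnn : Ann ann
        rest-val : ∀ w → w ∈ perms n → Val k (rest w)
        total : C y ≋ (λ u → Σ[ perms n ] (λ w → coef w ⊛ C w u)) ⊞ (ann ⊞ rest)

    Ann-0 : Ann 0H
    Ann-0 h = semilin-zero ≈refl (∙-linˡ (h ∙ x'))

    -- Modulo v and the annihilator, T_w is C_w for w in X and zero otherwise; χ is 1 or 0
    -- accordingly.
    record Decomp (w : Perm n) : Set (c ⊔ ℓ) where
      field
        χ : Carrier
        χ-val : Val 0 χ
        χ-X : X w ≡ false → χ ≈ 0#
        ann rest : HA
        isAnn : Ann ann
        rest-val : ∀ u → u ∈ perms n → Val 1 (rest u)
        total : T' w ≋ χ · C w ⊞ (ann ⊞ rest)

    decomp : ∀ w → w ∈ perms n → Decomp w
    decomp w p = go (X w) refl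
      where
      go : ∀ b → X w ≡ b → Decomp w
      go true e = record
        { χ = 1# ; χ-val = Val-1 ; χ-X = λ e' → ⊥-elim (true≢false (trans (sym e) e')) ; ann = 0H ; isAnn = Ann-0
        ; rest = λ u → T' w u ⊕ ⊖ C w u
        ; rest-val = λ u q → Val-cong (solve 2 (λ a b → :- (a :- b) := b :- a) ≈refl (C w u) (T' w u)) (Val-neg (C-val p q))
        ; total = mk λ u q → ≈trans (solve 2 (λ a b → b := a :+ (b :- a)) ≈refl (C w u) (T' w u)) (+-cong (≈sym (*-identityˡ _)) (≈sym (+-identityˡ _))) }
      go false e with lift p e
      ... | a , aa , ap = record
        { χ = 0# ; χ-val = Val-0 0 ; χ-X = λ _ → ≈refl ; ann = a ; isAnn = aa
        ; rest = λ u → T' w u ⊕ ⊖ a u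
        ; rest-val = λ u q → Val-cong (solve 2 (λ a b → :- (a :- b) := b :- a) ≈refl (a u) (T' w u)) (Val-neg (ap u q))
        ; total = mk λ u q → ≈trans (solve 2 (λ a b → b := a :+ (b :- a)) ≈refl (a u) (T' w u)) (≈sym (≈trans (+-congʳ (zeroˡ _)) (+-identityˡ _))) }

    -- Coefficient functions have to be total, so vectors that are not permutations receive zero
    -- data.
    decomp' : ∀ w → ∃ λ (χ : Carrier) → ∃ λ (a : HA) → ∃ λ (e : HA) → w ∈ perms n →
      Val 0 χ × (X w ≡ false → χ ≈ 0#) × Ann a × (∀ u → u ∈ perms n → Val 1 (e u)) × T' w ≋ χ · C w ⊞ (a ⊞ e)
    decomp' w with distinctB w in eq
    ... | true = χ , ann , rest , λ _ → χ-val , χ-X , isAnn , rest-val , total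
      where
      open Decomp (decomp w (unique-perms (distinctB-sound w eq)))
    ... | false = 0# , 0H , 0H , λ p → ⊥-elim (false≢true (trans (sym eq) (distinctB-complete (perms-unique p))))

    spread : ∀ r x c a e → r ⊛ (x ⊛ c ⊕ (a ⊕ e)) ≈ (r ⊛ x) ⊛ c ⊕ (r ⊛ a ⊕ r ⊛ e)
    spread = solve 5 (λ r x c a e → r :* (x :* c :+ (a :+ e)) := (r :* x) :* c :+ (r :* a :+ r :* e)) ≈refl

    regroup : ∀ a b c d e → a ⊕ (b ⊕ (c ⊕ (d ⊕ e))) ≈ (a ⊕ c) ⊕ ((b ⊕ d) ⊕ e)
    regroup = solve 5 (λ a b c d e → a :+ (b :+ (c :+ (d :+ e))) := (a :+ c) :+ ((b :+ d) :+ e)) ≈refl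

    expansion : ∀ {y} → y ∈ perms n → X y ≡ false → ∀ k → Expansion y (suc k)
    expansion {y} p xy zero with lift p xy
    ... | a , aa , ap = record
      { coef = λ _ → 0# ; coef-val = λ _ _ → Val-0 1 ; coef-X = λ _ _ _ → ≈refl ; ann = a ; isAnn = aa
      ; rest = λ u → C y u ⊕ ⊖ a u
      ; rest-val = λ u q → Val-cong (solve 3 (λ c a t → (c :- t) :+ (:- (a :- t)) := c :- a) ≈refl (C y u) (a u) (T' y u)) (Val-+ (C-val p q) (Val-neg (ap u q)))
      ; total = mk λ u q → ≈trans (solve 2 (λ c a → c := a :+ (c :- a)) ≈refl (C y u) (a u)) (≈sym (≈trans (+-congʳ (Σ-0 {xs = perms n} λ w _ → zeroˡ _)) (+-identityˡ _))) }
    -- The error is written in the T_w and each T_w is replaced by its decomposition. The new error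
    -- gains a factor v, and the coefficients change only by multiples of the old error, so they
    -- keep positive valuation.
    expansion {y} p xy (suc k) = record
      { coef = λ w → E.coef w ⊕ E.rest w ⊛ χ w
      ; coef-val = λ w q → Val-+ (E.coef-val w q) (Val-wk k (subst (λ i → Val i (E.rest w ⊛ χ w)) (trans (ℕP.+-identityʳ (suc k)) (sym (ℕP.+-comm k 1))) (Val-* (E.rest-val w q) (proj₁ (prop w q)))))
      ; coef-X = λ w q xw → ≈trans (+-cong (E.coef-X w q xw) (≈trans (*-congˡ (proj₁ (proj₂ (prop w q)) xw)) (zeroʳ _))) (+-identityˡ _)
      ; ann = E.ann ⊞ (λ u → Σ[ perms n ] (λ w → E.rest w ⊛ a w u))
      ; isAnn = Ann-⊞ E.isAnn (Ann-Σ (perms n) E.rest a λ w q → proj₁ (proj₂ (proj₂ (prop w q))))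
      ; rest = λ u → Σ[ perms n ] (λ w → E.rest w ⊛ e w u)
      ; rest-val = λ u q → Val-Σ (perms n) λ w r → subst (λ i → Val i (E.rest w ⊛ e w u)) (ℕP.+-comm (suc k) 1) (Val-* (E.rest-val w r) (proj₁ (proj₂ (proj₂ (proj₂ (prop w r)))) u q))
      ; total = E.total ∙≋ mk λ u q → begin
          Σ[ perms n ] (λ w → E.coef w ⊛ C w u) ⊕ (E.ann u ⊕ E.rest u)
            ≈⟨ +-congˡ (+-congˡ (≈trans (≈sym (expand E.rest q)) (Σ-cong {xs = perms n} λ w r → ≈trans (*-congˡ (at (proj₂ (proj₂ (proj₂ (proj₂ (prop w r))))) u q))
                 (spread (E.rest w) (χ w) (C w u) (a w u) (e w u))))) ⟩
          Σ[ perms n ] (λ w → E.coef w ⊛ C w u) ⊕ (E.ann u ⊕ Σ[ perms n ] (λ w → (E.rest w ⊛ χ w) ⊛ C w u ⊕ (E.rest w ⊛ a w u ⊕ E.rest w ⊛ e w u)))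
            ≈⟨ +-congˡ (+-congˡ (≈trans (Σ-+ (perms n) _ _) (+-congˡ (Σ-+ (perms n) _ _)))) ⟩
          Σ[ perms n ] (λ w → E.coef w ⊛ C w u) ⊕ (E.ann u ⊕ (Σ[ perms n ] (λ w → (E.rest w ⊛ χ w) ⊛ C w u) ⊕ (Σ[ perms n ] (λ w → E.rest w ⊛ a w u) ⊕ Σ[ perms n ] (λ w → E.rest w ⊛ e w u))))
            ≈⟨ regroup _ _ _ _ _ ⟩
          (Σ[ perms n ] (λ w → E.coef w ⊛ C w u) ⊕ Σ[ perms n ] (λ w → (E.rest w ⊛ χ w) ⊛ C w u)) ⊕ ((E.ann u ⊕ Σ[ perms n ] (λ w → E.rest w ⊛ a w u)) ⊕ Σ[ perms n ] (λ w → E.rest w ⊛ e w u))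
            ≈⟨ +-congʳ (≈trans (≈sym (Σ-+ (perms n) _ _)) (Σ-cong {xs = perms n} λ w _ → ≈sym (distribʳ _ _ _))) ⟩
          Σ[ perms n ] (λ w → (E.coef w ⊕ E.rest w ⊛ χ w) ⊛ C w u) ⊕ ((E.ann u ⊕ Σ[ perms n ] (λ w → E.rest w ⊛ a w u)) ⊕ Σ[ perms n ] (λ w → E.rest w ⊛ e w u)) ∎
      }
      where
      module E = Expansion (expansion p xy k)
      χ : Perm n → Carrier
      χ w = proj₁ (decomp' w)
      a e : Perm n → HA
      a w = proj₁ (proj₂ (decomp' w))
      e w = proj₁ (proj₂ (proj₂ (decomp' w)))
      prop = λ w → proj₂ (proj₂ (proj₂ (decomp' w)))

    eval : ∀ {y k} (Ex : Expansion y k) {θ} → Kills θ → ⟨ C y , θ ⟩ ≈ Σ[ perms n ] (λ w → Expansion.coef Ex w ⊛ ⟨ C w , θ ⟩) ⊕ ⟨ Expansion.rest Ex , θ ⟩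
    eval {y} Ex {θ} ks = begin
      ⟨ C y , θ ⟩ ≈⟨ ⟨⟩-congˡ total ⟩
      ⟨ (λ u → Σ[ perms n ] (λ w → coef w ⊛ C w u)) ⊞ (ann ⊞ rest) , θ ⟩ ≈⟨ ⟨⟩-⊞ (λ u → Σ[ perms n ] (λ w → coef w ⊛ C w u)) (ann ⊞ rest) θ ⟩
      ⟨ (λ u → Σ[ perms n ] (λ w → coef w ⊛ C w u)) , θ ⟩ ⊕ ⟨ ann ⊞ rest , θ ⟩ ≈⟨ +-cong (⟨⟩-Σˡ coef C θ) (≈trans (⟨⟩-⊞ ann rest θ) (≈trans (+-congʳ (ks ann isAnn)) (+-identityˡ _))) ⟩
      Σ[ perms n ] (λ w → coef w ⊛ ⟨ C w , θ ⟩) ⊕ ⟨ rest , θ ⟩ ∎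
      where open Expansion Ex

    abstract
      dual' : ∀ x → ∃ λ ψ' → x ∈ perms n → X x ≡ true → Kills ψ' × (∀ u → u ∈ perms n → X u ≡ true → ⟨ C u , ψ' ⟩ ≈ T' x u)
      dual' x with distinctB x in eq
      ... | false = 0H , λ p → ⊥-elim (false≢true (trans (sym eq) (distinctB-complete (perms-unique p))))
      ... | true = go (X x) refl
        where
        go : ∀ b → X x ≡ b → ∃ λ ψ' → x ∈ perms n → X x ≡ true → Kills ψ' × (∀ u → u ∈ perms n → X u ≡ true → ⟨ C u , ψ' ⟩ ≈ T' x u)
        go true e = let (ψ' , h) = dual (unique-perms (distinctB-sound x eq)) e in ψ' , λ _ _ → h
        go false e = 0H , λ _ e' → ⊥-elim (false≢true (trans (sym e) e'))

    D' : Perm n → HA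
    D' x = proj₁ (dual' x)

    D'-eval : ∀ {x} → x ∈ perms n → X x ≡ true → (k : Perm n → Carrier) → (∀ w → w ∈ perms n → X w ≡ false → k w ⊛ ⟨ C w , D' x ⟩ ≈ 0#) →
      Σ[ perms n ] (λ w → k w ⊛ ⟨ C w , D' x ⟩) ≈ k x
    D'-eval {x} p xx k h = ≈trans (Σ-perms-single p _ λ w q w≢x → other w q w≢x (X w) refl)
      (≈trans (*-congˡ (≈trans (pair x p xx) (T'-self x))) (*-identityʳ _))
      where
      pair = proj₂ (proj₂ (dual' x) p xx)
      other : ∀ w → w ∈ perms n → w ≢ x → ∀ b → X w ≡ b → k w ⊛ ⟨ C w , D' x ⟩ ≈ 0#
      other w q w≢x true e = ≈trans (*-congˡ (≈trans (pair w q e) (T'-other w≢x))) (zeroʳ _)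
      other w q w≢x false e = h w q e

    module Vanishing {y} (py : y ∈ perms n) (xy : X y ≡ false) where

      -- The exact value approximated by the coefficients of the expansions, taken as a pairing
      -- instead of a limit.
      κ' : Perm n → Carrier
      κ' x = if X x then ⟨ C y , D' x ⟩ else 0#

      κ'-false : ∀ {x} → X x ≡ false → κ' x ≈ 0#
      κ'-false e rewrite e = ≈refl

      κ'-true : ∀ {x} → X x ≡ true → κ' x ≈ ⟨ C y , D' x ⟩
      κ'-true e rewrite e = ≈refl

      κ'-val : ∀ {x} → x ∈ perms n → X x ≡ true → Val 1 (κ' x)
      κ'-val {x} p xx with ⟨⟩-bound (D' x)
      ... | d , f = Val-cong (≈sym (≈trans (κ'-true xx) (≈trans (eval Ex (proj₁ (proj₂ (dual' x) p xx)))
            (+-congʳ (D'-eval p xx coef λ w q e → ≈trans (*-congʳ (coef-X w q e)) (zeroˡ _))))))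
          (Val-+ (coef-val x p) (f λ w q → subst (λ i → Val i (rest w)) (sym (ℕP.+-comm d 1)) (rest-val w q)))
        where
        -- The depth d compensates the loss in the pairing, so that the error still contributes with
        -- positive valuation.
        Ex = expansion py xy d
        open Expansion Ex

      F : HA
      F = C y ⊞ (⊖ 1#) · (λ u → Σ[ perms n ] (λ w → κ' w ⊛ C w u))

      ⟨F⟩ : ∀ θ → ⟨ F , θ ⟩ ≈ ⟨ C y , θ ⟩ ⊕ ⊖ Σ[ perms n ] (λ w → κ' w ⊛ ⟨ C w , θ ⟩)
      ⟨F⟩ θ = ≈trans (⟨⟩-⊞ (C y) _ θ) (+-congˡ (≈trans (≈trans (Σ-cong {xs = perms n} λ w _ → *-assoc _ _ _) (Σ-*ˡ (perms n) (⊖ 1#) _))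
        (≈trans (≈sym (-‿distribˡ-* _ _)) (-‿cong (≈trans (*-identityˡ _) (⟨⟩-Σˡ κ' C θ))))))

      -- Correcting θ by the dual functionals gives a θ' that kills the annihilator and every C_x
      -- with x in X. In each expansion of C_y only the error is then seen, so ⟨C_y, θ'⟩ has
      -- arbitrarily high valuation and vanishes; it equals ⟨F, θ⟩.
      kills-F : ∀ θ → Kills θ → ⟨ F , θ ⟩ ≈ 0#
      kills-F θ ks = begin
        ⟨ F , θ ⟩ ≈⟨ ⟨F⟩ θ ⟩
        ⟨ C y , θ ⟩ ⊕ ⊖ Σ[ perms n ] (λ w → κ' w ⊛ ⟨ C w , θ ⟩) ≈⟨ +-congˡ (-‿cong (≈trans (Σ-cong {xs = perms n} λ w _ → swap-κ w (X w) refl) (≈sym (⟨⟩-Σʳ kθ D' (C y))))) ⟩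
        ⟨ C y , θ ⟩ ⊕ ⊖ ⟨ C y , θD ⟩ ≈⟨ ⟨θ'⟩ (C y) ⟨
        ⟨ C y , θ' ⟩ ≈⟨ Val-sep small ⟩
        0# ∎
        where
        kθ : Perm n → Carrier
        kθ w = if X w then ⟨ C w , θ ⟩ else 0#
        θD θ' : HA
        θD u = Σ[ perms n ] (λ w → kθ w ⊛ D' w u)
        θ' u = θ u ⊕ ⊖ θD u
        swap-κ : ∀ w b → X w ≡ b → κ' w ⊛ ⟨ C w , θ ⟩ ≈ kθ w ⊛ ⟨ C y , D' w ⟩
        swap-κ w true e rewrite e = *-comm _ _
        swap-κ w false e rewrite e = ≈trans (zeroˡ _) (≈sym (zeroˡ _))
        ⟨θ'⟩ : ∀ a → ⟨ a , θ' ⟩ ≈ ⟨ a , θ ⟩ ⊕ ⊖ ⟨ a , θD ⟩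
        ⟨θ'⟩ a = begin
          Σ[ perms n ] (λ u → a u ⊛ (θ u ⊕ ⊖ θD u)) ≈⟨ Σ-cong {xs = perms n} (λ u _ → solve 4 (λ a t d o → a :* (t :- d) := a :* t :+ (:- (a :* d))) ≈refl (a u) (θ u) (θD u) 0#) ⟩
          Σ[ perms n ] (λ u → a u ⊛ θ u ⊕ ⊖ (a u ⊛ θD u)) ≈⟨ Σ-+ (perms n) _ _ ⟩
          ⟨ a , θ ⟩ ⊕ Σ[ perms n ] (λ u → ⊖ (a u ⊛ θD u)) ≈⟨ +-congˡ (≈trans (Σ-cong {xs = perms n} λ u _ → ≈trans (-‿cong (≈sym (*-identityˡ _))) (-‿distribˡ-* _ _)) (Σ-*ˡ (perms n) (⊖ 1#) _)) ⟩
          ⟨ a , θ ⟩ ⊕ (⊖ 1#) ⊛ ⟨ a , θD ⟩ ≈⟨ +-congˡ (≈trans (≈sym (-‿distribˡ-* _ _)) (-‿cong (*-identityˡ _))) ⟩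
          ⟨ a , θ ⟩ ⊕ ⊖ ⟨ a , θD ⟩ ∎
        ⟨θD⟩ : ∀ a → ⟨ a , θD ⟩ ≈ Σ[ perms n ] (λ w → kθ w ⊛ ⟨ a , D' w ⟩)
        ⟨θD⟩ = ⟨⟩-Σʳ kθ D'
        kills' : Kills θ'
        kills' a aa = ≈trans (⟨θ'⟩ a) (≈trans (+-cong (ks a aa) (≈trans (-‿cong (≈trans (⟨θD⟩ a) (Σ-0 {xs = perms n} λ w q → term w q (X w) refl))) -0#≈0#)) (+-identityˡ _))
          where
          term : ∀ w → w ∈ perms n → ∀ b → X w ≡ b → kθ w ⊛ ⟨ a , D' w ⟩ ≈ 0#
          term w q true e = ≈trans (*-congˡ (proj₁ (proj₂ (dual' w) q e) a aa)) (zeroʳ _)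
          term w q false e rewrite e = zeroˡ _
        C-θ' : ∀ x → x ∈ perms n → X x ≡ true → ⟨ C x , θ' ⟩ ≈ 0#
        C-θ' x p xx = ≈trans (⟨θ'⟩ (C x)) (≈trans (+-congˡ (-‿cong (≈trans (⟨θD⟩ (C x)) (≈trans (Σ-perms-single p _ λ w q w≢x → other w q w≢x (X w) refl) self)))) (-‿inverseʳ _))
          where
          other : ∀ w → w ∈ perms n → w ≢ x → ∀ b → X w ≡ b → kθ w ⊛ ⟨ C x , D' w ⟩ ≈ 0#
          other w q w≢x true e = ≈trans (*-congˡ (≈trans (proj₂ (proj₂ (dual' w) q e) x p xx) (T'-other (w≢x ∘ sym)))) (zeroʳ _)
          other w q w≢x false e rewrite e = zeroˡ _
          self : kθ x ⊛ ⟨ C x , D' x ⟩ ≈ ⟨ C x , θ ⟩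
          self = ≈trans (*-cong (≡⇒≈ (cong (λ b → if b then ⟨ C x , θ ⟩ else 0#) xx)) (≈trans (proj₂ (proj₂ (dual' x) p xx) x p xx) (T'-self x))) (*-identityʳ _)
        small : ∀ k → Val k ⟨ C y , θ' ⟩
        small k with ⟨⟩-bound θ'
        ... | d , f = Val-cong (≈sym (≈trans (eval Ex kills') (≈trans (+-congʳ (Σ-0 {xs = perms n} λ w q → term w q (X w) refl)) (+-identityˡ _))))
              (f λ w q → Val-pred (rest-val w q))
          where
          Ex = expansion py xy (d + k)
          open Expansion Ex
          term : ∀ w → w ∈ perms n → ∀ b → X w ≡ b → coef w ⊛ ⟨ C w , θ' ⟩ ≈ 0#
          term w q true e = ≈trans (*-congˡ (C-θ' w q e)) (zeroʳ _)
          term w q false e = ≈trans (*-congʳ (coef-X w q e)) (zeroˡ _)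

      -- Each coefficient of a (h x') is a functional of a, and the annihilator is the common kernel
      -- of these.
      Ann-F : Ann F
      Ann-F h = mk λ u p → kills-F (λ w → W w (h ∙ x') u) λ a aa → at (aa h) u p

      -- Pairing bar F, which lies in the annihilator, with the functional dual to C_x gives κ'(x) =
      -- bar κ'(x); positive valuation leaves only zero.
      κ'-0 : ∀ x → x ∈ perms n → κ' x ≈ 0#
      κ'-0 x p = go (X x) refl
        where
        go : ∀ b → X x ≡ b → κ' x ≈ 0#
        go false e = κ'-false e
        go true e = Val-bar (κ'-val p e) (≈sym (begin
          κ' x ≈⟨ κ'-true e ⟩
          ⟨ C y , D' x ⟩ ≈⟨ solve 2 (λ a b → a := (a :- b) :+ b) ≈refl _ (bar (κ' x)) ⟩
          (⟨ C y , D' x ⟩ ⊕ ⊖ bar (κ' x)) ⊕ bar (κ' x) ≈⟨ +-congʳ (≈trans (≈sym ⟨βF⟩) (proj₁ (proj₂ (dual' x) p e) (β F) (Ann-β Ann-F))) ⟩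
          0# ⊕ bar (κ' x) ≈⟨ +-identityˡ _ ⟩
          bar (κ' x) ∎))
          where
          βF : β F ≋ C y ⊞ (⊖ 1#) · (λ u → Σ[ perms n ] (λ w → bar (κ' w) ⊛ C w u))
          βF = add-op β-semilin _ _ ∙≋ ⊞-cong (C-bar py) (scale-op β-semilin (⊖ 1#) _ ∙≋ ·-cong (≈trans (bar-neg 1#) (-‿cong bar-1))
            (semilin-Σ bar-0 β-semilin (perms n) κ' C ∙≋ mk λ u q → Σ-cong {xs = perms n} λ w r → *-congˡ (at (C-bar r) u q)))
          ⟨βF⟩ : ⟨ β F , D' x ⟩ ≈ ⟨ C y , D' x ⟩ ⊕ ⊖ bar (κ' x)
          ⟨βF⟩ = ≈trans (⟨⟩-congˡ βF) (≈trans (⟨⟩-⊞ (C y) _ (D' x)) (+-congˡ (≈trans (≈trans (Σ-cong {xs = perms n} λ w _ → *-assoc _ _ _) (Σ-*ˡ (perms n) (⊖ 1#) _))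
            (≈trans (≈sym (-‿distribˡ-* _ _)) (-‿cong (≈trans (*-identityˡ _) (≈trans (⟨⟩-Σˡ (bar ∘ κ') C (D' x))
              (D'-eval p e (bar ∘ κ') λ w q e' → ≈trans (*-congʳ (≈trans (bar-cong (κ'-false e')) bar-0)) (zeroˡ _)))))))))

      Ann-C : Ann (C y)
      Ann-C = Ann-cong (mk λ u p → ≈trans (+-congˡ (≈trans (*-congˡ (Σ-0 {xs = perms n} λ w q → ≈trans (*-congʳ (κ'-0 w q)) (zeroˡ _))) (zeroʳ _))) (+-identityʳ _)) Ann-F

    C-triangular-off : ∀ {w u} → w ∈ perms n → u ∈ perms n → w ≢ u → len w ≤ len u → C w u ≈ 0#
    C-triangular-off p q e = K.C-off p _ q (e ∘ sym)

    module CTri = Triangular N len (λ p → s≤s (len-≤-tri p)) C K.C-diag C-triangular-off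

    -- The C_w form a basis by triangularity. Pairing with a dual functional reads off a coefficient
    -- in X, since the C_w with w outside X are already known to be killed.
    Ann-expansion : ∀ {a} → Ann a → ∃ λ (k : Perm n → Carrier) → (∀ x → x ∈ perms n → X x ≡ true → k x ≈ 0#)
      × (∀ u → u ∈ perms n → a u ≈ Σ[ perms n ] (λ w → k w ⊛ C w u))
    Ann-expansion {a} aa = k , zeros , λ u p → ≈sym (h u p)
      where
      solution : ∃ λ (k : Perm n → Carrier) → ∀ u → u ∈ perms n → Σ[ perms n ] (λ w → k w ⊛ C w u) ≈ a u
      solution = CTri.solvable a
      k = proj₁ solution
      h = proj₂ solution
      zeros : ∀ x → x ∈ perms n → X x ≡ true → k x ≈ 0#
      zeros x p xx = begin
        k x ≈⟨ D'-eval p xx k (λ w q e → ≈trans (*-congˡ (kills (C w) (Vanishing.Ann-C q e))) (zeroʳ _)) ⟨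
        Σ[ perms n ] (λ w → k w ⊛ ⟨ C w , D' x ⟩) ≈⟨ ⟨⟩-Σˡ k C (D' x) ⟨
        ⟨ (λ u → Σ[ perms n ] (λ w → k w ⊛ C w u)) , D' x ⟩ ≈⟨ ⟨⟩-congˡ (mk h) ⟩
        ⟨ a , D' x ⟩ ≈⟨ kills a aa ⟩
        0# ∎
        where kills = proj₁ (proj₂ (dual' x) p xx)

-- Knuth moves, in the direction of column words

infix 4 _⇝_ _⇝*_
data _⇝_ : List ℕ → List ℕ → Set where
  acb→cab : ∀ {x y z w} → x ≤ y → y < z → x ∷ z ∷ y ∷ w ⇝ z ∷ x ∷ y ∷ w
  bca→bac : ∀ {x y z w} → x < y → y ≤ z → y ∷ z ∷ x ∷ w ⇝ y ∷ x ∷ z ∷ w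
  _∷_ : ∀ a {w w'} → w ⇝ w' → a ∷ w ⇝ a ∷ w'

_⇝*_ : List ℕ → List ℕ → Set
_⇝*_ = Star _⇝_

cons* : ∀ a {w w'} → w ⇝* w' → a ∷ w ⇝* a ∷ w'
cons* a = gmap (a ∷_) (a ∷_)

data Dec↓ : List ℕ → Set where
  [] : Dec↓ []
  _∷_ : ∀ {x c} → LA.All (_< x) c → Dec↓ c → Dec↓ (x ∷ c)

-- b passes the next column entry s because its left neighbour a satisfies s < a ≤ b; after the move
-- s takes over the role of a.
slide : ∀ {a b} c {rest} → LA.All (_< a) c → Dec↓ c → a ≤ b → a ∷ b ∷ c ++ rest ⇝* a ∷ c ++ b ∷ rest
slide [] _ _ _ = ε
slide {a} (s ∷ c) (p ∷ ps) (q ∷ d) l = bca→bac p l ◅ cons* a (slide c q d (ℕP.≤-trans (ℕP.<⇒≤ p) l))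

-- Column insertion: a replaces the smallest entry not below it, which moves on to the next column.
-- The last four fields keep columns decreasing and allow a chain through the columns to be
-- repaired.
record Bumped (a : ℕ) (c : List ℕ) : Set where
  field
    column : List ℕ
    bumped : ℕ
    moves : ∀ rest → a ∷ c ++ rest ⇝* column ++ bumped ∷ rest
    column↓ : Dec↓ column
    a≤b : a ≤ bumped
    a∈col : a ∈ column
    keeps : ∀ {x} → x ∈ c → x ≡ bumped ⊎ x ∈ column
    bounded : ∀ {z} → a < z → LA.All (_< z) c → LA.All (_< z) column

lower-all : ∀ {x a c} → x < a → LA.All (_< x) c → LA.All (_< a) (x ∷ c)
lower-all l ps = l ∷ LA.map (λ p → ℕP.<-trans p l) ps

bump-head : ∀ {a x c} → a ≤ x → LA.All (_< a) c → Dec↓ c → Bumped a (x ∷ c)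
bump-head {a} {x} {c} l ps d = record
  { column = a ∷ c ; bumped = x ; moves = λ rest → slide c ps d l ; column↓ = ps ∷ d ; a≤b = l ; a∈col = here refl
  ; keeps = λ { (here e) → inj₁ e ; (there p) → inj₂ (there p) } ; bounded = λ { pa (_ ∷ qs) → pa ∷ qs } }

column-insert : ∀ a c → Dec↓ c → Dec↓ (a ∷ c) ⊎ Bumped a c
column-insert a [] _ = inj₁ ([] ∷ [])
column-insert a (x ∷ c) (p ∷ d) with x ℕ.<? a
... | yes l = inj₁ (lower-all l p ∷ p ∷ d)
column-insert a (x ∷ []) (p ∷ d) | no x≮a = inj₂ (bump-head (ℕP.≮⇒≥ x≮a) [] [])
column-insert a (x ∷ y ∷ c) (p ∷ d) | no x≮a with column-insert a (y ∷ c) d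
... | inj₁ (q ∷ _) = inj₂ (bump-head (ℕP.≮⇒≥ x≮a) q d)
column-insert a (x ∷ y ∷ c) ((y<x ∷ p) ∷ (q ∷ d)) | no x≮a | inj₂ B with y ℕ.<? a
... | yes y<a = inj₂ (bump-head (ℕP.≮⇒≥ x≮a) (lower-all y<a q) (q ∷ d))
... | no y≮a = inj₂ (record
  { column = x ∷ column ; bumped = bumped
  ; moves = λ rest → acb→cab (ℕP.≮⇒≥ y≮a) y<x ◅ cons* x (moves rest)
  ; column↓ = bounded (ℕP.≤-<-trans (ℕP.≮⇒≥ y≮a) y<x) (y<x ∷ p) ∷ column↓
  ; a≤b = a≤b ; a∈col = there a∈col
  ; keeps = λ { (here e) → inj₂ (here e) ; (there r) → map₂ there (keeps r) }
  ; bounded = λ { pa (px ∷ ps) → px ∷ bounded pa ps } })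
  where open Bumped B

-- One entry from each column, weakly increasing: it certifies an increasing subsequence as long as
-- the number of columns.
data Chain : ℕ → List (List ℕ) → Set where
  [] : ∀ {lo} → Chain lo []
  pick : ∀ {lo r c cs} → r ∈ c → lo ≤ r → Chain r cs → Chain lo (c ∷ cs)

chain-weaken : ∀ {lo lo' cs} → lo' ≤ lo → Chain lo cs → Chain lo' cs
chain-weaken _ [] = []
chain-weaken l (pick r q ch) = pick r (ℕP.≤-trans l q) ch

record Inserted (a : ℕ) (cs : List (List ℕ)) : Set where
  field
    columns : List (List ℕ)
    moves : a ∷ concat cs ⇝* concat columns
    all↓ : LA.All Dec↓ columns
    chain : ∀ {lo} → lo ≤ a → Chain lo cs → Chain lo columns

columns-insert : ∀ a cs → LA.All Dec↓ cs → Inserted a cs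
columns-insert a [] _ = record { columns = (a ∷ []) ∷ [] ; moves = ε ; all↓ = ([] ∷ []) ∷ [] ; chain = λ l _ → pick (here refl) l [] }
columns-insert a (c ∷ cs) (d ∷ ds) with column-insert a c d
... | inj₁ d' = record { columns = (a ∷ c) ∷ cs ; moves = ε ; all↓ = d' ∷ ds ; chain = λ { l (pick r q ch) → pick (there r) q ch } }
... | inj₂ B = record
  { columns = B.column ∷ I.columns
  ; moves = B.moves (concat cs) ◅◅ prefix B.column I.moves
  ; all↓ = B.column↓ ∷ I.all↓
  ; chain = ch }
  where
  module B = Bumped B
  module I = Inserted (columns-insert B.bumped cs ds)
  prefix : ∀ u {w w'} → w ⇝* w' → u ++ w ⇝* u ++ w'
  prefix [] s = s
  prefix (x ∷ u) s = cons* x (prefix u s)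
  ch : ∀ {lo} → lo ≤ a → Chain lo (c ∷ cs) → Chain lo (B.column ∷ I.columns)
  -- If the chain uses r ≥ a, then a can replace r. If r < a, then r is not the bumped entry and
  -- stays in its column.
  ch l (pick {r = r} rc q chn) with a ℕ.≤? r
  ... | yes a≤r = pick B.a∈col l (I.chain B.a≤b (chain-weaken a≤r chn))
  ... | no a≰r with B.keeps rc
  ... | inj₁ refl = ⊥-elim (a≰r B.a≤b)
  ... | inj₂ rc' = pick rc' q (I.chain (ℕP.≤-trans (ℕP.<⇒≤ (ℕP.≰⇒> a≰r)) B.a≤b) chn)

record ColumnWord (w : List ℕ) : Set where
  field
    columns : List (List ℕ)
    moves : w ⇝* concat columns
    all↓ : LA.All Dec↓ columns
    chain : Chain 0 columns

column-word : ∀ w → ColumnWord w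
column-word [] = record { columns = [] ; moves = ε ; all↓ = [] ; chain = [] }
column-word (a ∷ w) = record { columns = I.columns ; moves = cons* a W.moves ◅◅ I.moves ; all↓ = I.all↓ ; chain = I.chain z≤n W.chain }
  where module W = ColumnWord (column-word w)
        module I = Inserted (columns-insert a W.columns W.all↓)

-- Weakly increasing subsequences under Knuth moves

data WInc : ℕ → List ℕ → ℕ → Set where
  nil : ∀ {lo w} → WInc lo w 0
  skip : ∀ {lo x w k} → WInc lo w k → WInc lo (x ∷ w) k
  take : ∀ {lo x w k} → lo ≤ x → WInc x w k → WInc lo (x ∷ w) (suc k)

-- The chosen entries stay in order except in one case: when x, z are chosen in y x z, the choice in
-- y z x becomes y, z, and y > x respects the lower bound.
winc-move : ∀ {lo w w' k} → w ⇝ w' → WInc lo w' k → WInc lo w k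
winc-move (a ∷ s) nil = nil
winc-move (a ∷ s) (skip i) = skip (winc-move s i)
winc-move (a ∷ s) (take l i) = take l (winc-move s i)
winc-move (acb→cab x≤y y<z) nil = nil
winc-move (acb→cab x≤y y<z) (skip nil) = nil
winc-move (acb→cab x≤y y<z) (skip (skip i)) = skip (skip i)
winc-move (acb→cab x≤y y<z) (skip (take l i)) = take l (skip i)
winc-move (acb→cab x≤y y<z) (take l nil) = skip (take l nil)
winc-move (acb→cab x≤y y<z) (take l (skip nil)) = skip (take l nil)
winc-move (acb→cab x≤y y<z) (take l (skip (skip i))) = skip (take l (skip i))
winc-move (acb→cab x≤y y<z) (take l (skip (take l' i))) = ⊥-elim (ℕP.<⇒≱ y<z l')
winc-move (acb→cab x≤y y<z) (take l (take l' i)) = ⊥-elim (ℕP.<⇒≱ y<z (ℕP.≤-trans l' x≤y))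
winc-move (bca→bac x<y y≤z) nil = nil
winc-move (bca→bac x<y y≤z) (skip nil) = nil
winc-move (bca→bac x<y y≤z) (skip (skip nil)) = nil
winc-move (bca→bac x<y y≤z) (skip (skip (skip i))) = skip (skip (skip i))
winc-move (bca→bac x<y y≤z) (skip (skip (take l i))) = skip (take l (skip i))
winc-move (bca→bac x<y y≤z) (skip (take l nil)) = skip (skip (take l nil))
winc-move (bca→bac x<y y≤z) (skip (take l (skip i))) = skip (skip (take l i))
winc-move (bca→bac x<y y≤z) (skip (take l (take l' i))) = take (ℕP.≤-trans l (ℕP.<⇒≤ x<y)) (take y≤z (skip i))
winc-move (bca→bac x<y y≤z) (take l nil) = take l nil
winc-move (bca→bac x<y y≤z) (take l (skip nil)) = take l nil
winc-move (bca→bac x<y y≤z) (take l (skip (skip i))) = take l (skip (skip i))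
winc-move (bca→bac x<y y≤z) (take l (skip (take l' i))) = take l (take l' (skip i))
winc-move (bca→bac x<y y≤z) (take l (take l' i)) = ⊥-elim (ℕP.<⇒≱ x<y l')

winc-moves : ∀ {lo w w' k} → w ⇝* w' → WInc lo w' k → WInc lo w k
winc-moves ε i = i
winc-moves (s ◅ ss) i = winc-move s (winc-moves ss i)

winc-skip : ∀ {lo k} u {w} → WInc lo w k → WInc lo (u ++ w) k
winc-skip [] i = i
winc-skip (x ∷ u) i = skip (winc-skip u i)

chain-winc : ∀ {lo cs} → Chain lo cs → WInc lo (concat cs) (length cs)
chain-winc [] = nil
chain-winc (pick {c = c} p l ch) = go c p
  where
  go : ∀ c → _ ∈ c → WInc _ (c ++ _) (suc _)
  go (x ∷ c) (here refl) = take l (winc-skip c (chain-winc ch))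
  go (x ∷ c) (there p) = skip (go c p)

winc-trim : ∀ {lo w k} j → j ≤ k → WInc lo w k → WInc lo w j
winc-trim zero _ _ = nil
winc-trim (suc j) l (skip i) = skip (winc-trim (suc j) l i)
winc-trim (suc j) (s≤s l) (take q i) = take q (winc-trim j l i)

-- Row insertion

step : ℕ → List ℕ → List ℕ
step x [] = x ∷ []
step x (y ∷ ys) = if x <ᵇ y then x ∷ ys else y ∷ step x ys

row₁ : List (List ℕ) → List ℕ
row₁ [] = []
row₁ (r ∷ _) = r

bump-step : ∀ x R → (bump x R ≡ nothing × step x R ≡ R ++ x ∷ []) ⊎ ∃ λ R' → ∃ λ y → bump x R ≡ just (R' , y) × step x R ≡ R' × length R' ≡ length R
bump-step x [] = inj₁ (refl , refl)
bump-step x (y ∷ ys) with x <ᵇ y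
... | true = inj₂ (x ∷ ys , y , refl , refl , refl)
... | false with bump-step x ys
... | inj₁ (e , e') rewrite e = inj₁ (refl , cong (y ∷_) e')
... | inj₂ (R' , z , e , e' , l) rewrite e = inj₂ (y ∷ R' , z , refl , cong (y ∷_) e' , cong suc l)

row₁-insert : ∀ x t → row₁ (rowInsert x t) ≡ step x (row₁ t)
row₁-insert x [] = refl
row₁-insert x (R ∷ t) with bump-step x R
... | inj₁ (e , e') rewrite e = sym e'
... | inj₂ (R' , z , e , e' , _) rewrite e = sym e'

total : List (List ℕ) → ℕ
total t = sum (List.map length t)

total-insert : ∀ x t → total (rowInsert x t) ≡ suc (total t)
total-insert x [] = refl
total-insert x (R ∷ t) with bump-step x R
... | inj₁ (e , _) rewrite e | LP.length-++ R {x ∷ []} = cong (_+ total t) (ℕP.+-comm (length R) 1)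
... | inj₂ (R' , y , e , _ , l) rewrite e | l = trans (cong (λ z → length R + z) (total-insert y t)) (ℕP.+-suc _ _)

NonEmpty : List ℕ → Set
NonEmpty R = 1 ≤ length R

nonempty-insert : ∀ x t → LA.All NonEmpty t → LA.All NonEmpty (rowInsert x t)
nonempty-insert x [] _ = s≤s z≤n ∷ []
nonempty-insert x (R ∷ t) (p ∷ ps) with bump-step x R
... | inj₁ (e , _) rewrite e = subst (1 ≤_) (sym (LP.length-++ R)) (ℕP.≤-trans p (ℕP.m≤m+n _ _)) ∷ ps
... | inj₂ (R' , y , e , _ , l) rewrite e = subst (1 ≤_) (sym l) p ∷ nonempty-insert y t ps

word : ∀ {n k} → Vec (Fin n) k → List ℕ
word v = List.map toℕ (V.toList v)

rows : List ℕ → List ℕ → List ℕ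
rows R w = List.foldl (λ R x → step x R) R w

head₀ : List ℕ → ℕ
head₀ [] = 0
head₀ (x ∷ _) = x

module _ {n : ℕ} where

  private
    insert : List (List ℕ) → Fin n → List (List ℕ)
    insert t a = rowInsert (toℕ a) t

  row₁-RSK : ∀ t (as : List (Fin n)) → row₁ (List.foldl insert t as) ≡ rows (row₁ t) (List.map toℕ as)
  row₁-RSK t [] = refl
  row₁-RSK t (a ∷ as) = trans (row₁-RSK (insert t a) as) (cong (λ R → rows R (List.map toℕ as)) (row₁-insert (toℕ a) t))

  total-RSK : ∀ t (as : List (Fin n)) → total (List.foldl insert t as) ≡ length as + total t
  total-RSK t [] = refl
  total-RSK t (a ∷ as) = trans (total-RSK (insert t a) as) (trans (cong (λ z → length as + z) (total-insert (toℕ a) t)) (ℕP.+-suc _ _))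

  nonempty-RSK : ∀ t (as : List (Fin n)) → LA.All NonEmpty t → LA.All NonEmpty (List.foldl insert t as)
  nonempty-RSK t [] p = p
  nonempty-RSK t (a ∷ as) p = nonempty-RSK (insert t a) as (nonempty-insert (toℕ a) t p)

  head-RSK : ∀ (w : Perm n) → head₀ (RSK w) ≡ length (rows [] (word w))
  head-RSK w = trans (head-map (List.foldl insert [] (V.toList w))) (cong length (row₁-RSK [] (V.toList w)))
    where head-map : ∀ t → head₀ (List.map length t) ≡ length (row₁ t)
          head-map [] = refl
          head-map (R ∷ t) = refl

-- Dominance over α(n,r) as a condition on the first row

psum-ones : ∀ k r → psum k (List.replicate r 1) ≤ k × psum k (List.replicate r 1) ≤ r
psum-ones zero r = z≤n , z≤n
psum-ones (suc k) zero = z≤n , z≤n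
psum-ones (suc k) (suc r) with psum-ones k r
... | p , q = s≤s p , s≤s q

psum-rows : ∀ k t → LA.All NonEmpty t → k ≤ psum k (List.map length t) ⊎ psum k (List.map length t) ≡ total t
psum-rows zero t _ = inj₁ z≤n
psum-rows (suc k) [] _ = inj₂ refl
psum-rows (suc k) (R ∷ t) (p ∷ ps) with psum-rows k t ps
... | inj₁ q = inj₁ (ℕP.+-mono-≤ p q)
... | inj₂ e = inj₂ (cong (λ z → length R + z) e)

dominates⇒ : ∀ n r (w : Perm n) → RSK w ⊵ α n r → n ∸ r ≤ head₀ (RSK w)
dominates⇒ n r w d = ℕP.≤-trans (ℕP.m≤m+n _ 0) (ℕP.≤-trans (d 1) (ℕP.≤-reflexive (psum-1 (RSK w))))
  where psum-1 : ∀ l → psum 1 l ≡ head₀ l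
        psum-1 [] = refl
        psum-1 (x ∷ l) = ℕP.+-identityʳ x

-- The parts of α(n,r) after the first are ones. The first k + 1 rows of a tableau with n boxes
-- either have k further boxes below the first row, one in each nonempty row, or are the whole
-- tableau.
dominates⇐ : ∀ n r (w : Perm n) → r < n → n ∸ r ≤ head₀ (RSK w) → RSK w ⊵ α n r
dominates⇐ n r w r<n h zero = z≤n
dominates⇐ n r w r<n h (suc k) = go (List.foldl (λ t a → rowInsert (toℕ a) t) [] (V.toList w)) h (nonempty-RSK [] (V.toList w) [])
    (trans (total-RSK [] (V.toList w)) (trans (ℕP.+-identityʳ _) (VP.length-toList w)))
  where
  go : ∀ t → n ∸ r ≤ head₀ (List.map length t) → LA.All NonEmpty t → total t ≡ n → psum (suc k) (α n r) ≤ psum (suc k) (List.map length t)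
  go [] h _ _ = ⊥-elim (ℕP.<⇒≱ (ℕP.m<n⇒0<n∸m r<n) h)
  go (R ∷ t) h (_ ∷ ps) e with psum-rows k t ps
  ... | inj₁ q = ℕP.+-mono-≤ h (ℕP.≤-trans (proj₁ (psum-ones k r)) q)
  ... | inj₂ e' = ℕP.≤-trans (ℕP.+-monoʳ-≤ (n ∸ r) (proj₂ (psum-ones k r)))
        (ℕP.≤-reflexive (trans (ℕP.m∸n+n≡m (ℕP.<⇒≤ r<n)) (trans (sym e) (cong (λ z → length R + z) (sym e')))))

-- The first row and the longest increasing subsequence

count≤ : ℕ → List ℕ → ℕ
count≤ b [] = 0
count≤ b (y ∷ ys) = (if b <ᵇ y then 0 else 1) + count≤ b ys

count-step-≥ : ∀ b x R → count≤ b R ≤ count≤ b (step x R)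
count-step-≥ b x [] = z≤n
count-step-≥ b x (y ∷ ys) with x <ᵇ y in e
... | false = ℕP.+-monoʳ-≤ (if b <ᵇ y then 0 else 1) (count-step-≥ b x ys)
... | true = ℕP.+-monoˡ-≤ (count≤ b ys) less
  where
  less : (if b <ᵇ y then 0 else 1) ≤ (if b <ᵇ x then 0 else 1)
  less with b <ᵇ x in e'
  ... | false with b <ᵇ y
  ... | true = z≤n
  ... | false = ℕP.≤-refl
  less | true rewrite <ᵇ-true (ℕP.<-trans (<ᵇ-true⁻ {b} {x} e') (<ᵇ-true⁻ {x} {y} e)) = z≤n

count-step-self : ∀ x R → suc (count≤ x R) ≤ count≤ x (step x R)
count-step-self x [] rewrite <ᵇ-false (ℕP.≤-refl {x}) = s≤s z≤n
count-step-self x (y ∷ ys) with x <ᵇ y in e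
... | true rewrite <ᵇ-false (ℕP.≤-refl {x}) = ℕP.≤-refl
... | false rewrite e = s≤s (count-step-self x ys)

count-mono : ∀ {a b} → a ≤ b → ∀ R → count≤ a R ≤ count≤ b R
count-mono l [] = z≤n
count-mono {a} {b} l (y ∷ ys) = ℕP.+-mono-≤ less (count-mono l ys)
  where
  less : (if a <ᵇ y then 0 else 1) ≤ (if b <ᵇ y then 0 else 1)
  less with b <ᵇ y in e
  ... | true rewrite <ᵇ-true (ℕP.≤-<-trans l (<ᵇ-true⁻ {b} {y} e)) = z≤n
  ... | false with a <ᵇ y
  ... | true = z≤n
  ... | false = ℕP.≤-refl

count-length : ∀ b R → count≤ b R ≤ length R
count-length b [] = z≤n
count-length b (y ∷ ys) with b <ᵇ y
... | true = ℕP.≤-trans (count-length b ys) (ℕP.n≤1+n _)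
... | false = s≤s (count-length b ys)

-- Inserting a chosen x raises the number of row entries that are at most x, and no insertion lowers
-- any `count≤ b`; so the count grows along the subsequence.
winc-rows : ∀ {lo w k} R → WInc lo w k → count≤ lo R + k ≤ length (rows R w)
winc-rows {lo} {w} R nil = ℕP.≤-trans (ℕP.≤-reflexive (ℕP.+-identityʳ _)) (ℕP.≤-trans (count-length lo R) (grow R w))
  where
  step-length : ∀ x R → length R ≤ length (step x R)
  step-length x [] = z≤n
  step-length x (y ∷ ys) with x <ᵇ y
  ... | true = ℕP.≤-refl
  ... | false = s≤s (step-length x ys)
  grow : ∀ R w → length R ≤ length (rows R w)
  grow R [] = ℕP.≤-refl
  grow R (x ∷ w) = ℕP.≤-trans (step-length x R) (grow (step x R) w)
winc-rows {lo} {x ∷ w} {k} R (skip i) = ℕP.≤-trans (ℕP.+-monoˡ-≤ k (count-step-≥ lo x R)) (winc-rows (step x R) i)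
winc-rows {lo} {x ∷ w} {suc k} R (take l i) = ℕP.≤-trans (ℕP.≤-reflexive (ℕP.+-suc (count≤ lo R) k))
  (ℕP.≤-trans (ℕP.+-monoˡ-≤ k (ℕP.≤-trans (s≤s (count-mono l R)) (count-step-self x R))) (winc-rows (step x R) i))

-- positions count from 1; the 0-th entry is 0 by convention
data Nth : List ℕ → ℕ → ℕ → Set where
  none : ∀ {R} → Nth R 0 0
  top : ∀ {x R} → Nth (x ∷ R) 1 x
  pop : ∀ {x R i lo} → Nth R (suc i) lo → Nth (x ∷ R) (suc (suc i)) lo

nth-step : ∀ x R {i lo} → Nth (step x R) i lo → Nth R i lo ⊎ (lo ≡ x × ∃ λ j → ∃ λ lo' → i ≡ suc j × Nth R j lo' × lo' ≤ x)
nth-step x [] none = inj₁ none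
nth-step x [] top = inj₂ (refl , 0 , 0 , refl , none , z≤n)
nth-step x (y ∷ ys) p with x <ᵇ y in e
nth-step x (y ∷ ys) none | true = inj₁ none
nth-step x (y ∷ ys) none | false = inj₁ none
nth-step x (y ∷ ys) top | true = inj₂ (refl , 0 , 0 , refl , none , z≤n)
nth-step x (y ∷ ys) (pop p) | true = inj₁ (pop p)
nth-step x (y ∷ ys) top | false = inj₁ top
nth-step x (y ∷ ys) (pop p) | false with nth-step x ys p
... | inj₁ q = inj₁ (pop q)
... | inj₂ (e' , zero , lo' , refl , none , l) = inj₂ (e' , 1 , y , refl , top , <ᵇ-false⁻ e)
... | inj₂ (e' , suc j , lo' , refl , q , l) = inj₂ (e' , suc (suc j) , lo' , refl , pop q , l)

-- Traced back from the last entry of the final row: when x was placed, the column to its left held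
-- an entry at most x, which was placed earlier or belonged to R. The entries met in this way form
-- the subsequence.
rows-winc : ∀ R w → ∃ λ i → ∃ λ lo → ∃ λ k → Nth R i lo × WInc lo w k × i + k ≡ length (rows R w)
rows-winc R [] with last R
  where
  last : ∀ R → ∃ λ lo → Nth R (length R) lo
  last [] = 0 , none
  last (x ∷ []) = x , top
  last (x ∷ y ∷ R) with last (y ∷ R)
  ... | lo , p = lo , pop p
... | lo , p = length R , lo , 0 , p , nil , ℕP.+-identityʳ _
rows-winc R (x ∷ w) with rows-winc (step x R) w
... | i , lo , k , p , q , e with nth-step x R p
... | inj₁ p' = i , lo , k , p' , skip q , e
... | inj₂ (refl , j , lo' , refl , p' , l) = j , lo' , suc k , p' , take l q , trans (ℕP.+-suc j k) e

winc-RSK : ∀ {n} (w : Perm n) → WInc 0 (word w) (head₀ (RSK w))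
winc-RSK w with rows-winc [] (word w)
... | _ , _ , k , none , q , e = subst (WInc 0 (word w)) (trans e (sym (head-RSK w))) q

RSK-winc : ∀ {n k} (w : Perm n) → WInc 0 (word w) k → k ≤ head₀ (RSK w)
RSK-winc w i = ℕP.≤-trans (winc-rows [] i) (ℕP.≤-reflexive (sym (head-RSK w)))

-- Masks from subsequences, and ascents of column words

trues-unique : ∀ {A : Set} {m r k} (M : Mask m r k) {v : Vec A k} → Unique v → Unique (trues M v)
trues-unique [] [] = []
trues-unique (tt∷ M) (p ∷ u) = trues-All M p ∷ trues-unique M u
trues-unique (ff∷ M) (p ∷ u) = trues-unique M u

all-false : ∀ k → Mask 0 k k
all-false zero = []
all-false (suc k) = ff∷ all-false k

-- Distinct entries make a weakly increasing subsequence strictly increasing.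
winc-mask : ∀ {n k lo m} (v : Vec (Fin n) k) → Unique v → WInc lo (word v) m →
  ∃ λ r → Σ (Mask m r k) λ M → Inc lo (trues M v)
winc-mask [] _ nil = 0 , [] , []
winc-mask {k = suc k} {lo} (a ∷ v) _ nil = suc k , all-false (suc k) , empty k v
  where empty : ∀ k (v : Vec (Fin _) k) → Inc lo (trues (all-false k) v)
        empty zero [] = []
        empty (suc k) (a ∷ v) = empty k v
winc-mask (a ∷ v) (_ ∷ u) (skip i) with winc-mask v u i
... | r , M , p = suc r , ff∷ M , p
winc-mask (a ∷ v) (a∉ ∷ u) (take l i) with winc-mask v u i
... | r , M , p = r , tt∷ M , l ∷ strict (trues-All M a∉) p
  where
  strict : ∀ {n k} {a : Fin n} {t : Vec (Fin n) k} → All (a ≢_) t → Inc (toℕ a) t → Inc (suc (toℕ a)) t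
  strict [] [] = []
  strict (q ∷ _) (l ∷ p) = ℕP.≤∧≢⇒< l (q ∘ FP.toℕ-injective) ∷ p

nd : List ℕ → ℕ → ℕ
nd (a ∷ b ∷ w) (suc t) = (if b <ᵇ a then 0 else 1) + nd (b ∷ w) t
nd _ _ = 0

nd-zero : ∀ w → nd w 0 ≡ 0
nd-zero [] = refl
nd-zero (a ∷ []) = refl
nd-zero (a ∷ b ∷ w) = refl

nd-suc : ∀ {n k} (v : Vec (Fin n) k) t → suc t < k → nd (word v) (suc t) ≡ nd (word v) t + (if descB t v then 0 else 1)
nd-suc (a ∷ []) t (s≤s ())
nd-suc (a ∷ b ∷ v) zero _ = trans (cong (λ z → (if b <f a then 0 else 1) + z) (nd-zero (word (b ∷ v)))) (ℕP.+-identityʳ _)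
nd-suc (a ∷ b ∷ v) (suc t) (s≤s r) = trans (cong (λ z → (if b <f a then 0 else 1) + z) (nd-suc (b ∷ v) t r)) (sym (ℕP.+-assoc (if b <f a then 0 else 1) _ _))

ascents-nd : ∀ {n} (y : Perm n) t → t < n → ascents y t ≡ nd (word y) t
ascents-nd y zero _ = sym (nd-zero (word y))
ascents-nd y (suc t) r = trans (cong (_+ (if descB t y then 0 else 1)) (ascents-nd y t (ℕP.<⇒≤ r))) (sym (nd-suc y t r))

-- Entries descend inside a column, so ascents occur only where one column meets the next.
nd-columns : ∀ cs t → LA.All Dec↓ cs → 1 ≤ length (concat cs) → suc (nd (concat cs) t) ≤ length cs
nd-columns ([] ∷ cs) t (_ ∷ ds) l = ℕP.≤-trans (nd-columns cs t ds l) (ℕP.n≤1+n _)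
nd-columns ((x ∷ c) ∷ cs) t (d ∷ ds) _ = go x c d t
  where
  go : ∀ x c → Dec↓ (x ∷ c) → ∀ t → suc (nd (x ∷ c ++ concat cs) t) ≤ suc (length cs)
  go x (y ∷ c) ((y<x ∷ _) ∷ d) zero = s≤s z≤n
  go x (y ∷ c) ((y<x ∷ _) ∷ d) (suc t) rewrite <ᵇ-true y<x = go y c d t
  go x [] _ t = s≤s (last (concat cs) refl t)
    where
    last : ∀ w → concat cs ≡ w → ∀ t → nd (x ∷ w) t ≤ length cs
    last [] _ zero = z≤n
    last [] _ (suc t) = z≤n
    last (y ∷ w) _ zero = z≤n
    last (y ∷ w) e (suc t) = ℕP.≤-trans (ℕP.+-monoˡ-≤ (nd (y ∷ w) t) (bit (y <ᵇ x)))
      (subst (λ w → suc (nd w t) ≤ length cs) e (nd-columns cs t ds (subst (λ w → 1 ≤ length w) (sym e) (s≤s z≤n))))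
      where bit : ∀ b → (if b then 0 else 1) ≤ 1
            bit true = z≤n
            bit false = ℕP.≤-refl

-- Knuth moves on permutations

record VecMove {n k} (v : Vec (Fin n) k) (w' : List ℕ) : Set where
  constructor vecMove
  field
    pos : ℕ
    kind : (∃ λ a → ∃ λ b → ∃ λ c → At pos v a c b × toℕ a ≤ toℕ b × toℕ b < toℕ c × word (swapPos pos v) ≡ w')
         ⊎ (∃ λ a → ∃ λ b → ∃ λ c → At pos v b c a × toℕ a < toℕ b × toℕ b ≤ toℕ c × word (swapPos (suc pos) v) ≡ w')

vec-move : ∀ {n k w'} (v : Vec (Fin n) k) → word v ⇝ w' → VecMove v w'
vec-move (x ∷ z ∷ y ∷ v) (acb→cab l l') = vecMove 0 (inj₁ (x , y , z , here , l , l' , refl))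
vec-move (y ∷ z ∷ x ∷ v) (bca→bac l l') = vecMove 0 (inj₂ (x , y , z , here , l , l' , refl))
vec-move (a ∷ v) (_ ∷ s) with vec-move v s
... | vecMove j (inj₁ (x , y , z , p , l , l' , e)) = vecMove (suc j) (inj₁ (x , y , z , there p , l , l' , cong (toℕ a ∷_) e))
... | vecMove j (inj₂ (x , y , z , p , l , l' , e)) = vecMove (suc j) (inj₂ (x , y , z , there p , l , l' , cong (toℕ a ∷_) e))

module _ {n q} (Q : Perm n → Set q)
  (bac : ∀ {j y a b c} → At j y b a c → toℕ a < toℕ b → toℕ b < toℕ c → y ∈ perms n → Q y → Q (swapPos (suc j) y))
  (cab : ∀ {j y a b c} → At j y c a b → toℕ a < toℕ b → toℕ b < toℕ c → y ∈ perms n → Q y → Q (swapPos j y)) where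

  -- The hypotheses `bac` and `cab` undo the moves, so Q travels from the column word back to y.
  transport-moves : ∀ {w w'} (y : Perm n) → y ∈ perms n → word y ≡ w → w ⇝* w' →
    (∀ y' → y' ∈ perms n → word y' ≡ w' → Q y') → Q y
  transport-moves y p e ε h = h y p e
  transport-moves y p refl (s ◅ ss) h with vec-move y s
  ... | vecMove j (inj₁ (a , b , c , t , l , l' , e)) =
        subst Q (swapPos-invol j y) (cab (at-s t) (ℕP.≤∧≢⇒< l (a≢b ∘ FP.toℕ-injective)) l' (swapPos∈ j p) (transport-moves (swapPos j y) (swapPos∈ j p) e ss h))
    where a≢b = proj₁ (proj₂ (at-unique (perms-unique p) t))
  ... | vecMove j (inj₂ (a , b , c , t , l , l' , e)) =
        subst Q (swapPos-invol (suc j) y) (bac (at-t t) l (ℕP.≤∧≢⇒< l' (b≢c ∘ FP.toℕ-injective)) (swapPos∈ (suc j) p) (transport-moves (swapPos (suc j) y) (swapPos∈ (suc j) p) e ss h))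
    where b≢c = proj₁ (at-unique (perms-unique p) t)

  -- The chain through the columns pulls back to an increasing subsequence of y, so there are fewer
  -- than m columns, and the column word has few enough ascents for `base`.
  knuth-reduction : ∀ {m} → 0 < n → (∀ y → y ∈ perms n → (∀ t → t < n → suc (ascents y t) < m) → Q y) →
    ∀ y → y ∈ perms n → head₀ (RSK y) < m → Q y
  knuth-reduction {m} 0<n base y p l = transport-moves y p refl moves λ y' p' e → base y' p' λ t r →
    ℕP.≤-<-trans (subst₂ _≤_ (cong suc (sym (trans (ascents-nd y' t r) (cong (λ w → nd w t) e)))) refl
        (nd-columns columns t all↓ (subst (λ w → 1 ≤ length w) e (ℕP.≤-trans 0<n (ℕP.≤-reflexive (sym (trans (LP.length-map toℕ (V.toList y')) (VP.length-toList y'))))))))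
      (ℕP.≤-<-trans (RSK-winc y (winc-moves moves (chain-winc chain))) l)
    where open ColumnWord (column-word (word y))

-- Selecting entries among the last r positions

drop-append : ∀ {A : Set} {m r} (t : Vec A m) (f : Vec A r) → V.drop m (t V.++ f) ≡ f
drop-append [] f = refl
drop-append (x ∷ t) f = drop-append t f

drop-swapPos : ∀ {A : Set} m {r} j (v : Vec A (m + r)) → suc j < m → V.drop m (swapPos j v) ≡ V.drop m v
drop-swapPos (suc zero) zero v (s≤s ())
drop-swapPos (suc (suc m)) zero (x ∷ y ∷ v) _ = refl
drop-swapPos (suc m) (suc j) (x ∷ v) (s≤s l) = drop-swapPos m j v l

entry-drop : ∀ {n} m {r} (v : Vec (Fin n) (m + r)) p → entry (V.drop m v) p ≡ entry v (m + p)
entry-drop zero v p = refl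
entry-drop (suc m) (x ∷ v) p = entry-drop m v p

entry-lookup : ∀ {n k} (v : Vec (Fin n) k) i → toℕ (lookup v i) ≡ entry v (toℕ i)
entry-lookup (x ∷ v) zero = refl
entry-lookup (x ∷ v) (suc i) = entry-lookup v i

entry-surjective : ∀ {n} {u : Perm n} → u ∈ perms n → ∀ a → ∃ λ p → p < n × entry u p ≡ toℕ a
entry-surjective {n} {u} p a = find u (PP.∈-resp-↭ (↭-sym (perm-↭-id (perms-unique p)))
    (subst (_∈ V.toList (idPerm n)) (VP.lookup-allFin a) (member a (idPerm n))))
  where
  member : ∀ {k} (i : Fin k) (v : Vec (Fin n) k) → lookup v i ∈ V.toList v
  member zero (x ∷ v) = here refl
  member (suc i) (x ∷ v) = there (member i v)
  find : ∀ {k} (v : Vec (Fin n) k) → a ∈ V.toList v → ∃ λ p → p < k × entry v p ≡ toℕ a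
  find (x ∷ v) (here refl) = 0 , s≤s z≤n , refl
  find (x ∷ v) (there q) with find v q
  ... | i , l , e = suc i , s≤s l , e

move-right : ∀ {n} dist {u : Perm n} → u ∈ perms n → ∀ q → q + dist < n →
  ∃ λ u' → u' ∈ perms n × entry u' (q + dist) ≡ entry u q × (∀ p → q + dist < p → entry u' p ≡ entry u p)
move-right zero {u} p q l = u , p , cong (entry u) (ℕP.+-identityʳ q) , λ _ _ → refl
move-right {n} (suc dist) {u} p q l with move-right dist (swapPos∈ q p) (suc q) (subst (_< n) (ℕP.+-suc q dist) l)
... | u' , p' , e , f rewrite ℕP.+-suc q dist = u' , p' , trans e (entry-swapPos-1 q u (ℕP.≤-trans (s≤s (s≤s (ℕP.m≤m+n q dist))) l))
    , λ i li → trans (f i li) (entry-swapPos-fix q u i (λ { refl → ℕP.<⇒≱ li (ℕP.≤-trans (ℕP.m≤m+n q dist) (ℕP.n≤1+n _)) }) (λ { refl → ℕP.<⇒≱ li (s≤s (ℕP.m≤m+n q dist)) }))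

-- Entries of `g` may repeat, so they are only placed somewhere among the last k positions. A value
-- not yet there moves to the place just before the block arranged for the tail.
gather : ∀ {n k} (g : Vec (Fin n) k) → k ≤ n → ∃ λ u → u ∈ perms n × All (λ a → ∃ λ p → n ≤ p + k × p < n × entry u p ≡ toℕ a) g
gather {n} [] _ = idPerm n , id∈ n , []
gather {n} {suc k} (a ∷ g) l with gather g (ℕP.<⇒≤ l)
... | u , pu , h with entry-surjective pu a
... | q , q<n , e with n ℕ.≤? q + suc k
... | yes q≥ = u , pu , (q , q≥ , q<n , e) ∷ VA.map (λ (p , l' , r) → p , ℕP.≤-trans l' (ℕP.+-monoʳ-≤ p (ℕP.n≤1+n k)) , r) h
... | no q≱ with ℕP.m≤n⇒∃[o]m+o≡n (ℕP.≰⇒> q≱)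
... | o , eo = place (move-right (suc o) pu q (ℕP.<-≤-trans (ℕP.m<m+n _ (s≤s z≤n)) (ℕP.≤-reflexive sum≡)))
          where
          sum≡ : q + suc o + suc k ≡ n
          sum≡ = trans (solve 3 (λ q o k → q :+ (con 1 :+ o) :+ (con 1 :+ k) := con 1 :+ (q :+ (con 1 :+ k)) :+ o) refl q o k) eo
            where open import Data.Nat.Solver using (module +-*-Solver)
                  open +-*-Solver
          place : (∃ λ u' → u' ∈ perms n × entry u' (q + suc o) ≡ entry u q × (∀ p → q + suc o < p → entry u' p ≡ entry u p)) →
            ∃ λ u → u ∈ perms n × All (λ a → ∃ λ p → n ≤ p + suc k × p < n × entry u p ≡ toℕ a) (a ∷ g)
          place (u' , pu' , e' , f) = u' , pu' , (q + suc o , ℕP.≤-reflexive (sym sum≡) , ℕP.<-≤-trans (ℕP.m<m+n _ (s≤s z≤n)) (ℕP.≤-reflexive sum≡) , trans e' e)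
            ∷ VA.map (λ (p , l' , p<n , ep) → p , ℕP.≤-trans l' (ℕP.+-monoʳ-≤ p (ℕP.n≤1+n k)) , p<n ,
                trans (f p (ℕP.+-cancelʳ-< k _ _ (ℕP.<-≤-trans (ℕP.≤-reflexive (trans (sym (ℕP.+-suc (q + suc o) k)) sum≡)) l'))) ep) h

module Selection {m r : ℕ} where

  n : ℕ
  n = m + r

  -- κ need not be injective, which is how basis tensors with repeated indices are reached.
  sel : Vec (Fin r) r → Perm n → Vec (Fin n) r
  sel κ z = V.map (lookup (V.drop m z)) κ

  sel-id : ∀ z → sel (idPerm r) z ≡ V.drop m z
  sel-id z = VP.map-lookup-allFin (V.drop m z)

  sel-map : ∀ κ (f : Fin n → Fin n) z → sel κ (V.map f z) ≡ V.map f (sel κ z)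
  sel-map κ f z = trans (cong (λ v → V.map (lookup v) κ) (VP.drop-map f m z))
    (trans (VP.map-cong (λ i → VP.lookup-map i f (V.drop m z)) κ) (VP.map-∘ f (lookup (V.drop m z)) κ))

  sel-swapPos : ∀ κ j z → suc j < m → sel κ (swapPos j z) ≡ sel κ z
  sel-swapPos κ j z l = cong (λ v → V.map (lookup v) κ) (drop-swapPos m j z l)

  sel-surjective : ∀ (g : Vec (Fin n) r) → ∃ λ u → ∃ λ κ → u ∈ perms n × sel κ u ≡ g
  sel-surjective g with gather g (ℕP.m≤n+m r m)
  ... | u , p , h = u , proj₁ (indices h) , p , proj₂ (indices h)
    where
    index : ∀ {a} → (∃ λ q → n ≤ q + r × q < n × entry u q ≡ toℕ a) → ∃ λ i → lookup (V.drop m u) i ≡ a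
    index (q , l , q<n , e) with ℕP.m≤n⇒∃[o]m+o≡n (ℕP.+-cancelʳ-≤ r m q l)
    ... | o , refl = F.fromℕ< o<r , FP.toℕ-injective (trans (entry-lookup (V.drop m u) (F.fromℕ< o<r))
        (trans (cong (entry (V.drop m u)) (FP.toℕ-fromℕ< o<r)) (trans (entry-drop m u o) e)))
      where o<r : o < r
            o<r = ℕP.+-cancelˡ-< m _ _ q<n
    indices : ∀ {k} {g : Vec (Fin n) k} → All (λ a → ∃ λ q → n ≤ q + r × q < n × entry u q ≡ toℕ a) g → ∃ λ (κ : Vec (Fin r) k) → V.map (lookup (V.drop m u)) κ ≡ g
    indices [] = [] , refl
    indices (x ∷ h) with index x | indices h
    ... | i , e | κ , e' = i ∷ κ , cong₂ _∷_ e e'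

  unact : List ℕ → Perm n → Perm n
  unact ω u = List.foldl (λ u j → sL j u) u ω

  act-unact : ∀ ω u → foldr sL (unact ω u) ω ≡ u
  act-unact [] u = refl
  act-unact (j ∷ ω) u = trans (cong (sL j) (act-unact ω (sL j u))) (sL-invol j u)

  act-lookup-redWord : ∀ {w} → w ∈ perms n → ∀ u → V.map (lookup w) (unact (redWord w) u) ≡ u
  act-lookup-redWord {w} p u = trans (cong (λ x → V.map (lookup x) (unact (redWord w) u)) (sym (isProd (redWord-red (perms-unique p)))))
    (trans (sym (act-lookup (redWord w) (unact (redWord w) u))) (act-unact (redWord w) u))

  lookup-injective : ∀ {w} → w ∈ perms n → ∀ {k} {f g : Vec (Fin n) k} → V.map (lookup w) f ≡ V.map (lookup w) g → f ≡ g
  lookup-injective p = map-injective (UP.lookup-injective (perms-unique p) _ _)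

  X : Perm n → Bool
  X x = m ℕ.≤ᵇ head₀ (RSK x)

  default-mask : ∀ m → Mask m r (m + r)
  default-mask zero = all-false r
  default-mask (suc m) = tt∷ default-mask m

  -- Totality again: outside X, and on vectors that are not permutations, the mask is an arbitrary
  -- default.
  mask : ∀ x → Σ (Mask m r n) λ M → x ∈ perms n → X x ≡ true → Inc 0 (trues M x)
  mask x with X x in eq | distinctB x in eq'
  ... | false | _ = default-mask m , λ _ ()
  ... | true | false = default-mask m , λ p → ⊥-elim (false≢true (trans (sym eq') (distinctB-complete (perms-unique p))))
  ... | true | true with winc-mask x (distinctB-sound x eq') (winc-trim m (ℕP.≤ᵇ⇒≤ m _ (Equivalence.from T-≡ eq)) (winc-RSK x))
  ... | r' , M , i with ℕP.+-cancelˡ-≡ m r r' (mask-size M)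
  ... | refl = M , λ _ _ → i

  M[_] : Perm n → Mask m r n
  M[ x ] = proj₁ (mask x)

  module _ {x : Perm n} (px : x ∈ perms n) (xx : X x ≡ true) where

    -- `base` lists the positions, selected ones first, and `ends` the values of x in that order, so
    -- `ends` is x composed with `base`.
    ends base : Vec (Fin n) n
    ends = trues M[ x ] x V.++ falses M[ x ] x
    base = trues M[ x ] (idPerm n) V.++ falses M[ x ] (idPerm n)

    ends∈ : ends ∈ perms n
    ends∈ = unique-perms (split-unique M[ x ] (perms-unique px))

    map-base : ∀ (w : Perm n) → V.map (lookup w) base ≡ trues M[ x ] w V.++ falses M[ x ] w
    map-base w = trans (VP.map-++ (lookup w) (trues M[ x ] (idPerm n)) (falses M[ x ] (idPerm n)))
      (cong₂ V._++_ (trans (trues-map (lookup w) M[ x ] (idPerm n)) (cong (trues M[ x ]) (VP.map-lookup-allFin w)))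
                    (trans (falses-map (lookup w) M[ x ] (idPerm n)) (cong (falses M[ x ]) (VP.map-lookup-allFin w))))

    minimal : ∀ {w} → w ∈ perms n → falses M[ x ] x ≡ falses M[ x ] w → len x ≤ len w × (len w ≤ len x → w ≡ x)
    minimal {w} pw e = min-len M[ x ] x w (perms-unique px) (↭trans (perm-↭-id (perms-unique px)) (↭-sym (perm-↭-id (perms-unique pw)))) e (proj₂ (mask x) px xx)

-- The functionals ψ_x

module DualBasis {c ℓ} {A : CommutativeRing c ℓ} (LA : Laurent A) (m r : ℕ) where
  open Selection {m} {r} public hiding (n)
  n = m + r
  open HeckeTheory LA n m public
  open Solver using (solve; _:+_; _:-_; _:*_; _:=_; con; :-_)

  -- Right symmetric, because S_m permutes the first m positions and leaves the selected entries
  -- alone, while v^{ℓ(z)} supplies the factor v.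
  selected : Vec (Fin r) r → Vec (Fin n) r → HA
  selected κ f z = if does (sel κ z ≟V f) then pw (len z) else 0#

  selected-true : ∀ {κ f z} → sel κ z ≡ f → selected κ f z ≈ pw (len z)
  selected-true {κ} {f} {z} e rewrite dec-true (sel κ z ≟V f) e = ≈refl

  selected-false : ∀ {κ f z} → sel κ z ≢ f → selected κ f z ≈ 0#
  selected-false {κ} {f} {z} e rewrite dec-false (sel κ z ≟V f) e = ≈refl

  selected-right : ∀ κ f → RightSym (selected κ f)
  selected-right κ f j l l' = mk λ u p → op-eigen (swapPos j) (descB j) (selected κ f) u (asc u p) (desc u)
    where
    asc : ∀ u → u ∈ perms n → descB j u ≡ false → selected κ f (swapPos j u) ≈ v ⊛ selected κ f u
    asc u p d rewrite sel-swapPos κ j u l with does (sel κ u ≟V f)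
    ... | true rewrite len-swapPos-asc j (perms-unique p) l' d = ≈refl
    ... | false = ≈sym (zeroʳ _)
    desc : ∀ u → descB j u ≡ true → selected κ f u ≈ v ⊛ selected κ f (swapPos j u)
    desc u d rewrite sel-swapPos κ j u l with does (sel κ u ≟V f)
    ... | true rewrite len-swapPos-desc j u d = ≈refl
    ... | false = ≈sym (zeroʳ _)

  word-zero : ∀ h ω {u} → u ∈ perms n → (∀ ω' z → z ∈ perms n → length ω' ≤ length ω → foldr sL z ω' ≡ u → h z ≈ 0#) → foldr lm h ω u ≈ 0#
  word-zero h [] p f = f [] _ p z≤n refl
  word-zero h (j ∷ ω) {u} p f = begin
    lm j (foldr lm h ω) u ≈⟨ lm-κ j (foldr lm h ω) u ⟩
    foldr lm h ω (sL j u) ⊕ κ (lenB j u) ⊛ foldr lm h ω u ≈⟨ +-cong (word-zero h ω (sL∈ j p) λ ω' z q l e → f (j ∷ ω') z q (s≤s l) (trans (cong (sL j) e) (sL-invol j u)))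
                                                                            (≈trans (*-congˡ (word-zero h ω p λ ω' z q l e → f ω' z q (ℕP.≤-trans l (ℕP.n≤1+n _)) e)) (zeroʳ _)) ⟩
    0# ⊕ 0# ≈⟨ +-identityˡ 0# ⟩
    0# ∎

  -- Each diagonal term ξ drops a letter of the word. If h vanishes wherever a strictly shorter word
  -- leads to u, only the term using all letters contributes.
  word-leading : ∀ h ω {u} → u ∈ perms n → (∀ ω' z → z ∈ perms n → length ω' < length ω → foldr sL z ω' ≡ u → h z ≈ 0#) → foldr lm h ω u ≈ h (unact ω u)
  word-leading h [] p f = ≈refl
  word-leading h (j ∷ ω) {u} p f = begin
    lm j (foldr lm h ω) u ≈⟨ lm-κ j (foldr lm h ω) u ⟩
    foldr lm h ω (sL j u) ⊕ κ (lenB j u) ⊛ foldr lm h ω u ≈⟨ +-cong (word-leading h ω (sL∈ j p) λ ω' z q l e → f (j ∷ ω') z q (s≤s l) (trans (cong (sL j) e) (sL-invol j u)))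
                                                                            (≈trans (*-congˡ (word-zero h ω p λ ω' z q l e → f ω' z q (s≤s l) e)) (zeroʳ _)) ⟩
    h (unact ω (sL j u)) ⊕ 0# ≈⟨ +-identityʳ _ ⟩
    h (unact ω (sL j u)) ∎

  vipw : ℕ → Carrier
  vipw zero = 1#
  vipw (suc k) = vi ⊛ vipw k

  vipw-pw : ∀ k → vipw k ⊛ pw k ≈ 1#
  vipw-pw zero = *-identityˡ 1#
  vipw-pw (suc k) = ≈trans (solve 4 (λ a b c d → (a :* b) :* (c :* d) := a :* (c :* (b :* d))) ≈refl vi (vipw k) v (pw k)) (≈trans (vi-v _) (vipw-pw k))

  corner : Perm n → HA
  corner x = selected (idPerm r) (falses M[ x ] (idPerm n))

  ψ : Perm n → HA
  ψ x w = vipw (len (trues M[ x ] (idPerm n) V.++ falses M[ x ] (idPerm n))) ⊛ W w (corner x) (trues M[ x ] x V.++ falses M[ x ] x)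

  module _ {x : Perm n} (px : x ∈ perms n) (xx : X x ≡ true) where

    private
      d u : Perm n
      d = base px xx
      u = ends px xx
      f = falses M[ x ] (idPerm n)

    ψ-kills : Kills (ψ x)
    ψ-kills a aa = ≈trans (Σ-cong {xs = perms n} λ w _ → solve 3 (λ a c x → a :* (c :* x) := c :* (a :* x)) ≈refl (a w) (vipw (len d)) (W w (corner x) u))
      (≈trans (Σ-*ˡ (perms n) (vipw (len d)) _) (≈trans (*-congˡ (at (Ann-right aa (selected-right (idPerm r) f)) u (ends∈ px xx))) (zeroʳ _)))

    agree : ∀ {w z} → V.map (lookup w) z ≡ u → sel (idPerm r) z ≡ f → falses M[ x ] x ≡ falses M[ x ] w
    agree {w} {z} e s =
      trans (sym (drop-append (trues M[ x ] x) (falses M[ x ] x))) (trans (cong (V.drop m) (sym e))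
        (trans (VP.drop-map (lookup w) m z) (trans (cong (V.map (lookup w)) (trans (sym (sel-id z)) s))
          (trans (falses-map (lookup w) M[ x ] (idPerm n)) (cong (falses M[ x ]) (VP.map-lookup-allFin w))))))

    -- A contributing term with a dropped letter would give a permutation shorter than x that agrees
    -- with it outside the selected positions, against minimality.
    W-leading : ∀ {w} → w ∈ perms n → len w ≤ len x → W w (corner x) u ≈ corner x (unact (redWord w) u)
    W-leading {w} pw l = word-leading (corner x) (redWord w) (ends∈ px xx) λ ω' z pz l' e →
      selected-false λ s → ℕP.<⇒≱ (ℕP.<-≤-trans l' (ℕP.≤-trans (ℕP.≤-reflexive (length≡ (redWord-red (perms-unique pw)))) l))
        (ℕP.≤-trans (proj₁ (minimal px xx (act∈ ω' (id∈ n)) (agree (trans (sym (act-lookup ω' z)) e) s))) (len-prod ω'))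

    ψ-off : ∀ {w} → w ∈ perms n → w ≢ x → len w ≤ len x → ψ x w ≈ 0#
    ψ-off {w} pw w≢x l = ≈trans (*-congˡ (≈trans (W-leading pw l) (selected-false λ s →
      w≢x (proj₂ (minimal px xx pw (agree (act-lookup-redWord pw u) s)) l)))) (zeroʳ _)

    ψ-diag : ψ x x ≈ 1#
    ψ-diag = ≈trans (*-congˡ (≈trans (W-leading px ℕP.≤-refl) (≈trans (selected-true s) (≡⇒≈ (cong (pw ∘ len) z≡d))))) (vipw-pw (len d))
      where
      z≡d : unact (redWord x) u ≡ d
      z≡d = lookup-injective px (trans (act-lookup-redWord px u) (sym (map-base px xx x)))
      s : sel (idPerm r) (unact (redWord x) u) ≡ f
      s = trans (sel-id _) (trans (cong (V.drop m) z≡d) (drop-append (trues M[ x ] (idPerm n)) f))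

  module Theorem (0<m : 0 < m) (C : Perm n → HA) (C-bar : ∀ {w} → w ∈ perms n → β (C w) ≋ C w)
    (C-val : ∀ {w y} → w ∈ perms n → y ∈ perms n → Val 1 (C w y ⊕ ⊖ T' w y)) where

    lift : ∀ {y} → y ∈ perms n → X y ≡ false → Lift y
    lift {y} p xy = knuth-reduction Lift Lift-bac Lift-cab (ℕP.≤-trans 0<m (ℕP.m≤m+n m r))
      (λ y' p' few → C y' , Pigeonhole.annihilates 0<m (ℕP.m≤m+n m r) y' (C y') (λ t d → KL.C-desc C C-bar C-val p' t d) few , λ u q → C-val p' q)
      y p (ℕP.≰⇒> λ l → true≢false (trans (sym (Equivalence.to T-≡ (ℕP.≤⇒≤ᵇ l))) xy))

    open Criterion C C-bar C-val X lift ψ ψ-kills ψ-diag (λ p xx q → ψ-off p xx q) public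

-- The ring of integral Laurent polynomials

record _≅_ (p q : L) : Set where
  constructor wrap
  field un : p ≃ q
open _≅_ public

-- A Laurent polynomial acts on sequences ℤ → ℤ by shifts; its coefficients are the image of δ.

act : List ℤ → (ℤ → ℤ) → ℤ → ℤ
act [] f k = + 0
act (c ∷ cs) f k = c ℤ.* f k ℤ.+ act cs f (k ℤ.- + 1)

δ : ℤ → ℤ
δ (+ zero) = + 1
δ (+ suc _) = + 0
δ (-[1+ _ ]) = + 0

infix 8 _⊙_
_⊙_ : L → (ℤ → ℤ) → ℤ → ℤ
(p ⊙ f) k = act (cs p) f (k ℤ.- low p)

act-cong : ∀ cs {f g} → (∀ k → f k ≡ g k) → ∀ k → act cs f k ≡ act cs g k
act-cong [] h k = refl
act-cong (c ∷ cs) h k = cong₂ (λ x y → c ℤ.* x ℤ.+ y) (h k) (act-cong cs h (k ℤ.- + 1))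

act-addLists : ∀ xs ys f k → act (addLists xs ys) f k ≡ act xs f k ℤ.+ act ys f k
act-addLists [] ys f k = sym (ℤP.+-identityˡ _)
act-addLists (x ∷ xs) [] f k = sym (ℤP.+-identityʳ _)
act-addLists (x ∷ xs) (y ∷ ys) f k = trans (cong (λ z → (x ℤ.+ y) ℤ.* f k ℤ.+ z) (act-addLists xs ys f (k ℤ.- + 1)))
  (lem x y (f k) (act xs f (k ℤ.- + 1)) (act ys f (k ℤ.- + 1)))
  where lem : ∀ x y a b c → (x ℤ.+ y) ℤ.* a ℤ.+ (b ℤ.+ c) ≡ (x ℤ.* a ℤ.+ b) ℤ.+ (y ℤ.* a ℤ.+ c)
        lem = solve-∀

act-map : ∀ c ys f k → act (List.map (c ℤ.*_) ys) f k ≡ c ℤ.* act ys f k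
act-map c [] f k = sym (ℤP.*-zeroʳ c)
act-map c (y ∷ ys) f k = trans (cong (λ z → c ℤ.* y ℤ.* f k ℤ.+ z) (act-map c ys f _)) (lem c y (f k) (act ys f (k ℤ.- + 1)))
  where lem : ∀ c y a b → c ℤ.* y ℤ.* a ℤ.+ c ℤ.* b ≡ c ℤ.* (y ℤ.* a ℤ.+ b)
        lem = solve-∀

act-neg : ∀ ys f k → act (List.map ℤ.-_ ys) f k ≡ ℤ.- act ys f k
act-neg [] f k = refl
act-neg (y ∷ ys) f k = trans (cong (λ z → (ℤ.- y) ℤ.* f k ℤ.+ z) (act-neg ys f _)) (lem y (f k) (act ys f (k ℤ.- + 1)))
  where lem : ∀ y a b → (ℤ.- y) ℤ.* a ℤ.+ (ℤ.- b) ≡ ℤ.- (y ℤ.* a ℤ.+ b)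
        lem = solve-∀

act-shift : ∀ cs f a k → act cs (λ k → f (k ℤ.- a)) k ≡ act cs f (k ℤ.- a)
act-shift [] f a k = refl
act-shift (c ∷ cs) f a k = cong (λ z → c ℤ.* f (k ℤ.- a) ℤ.+ z) (trans (act-shift cs f a (k ℤ.- + 1)) (cong (act cs f) (lem k a)))
  where lem : ∀ k a → k ℤ.- + 1 ℤ.- a ≡ k ℤ.- a ℤ.- + 1
        lem = solve-∀

act-+ : ∀ cs f g k → act cs (λ k → f k ℤ.+ g k) k ≡ act cs f k ℤ.+ act cs g k
act-+ [] f g k = refl
act-+ (c ∷ cs) f g k = trans (cong (λ z → c ℤ.* (f k ℤ.+ g k) ℤ.+ z) (act-+ cs f g _)) (lem c (f k) (g k) (act cs f (k ℤ.- + 1)) (act cs g (k ℤ.- + 1)))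
  where lem : ∀ c a b x y → c ℤ.* (a ℤ.+ b) ℤ.+ (x ℤ.+ y) ≡ (c ℤ.* a ℤ.+ x) ℤ.+ (c ℤ.* b ℤ.+ y)
        lem = solve-∀

act-* : ∀ cs x f k → act cs (λ k → x ℤ.* f k) k ≡ x ℤ.* act cs f k
act-* [] x f k = sym (ℤP.*-zeroʳ x)
act-* (c ∷ cs) x f k = trans (cong (λ z → c ℤ.* (x ℤ.* f k) ℤ.+ z) (act-* cs x f _)) (lem c x (f k) (act cs f (k ℤ.- + 1)))
  where lem : ∀ c x a b → c ℤ.* (x ℤ.* a) ℤ.+ x ℤ.* b ≡ x ℤ.* (c ℤ.* a ℤ.+ b)
        lem = solve-∀

act-0∷ : ∀ cs f k → act (+ 0 ∷ cs) f k ≡ act cs f (k ℤ.- + 1)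
act-0∷ cs f k = trans (cong (ℤ._+ act cs f (k ℤ.- + 1)) (ℤP.*-zeroˡ (f k))) (ℤP.+-identityˡ _)

act-conv : ∀ xs ys f k → act (conv xs ys) f k ≡ act xs (act ys f) k
act-conv [] ys f k = refl
act-conv (x ∷ xs) ys f k = trans (act-addLists (List.map (x ℤ.*_) ys) (+ 0 ∷ conv xs ys) f k)
  (cong₂ ℤ._+_ (act-map x ys f k) (trans (act-0∷ (conv xs ys) f k) (act-conv xs ys f (k ℤ.- + 1))))

-- Polynomials in a single shift operator commute. This gives commutativity of `mulL`, and with it
-- congruence in the left factor, whose representation is not unique.
act-comm : ∀ xs ys f k → act xs (act ys f) k ≡ act ys (act xs f) k
act-comm [] ys f k = sym (zero-act ys k)
  where zero-act : ∀ ys k → act ys (λ _ → + 0) k ≡ + 0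
        zero-act [] k = refl
        zero-act (y ∷ ys) k = trans (cong₂ ℤ._+_ (ℤP.*-zeroʳ y) (zero-act ys _)) refl
act-comm (x ∷ xs) ys f k = sym (trans (act-+ ys (λ k → x ℤ.* f k) (λ k → act xs f (k ℤ.- + 1)) k)
  (cong₂ ℤ._+_ (act-* ys x f k) (trans (act-shift ys (act xs f) (+ 1) k) (sym (act-comm xs ys f (k ℤ.- + 1))))))

act-pad : ∀ m cs f k → act (List.replicate m (+ 0) ++ cs) f k ≡ act cs f (k ℤ.- + m)
act-pad zero cs f k = cong (act cs f) (sym (ℤP.+-identityʳ k))
act-pad (suc m) cs f k = trans (act-0∷ (List.replicate m (+ 0) ++ cs) f k) (trans (act-pad m cs f (k ℤ.- + 1)) (cong (act cs f) (trans (lem k (+ m)) (cong (λ z → k ℤ.- z) (sym (ℤP.pos-+ 1 m))))))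
  where lem : ∀ k m → k ℤ.- + 1 ℤ.- m ≡ k ℤ.- (+ 1 ℤ.+ m)
        lem = solve-∀

co : List ℤ → ℤ → ℤ
co cs (+ j) = lookupOr j cs
co cs (-[1+ _ ]) = + 0

coeff-co : ∀ p k → coeff p k ≡ co (cs p) (k ℤ.- low p)
coeff-co p k with k ℤ.- low p
... | + j = refl
... | -[1+ _ ] = refl

co-act : ∀ cs k → co cs k ≡ act cs δ k
co-act [] (+ zero) = refl
co-act [] (+ suc j) = refl
co-act [] (-[1+ _ ]) = refl
co-act (c ∷ cs) (+ zero) = sym (trans (cong₂ ℤ._+_ (ℤP.*-identityʳ c) (trans (sym (co-act cs (-[1+ 0 ]))) refl)) (ℤP.+-identityʳ c))
co-act (c ∷ cs) (+ suc j) = sym (trans (cong₂ ℤ._+_ (ℤP.*-zeroʳ c) (sym (co-act cs (+ j)))) (ℤP.+-identityˡ _))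
co-act (c ∷ cs) (-[1+ j ]) = sym (trans (cong₂ ℤ._+_ (ℤP.*-zeroʳ c) (sym (co-act cs (-[1+ j ] ℤ.- + 1)))) refl)

coeff-⊙ : ∀ p k → coeff p k ≡ (p ⊙ δ) k
coeff-⊙ p k = trans (coeff-co p k) (co-act (cs p) (k ℤ.- low p))

add-⊙ : ∀ p q f k → (addL p q ⊙ f) k ≡ (p ⊙ f) k ℤ.+ (q ⊙ f) k
add-⊙ p q f k = trans (act-addLists (padded p) (padded q) f (k ℤ.- m)) (cong₂ ℤ._+_ (unpad p (ℤP.i⊓j≤i (low p) (low q))) (unpad q (ℤP.i⊓j≤j (low p) (low q))))
  where
  m = low p ℤ.⊓ low q
  padded : L → List ℤ
  padded r = List.replicate ℤ.∣ low r ℤ.- m ∣ (+ 0) ++ cs r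
  lem : ∀ k m l → k ℤ.- m ℤ.- (l ℤ.- m) ≡ k ℤ.- l
  lem = solve-∀
  unpad : ∀ r → m ℤ.≤ low r → act (padded r) f (k ℤ.- m) ≡ (r ⊙ f) k
  unpad r l = trans (act-pad ℤ.∣ low r ℤ.- m ∣ (cs r) f (k ℤ.- m))
    (cong (act (cs r) f) (trans (cong (λ z → k ℤ.- m ℤ.- z) (ℤP.0≤i⇒+∣i∣≡i (ℤP.i≤j⇒0≤j-i l))) (lem k m (low r))))

mul-⊙ : ∀ p q f k → (mulL p q ⊙ f) k ≡ (p ⊙ (q ⊙ f)) k
mul-⊙ p q f k = trans (act-conv (cs p) (cs q) f (k ℤ.- (low p ℤ.+ low q)))
  (trans (cong (act (cs p) (act (cs q) f)) (lem k (low p) (low q))) (sym (act-shift (cs p) (act (cs q) f) (low q) (k ℤ.- low p))))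
  where lem : ∀ k a b → k ℤ.- (a ℤ.+ b) ≡ k ℤ.- a ℤ.- b
        lem = solve-∀

neg-⊙ : ∀ p f k → (negL p ⊙ f) k ≡ ℤ.- (p ⊙ f) k
neg-⊙ p f k = act-neg (cs p) f (k ℤ.- low p)

comm-⊙ : ∀ p q f k → (p ⊙ (q ⊙ f)) k ≡ (q ⊙ (p ⊙ f)) k
comm-⊙ p q f k = begin
  act (cs p) (λ k → act (cs q) f (k ℤ.- low q)) (k ℤ.- low p) ≡⟨ act-shift (cs p) (act (cs q) f) (low q) (k ℤ.- low p) ⟩
  act (cs p) (act (cs q) f) (k ℤ.- low p ℤ.- low q) ≡⟨ act-comm (cs p) (cs q) f _ ⟩
  act (cs q) (act (cs p) f) (k ℤ.- low p ℤ.- low q) ≡⟨ cong (act (cs q) (act (cs p) f)) (lem k (low p) (low q)) ⟩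
  act (cs q) (act (cs p) f) (k ℤ.- low q ℤ.- low p) ≡⟨ act-shift (cs q) (act (cs p) f) (low p) (k ℤ.- low q) ⟨
  act (cs q) (λ k → act (cs p) f (k ℤ.- low p)) (k ℤ.- low q) ∎
  where open ≡-Reasoning
        lem : ∀ k a b → k ℤ.- a ℤ.- b ≡ k ℤ.- b ℤ.- a
        lem = solve-∀

coeff-add : ∀ p q k → coeff (addL p q) k ≡ coeff p k ℤ.+ coeff q k
coeff-add p q k = trans (coeff-⊙ (addL p q) k) (trans (add-⊙ p q δ k) (sym (cong₂ ℤ._+_ (coeff-⊙ p k) (coeff-⊙ q k))))

coeff-neg : ∀ p k → coeff (negL p) k ≡ ℤ.- coeff p k
coeff-neg p k = trans (coeff-⊙ (negL p) k) (trans (neg-⊙ p δ k) (cong ℤ.-_ (sym (coeff-⊙ p k))))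

⊙-cong : ∀ p {f g} → (∀ k → f k ≡ g k) → ∀ k → (p ⊙ f) k ≡ (p ⊙ g) k
⊙-cong p h k = act-cong (cs p) h (k ℤ.- low p)

coeff-mul : ∀ p q k → coeff (mulL p q) k ≡ (p ⊙ coeff q) k
coeff-mul p q k = trans (coeff-⊙ (mulL p q) k) (trans (mul-⊙ p q δ k) (⊙-cong p (λ k → sym (coeff-⊙ q k)) k))

⊙-+ : ∀ p f g k → (p ⊙ (λ k → f k ℤ.+ g k)) k ≡ (p ⊙ f) k ℤ.+ (p ⊙ g) k
⊙-+ p f g k = act-+ (cs p) f g (k ℤ.- low p)

coeff-zero : ∀ k → coeff zeroL k ≡ + 0
coeff-zero k = coeff-⊙ zeroL k

one-⊙ : ∀ f k → (oneL ⊙ f) k ≡ f k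
one-⊙ f k = trans (ℤP.+-identityʳ _) (trans (ℤP.*-identityˡ _) (cong f (ℤP.+-identityʳ k)))

mulL-comm : ∀ p q → mulL p q ≃ mulL q p
mulL-comm p q k = trans (coeff-⊙ (mulL p q) k) (trans (mul-⊙ p q δ k) (trans (comm-⊙ p q δ k) (sym (trans (coeff-⊙ (mulL q p) k) (mul-⊙ q p δ k)))))

mulL-congʳ : ∀ p {q q'} → q ≃ q' → mulL p q ≃ mulL p q'
mulL-congʳ p {q} {q'} e k = trans (coeff-mul p q k) (trans (⊙-cong p e k) (sym (coeff-mul p q' k)))

mulL-cong : ∀ {p p' q q'} → p ≃ p' → q ≃ q' → mulL p q ≃ mulL p' q'
mulL-cong {p} {p'} {q} {q'} e e' k = trans (mulL-congʳ p {q} {q'} e' k) (trans (mulL-comm p q' k) (trans (mulL-congʳ q' {p} {p'} e k) (mulL-comm q' p' k)))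

mulL-assoc : ∀ p q r → mulL (mulL p q) r ≃ mulL p (mulL q r)
mulL-assoc p q r k = begin
  coeff (mulL (mulL p q) r) k ≡⟨ coeff-mul (mulL p q) r k ⟩
  (mulL p q ⊙ coeff r) k ≡⟨ mul-⊙ p q (coeff r) k ⟩
  (p ⊙ (q ⊙ coeff r)) k ≡⟨ ⊙-cong p (λ k → sym (coeff-mul q r k)) k ⟩
  (p ⊙ coeff (mulL q r)) k ≡⟨ coeff-mul p (mulL q r) k ⟨
  coeff (mulL p (mulL q r)) k ∎
  where open ≡-Reasoning

mulL-oneˡ : ∀ p → mulL oneL p ≃ p
mulL-oneˡ p k = trans (coeff-mul oneL p k) (one-⊙ (coeff p) k)

mulL-distribˡ : ∀ p q r → mulL p (addL q r) ≃ addL (mulL p q) (mulL p r)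
mulL-distribˡ p q r k = begin
  coeff (mulL p (addL q r)) k ≡⟨ coeff-mul p (addL q r) k ⟩
  (p ⊙ coeff (addL q r)) k ≡⟨ ⊙-cong p (coeff-add q r) k ⟩
  (p ⊙ (λ k → coeff q k ℤ.+ coeff r k)) k ≡⟨ ⊙-+ p (coeff q) (coeff r) k ⟩
  (p ⊙ coeff q) k ℤ.+ (p ⊙ coeff r) k ≡⟨ cong₂ ℤ._+_ (coeff-mul p q k) (coeff-mul p r k) ⟨
  coeff (mulL p q) k ℤ.+ coeff (mulL p r) k ≡⟨ coeff-add (mulL p q) (mulL p r) k ⟨
  coeff (addL (mulL p q) (mulL p r)) k ∎
  where open ≡-Reasoning

L-ring : CommutativeRing _ _
L-ring = record
  { Carrier = L ; _≈_ = _≅_ ; _+_ = addL ; _*_ = mulL ; -_ = negL ; 0# = zeroL ; 1# = oneL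
  ; isCommutativeRing = record
    { isRing = record
      { +-isAbelianGroup = record
        { isGroup = record
          { isMonoid = record
            { isSemigroup = record
              { isMagma = record
                { isEquivalence = record { refl = wrap λ _ → refl ; sym = λ e → wrap λ k → sym (un e k) ; trans = λ e e' → wrap λ k → trans (un e k) (un e' k) }
                ; ∙-cong = λ {p} {p'} {q} {q'} e e' → wrap λ k → trans (coeff-add p q k) (trans (cong₂ ℤ._+_ (un e k) (un e' k)) (sym (coeff-add p' q' k))) }
              ; assoc = λ p q r → wrap λ k → trans (coeff-add (addL p q) r k) (trans (cong (ℤ._+ coeff r k) (coeff-add p q k))
                  (trans (ℤP.+-assoc (coeff p k) (coeff q k) (coeff r k)) (sym (trans (coeff-add p (addL q r) k) (cong (λ z → coeff p k ℤ.+ z) (coeff-add q r k)))))) }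
            ; identity = (λ p → wrap λ k → trans (coeff-add zeroL p k) (trans (cong (ℤ._+ coeff p k) (coeff-zero k)) (ℤP.+-identityˡ _)))
                       , (λ p → wrap λ k → trans (coeff-add p zeroL k) (trans (cong (λ z → coeff p k ℤ.+ z) (coeff-zero k)) (ℤP.+-identityʳ _))) }
          ; inverse = (λ p → wrap λ k → trans (coeff-add (negL p) p k) (trans (cong (ℤ._+ coeff p k) (coeff-neg p k)) (trans (ℤP.+-inverseˡ (coeff p k)) (sym (coeff-zero k)))))
                    , (λ p → wrap λ k → trans (coeff-add p (negL p) k) (trans (cong (λ z → coeff p k ℤ.+ z) (coeff-neg p k)) (trans (ℤP.+-inverseʳ (coeff p k)) (sym (coeff-zero k)))))
          ; ⁻¹-cong = λ {p} {q} e → wrap λ k → trans (coeff-neg p k) (trans (cong ℤ.-_ (un e k)) (sym (coeff-neg q k))) }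
        ; comm = λ p q → wrap λ k → trans (coeff-add p q k) (trans (ℤP.+-comm (coeff p k) (coeff q k)) (sym (coeff-add q p k))) }
      ; *-cong = λ {p} {p'} {q} {q'} e e' → wrap (mulL-cong {p} {p'} {q} {q'} (un e) (un e'))
      ; *-assoc = λ p q r → wrap (mulL-assoc p q r)
      ; *-identity = (λ p → wrap (mulL-oneˡ p)) , (λ p → wrap λ k → trans (mulL-comm p oneL k) (mulL-oneˡ p k))
      ; distrib = (λ p q r → wrap (mulL-distribˡ p q r))
                , (λ p q r → wrap λ k → trans (mulL-comm (addL q r) p k) (trans (mulL-distribˡ p q r k)
                    (trans (coeff-add (mulL p q) (mulL p r) k) (trans (cong₂ ℤ._+_ (mulL-comm p q k) (mulL-comm p r k)) (sym (coeff-add (mulL q p) (mulL r p) k)))))) }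
    ; *-comm = λ p q → wrap (mulL-comm p q) } }

act-∷ʳ : ∀ xs c f k → act (xs ++ c ∷ []) f k ≡ act xs f k ℤ.+ c ℤ.* f (k ℤ.- + length xs)
act-∷ʳ [] c f k = trans (ℤP.+-identityʳ _) (sym (trans (ℤP.+-identityˡ _) (cong (λ z → c ℤ.* f z) (ℤP.+-identityʳ k))))
act-∷ʳ (x ∷ xs) c f k = trans (cong (λ z → x ℤ.* f k ℤ.+ z) (act-∷ʳ xs c f (k ℤ.- + 1)))
  (trans (sym (ℤP.+-assoc (x ℤ.* f k) _ _)) (cong (λ z → x ℤ.* f k ℤ.+ act xs f (k ℤ.- + 1) ℤ.+ c ℤ.* f z) (trans (lem k (+ length xs)) (cong (λ z → k ℤ.- z) (sym (ℤP.pos-+ 1 (length xs)))))))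
  where lem : ∀ k m → k ℤ.- + 1 ℤ.- m ≡ k ℤ.- (+ 1 ℤ.+ m)
        lem = solve-∀

act-reverse : ∀ cs f k → act (List.reverse cs) f k ≡ act cs (f ∘ ℤ.-_) (+ length cs ℤ.- + 1 ℤ.- k)
act-reverse [] f k = refl
act-reverse (c ∷ cs) f k rewrite LP.unfold-reverse c cs = begin
  act (List.reverse cs ++ c ∷ []) f k ≡⟨ act-∷ʳ (List.reverse cs) c f k ⟩
  act (List.reverse cs) f k ℤ.+ c ℤ.* f (k ℤ.- + length (List.reverse cs)) ≡⟨ ℤP.+-comm (act (List.reverse cs) f k) _ ⟩
  c ℤ.* f (k ℤ.- + length (List.reverse cs)) ℤ.+ act (List.reverse cs) f k ≡⟨ cong₂ ℤ._+_ (cong (λ z → c ℤ.* f z) (trans (cong (λ l → k ℤ.- + l) (LP.length-reverse cs)) (trans (lem₁ k (+ length cs)) (cong (λ l → ℤ.- (l ℤ.- + 1 ℤ.- k)) (sym (ℤP.pos-+ 1 (length cs)))))))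
                                                                                                         (trans (act-reverse cs f k) (cong (act cs (f ∘ ℤ.-_)) (trans (lem₂ k (+ length cs)) (cong (λ l → l ℤ.- + 1 ℤ.- k ℤ.- + 1) (sym (ℤP.pos-+ 1 (length cs))))))) ⟩
  c ℤ.* f (ℤ.- (+ suc (length cs) ℤ.- + 1 ℤ.- k)) ℤ.+ act cs (f ∘ ℤ.-_) (+ suc (length cs) ℤ.- + 1 ℤ.- k ℤ.- + 1) ∎
  where
  open ≡-Reasoning
  lem₁ : ∀ k l → k ℤ.- l ≡ ℤ.- ((+ 1 ℤ.+ l) ℤ.- + 1 ℤ.- k)
  lem₁ = solve-∀
  lem₂ : ∀ k l → l ℤ.- + 1 ℤ.- k ≡ (+ 1 ℤ.+ l) ℤ.- + 1 ℤ.- k ℤ.- + 1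
  lem₂ = solve-∀

bar-⊙ : ∀ p f k → (barL p ⊙ f) k ≡ (p ⊙ (f ∘ ℤ.-_)) (ℤ.- k)
bar-⊙ p f k = trans (act-reverse (cs p) f _) (cong (act (cs p) (f ∘ ℤ.-_)) (lem k (low p) (+ length (cs p))))
  where lem : ∀ k a l → l ℤ.- + 1 ℤ.- (k ℤ.- (ℤ.- (a ℤ.+ (l ℤ.- + 1)))) ≡ ℤ.- k ℤ.- a
        lem = solve-∀

δ-even : ∀ k → δ (ℤ.- k) ≡ δ k
δ-even (+ zero) = refl
δ-even (+ suc j) = refl
δ-even (-[1+ j ]) = refl

coeff-bar : ∀ p k → coeff (barL p) k ≡ coeff p (ℤ.- k)
coeff-bar p k = trans (coeff-⊙ (barL p) k) (trans (bar-⊙ p δ k) (trans (⊙-cong p δ-even (ℤ.- k)) (sym (coeff-⊙ p (ℤ.- k)))))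

ValL : ℕ → L → Set
ValL k p = ∀ j → j ℤ.< + k → coeff p j ≡ + 0

lookup-coeff : ∀ p i → lookupOr i (cs p) ≡ coeff p (low p ℤ.+ + i)
lookup-coeff p i = sym (trans (coeff-co p (low p ℤ.+ + i)) (cong (co (cs p)) (lem (low p) (+ i))))
  where lem : ∀ a b → a ℤ.+ b ℤ.- a ≡ b
        lem = solve-∀

act-zero : ∀ cs f k → (∀ i → lookupOr i cs ≡ + 0 ⊎ f (k ℤ.- + i) ≡ + 0) → act cs f k ≡ + 0
act-zero [] f k h = refl
act-zero (c ∷ cs) f k h = trans (cong₂ ℤ._+_ (first (h 0)) (act-zero cs f (k ℤ.- + 1) λ i → map₂ (λ e → trans (cong f (trans (lem k (+ i)) (cong (λ z → k ℤ.- z) (sym (ℤP.pos-+ 1 i))))) e) (h (suc i)))) refl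
  where
  open import Data.Sum using (map₂)
  lem : ∀ k m → k ℤ.- + 1 ℤ.- m ≡ k ℤ.- (+ 1 ℤ.+ m)
  lem = solve-∀
  first : c ≡ + 0 ⊎ f (k ℤ.- + 0) ≡ + 0 → c ℤ.* f k ≡ + 0
  first (inj₁ refl) = refl
  first (inj₂ e) = trans (cong (λ z → c ℤ.* z) (trans (cong f (sym (ℤP.+-identityʳ k))) e)) (ℤP.*-zeroʳ c)

<-sum : ∀ {j a k l i} → a ℤ.≤ l ℤ.+ i → j ℤ.< a ℤ.+ k → j ℤ.- l ℤ.- i ℤ.< k
<-sum {j} {a} {k} {l} {i} p q = subst₂ ℤ._<_ refl (lem a k)
  (ℤP.<-≤-trans (subst₂ ℤ._<_ (lem' j l i) refl (ℤP.+-monoˡ-< (ℤ.- (l ℤ.+ i)) q)) (ℤP.+-monoʳ-≤ (a ℤ.+ k) (ℤP.neg-mono-≤ p)))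
  where lem : ∀ a k → a ℤ.+ k ℤ.- a ≡ k
        lem = solve-∀
        lem' : ∀ j l i → j ℤ.- (l ℤ.+ i) ≡ j ℤ.- l ℤ.- i
        lem' = solve-∀

-- In each term of the product, either the exponent taken from p is below a or the remaining one is
-- below b.
ValL-* : ∀ {a b p q} → ValL a p → ValL b q → ValL (a + b) (mulL p q)
ValL-* {a} {b} {p} {q} vp vq j l = trans (coeff-mul p q j) (act-zero (cs p) (coeff q) (j ℤ.- low p) term)
  where
  term : ∀ i → lookupOr i (cs p) ≡ + 0 ⊎ coeff q (j ℤ.- low p ℤ.- + i) ≡ + 0
  term i with (low p ℤ.+ + i) ℤP.<? + a
  ... | yes r = inj₁ (trans (lookup-coeff p i) (vp _ r))
  ... | no r = inj₂ (vq _ (<-sum {j} {+ a} {+ b} {low p} {+ i} (ℤP.≮⇒≥ r) (subst (j ℤ.<_) (ℤP.pos-+ a b) l)))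

ValL-bound : ∀ p → ∃ λ d → ∀ {k q} → ValL (d + k) q → ValL k (mulL p q)
ValL-bound p = ℤ.∣ low p ∣ , λ {k} {q} vq j l → trans (coeff-mul p q j) (act-zero (cs p) (coeff q) (j ℤ.- low p) λ i →
  inj₂ (vq _ (<-sum {j} {ℤ.- + ℤ.∣ low p ∣} {+ (ℤ.∣ low p ∣ + k)} {low p} {+ i}
    (ℤP.≤-trans (-∣i∣≤i (low p)) (ℤP.≤-trans (ℤP.≤-reflexive (sym (ℤP.+-identityʳ (low p)))) (ℤP.+-monoʳ-≤ (low p) (ℤ.+≤+ z≤n))))
    (subst (j ℤ.<_) (trans (lem (+ ℤ.∣ low p ∣) (+ k)) (cong (λ z → ℤ.- + ℤ.∣ low p ∣ ℤ.+ z) (sym (ℤP.pos-+ ℤ.∣ low p ∣ k)))) l))))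
  where
  lem : ∀ d k → k ≡ ℤ.- d ℤ.+ (d ℤ.+ k)
  lem = solve-∀
  -∣i∣≤i : ∀ i → ℤ.- + ℤ.∣ i ∣ ℤ.≤ i
  -∣i∣≤i (+ zero) = ℤP.≤-refl
  -∣i∣≤i (+ suc i) = ℤ.-≤+
  -∣i∣≤i (-[1+ i ]) = ℤP.≤-refl

L-laurent : Laurent L-ring
L-laurent = record
  { v = vL ; vi = vinvL ; v*vi = wrap λ k → refl
  ; bar = barL
  ; bar-cong = λ {p} {q} e → wrap λ k → trans (coeff-bar p k) (trans (un e (ℤ.- k)) (sym (coeff-bar q k)))
  ; bar-+ = λ p q → wrap λ k → trans (coeff-bar (addL p q) k) (trans (coeff-add p q (ℤ.- k)) (trans (cong₂ ℤ._+_ (sym (coeff-bar p k)) (sym (coeff-bar q k))) (sym (coeff-add (barL p) (barL q) k))))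
  ; bar-* = λ p q → wrap λ k → trans (coeff-bar (mulL p q) k) (trans (coeff-mul p q (ℤ.- k)) (trans (⊙-cong p (λ k → sym (trans (coeff-bar q (ℤ.- k)) (cong (coeff q) (ℤP.neg-involutive k)))) (ℤ.- k))
      (trans (sym (bar-⊙ p (coeff (barL q)) k)) (sym (coeff-mul (barL p) (barL q) k)))))
  ; bar-1 = wrap λ k → refl
  ; bar-v = wrap λ k → refl
  ; bar-invol = λ p → wrap λ k → trans (coeff-bar (barL p) k) (trans (coeff-bar p (ℤ.- k)) (cong (coeff p) (ℤP.neg-involutive k)))
  ; Val = ValL
  ; Val-cong = λ e h j l → trans (sym (un e j)) (h j l)
  ; Val-0 = λ k j _ → coeff-zero j
  ; Val-1 = val1
  ; Val-v = valv
  ; Val-+ = λ {k} {p} {q} hp hq j l → trans (coeff-add p q j) (cong₂ ℤ._+_ (hp j l) (hq j l))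
  ; Val-neg = λ {k} {p} hp j l → trans (coeff-neg p j) (cong ℤ.-_ (hp j l))
  ; Val-* = λ {a} {b} {p} {q} → ValL-* {a} {b} {p} {q}
  ; Val-pred = λ h j l → h j (ℤP.<-trans l (ℤ.+<+ ℕP.≤-refl))
  ; Val-bound = ValL-bound
  ; Val-sep = λ {p} h → wrap λ k → trans (h (suc ℤ.∣ k ∣) k (small k)) (sym (coeff-zero k))
  ; Val-bar = λ {p} h e → wrap λ k → trans (vanish p h (un e) k) (sym (coeff-zero k)) }
  where
  val1 : ValL 0 oneL
  val1 (+ j) (ℤ.+<+ ())
  val1 (-[1+ j ]) _ = refl
  valv : ValL 1 vL
  valv (+ zero) _ = refl
  valv (+ suc j) (ℤ.+<+ (s≤s ()))
  valv (-[1+ j ]) _ = refl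
  small : ∀ k → k ℤ.< + suc ℤ.∣ k ∣
  small (+ k) = ℤ.+<+ ℕP.≤-refl
  small (-[1+ k ]) = ℤ.-<+
  -- Coefficients at nonpositive exponents vanish by the valuation; the others are their mirror
  -- images.
  vanish : ∀ p → ValL 1 p → barL p ≃ p → ∀ k → coeff p k ≡ + 0
  vanish p h e (+ zero) = h (+ 0) (ℤ.+<+ (s≤s z≤n))
  vanish p h e (-[1+ j ]) = h (-[1+ j ]) ℤ.-<+
  vanish p h e (+ suc j) = trans (sym (e (+ suc j))) (trans (coeff-bar p (+ suc j)) (h (-[1+ j ]) ℤ.-<+))

-- Specialisation at v = 1

ev1-add : ∀ p q → ev1 (addL p q) ≡ ev1 p ℤ.+ ev1 q
ev1-add p q = trans (sum-addLists (List.replicate ℤ.∣ low p ℤ.- m ∣ (+ 0) ++ cs p) _) (cong₂ ℤ._+_ (pad ℤ.∣ low p ℤ.- m ∣ (cs p)) (pad ℤ.∣ low q ℤ.- m ∣ (cs q)))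
  where
  m = low p ℤ.⊓ low q
  sum-addLists : ∀ xs ys → foldr ℤ._+_ (+ 0) (addLists xs ys) ≡ foldr ℤ._+_ (+ 0) xs ℤ.+ foldr ℤ._+_ (+ 0) ys
  sum-addLists [] ys = sym (ℤP.+-identityˡ _)
  sum-addLists (x ∷ xs) [] = sym (ℤP.+-identityʳ _)
  sum-addLists (x ∷ xs) (y ∷ ys) = trans (cong (λ z → x ℤ.+ y ℤ.+ z) (sum-addLists xs ys)) (lem x y _ _)
    where lem : ∀ x y a b → x ℤ.+ y ℤ.+ (a ℤ.+ b) ≡ (x ℤ.+ a) ℤ.+ (y ℤ.+ b)
          lem = solve-∀
  pad : ∀ k xs → foldr ℤ._+_ (+ 0) (List.replicate k (+ 0) ++ xs) ≡ foldr ℤ._+_ (+ 0) xs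
  pad zero xs = refl
  pad (suc k) xs = trans (ℤP.+-identityˡ _) (pad k xs)

-- Evaluation at v = 1 is the action on the constant sequence 1, which shifts fix; multiplicativity
-- of `ev1` then comes from `act-conv`.
act-ones : ∀ cs k → act cs (λ _ → + 1) k ≡ foldr ℤ._+_ (+ 0) cs
act-ones [] k = refl
act-ones (c ∷ cs) k = cong₂ ℤ._+_ (ℤP.*-identityʳ c) (act-ones cs _)

act-const : ∀ cs x k → act cs (λ _ → x) k ≡ foldr ℤ._+_ (+ 0) cs ℤ.* x
act-const cs x k = trans (act-cong cs (λ _ → sym (ℤP.*-identityʳ x)) k) (trans (act-* cs x (λ _ → + 1) k) (trans (cong (x ℤ.*_) (act-ones cs k)) (ℤP.*-comm x _)))

ev1-mul : ∀ p q → ev1 (mulL p q) ≡ ev1 p ℤ.* ev1 q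
ev1-mul p q = trans (sym (act-ones (conv (cs p) (cs q)) (+ 0))) (trans (act-conv (cs p) (cs q) _ (+ 0))
  (trans (act-cong (cs p) (act-ones (cs q)) (+ 0)) (act-const (cs p) (ev1 q) (+ 0))))

ev1-neg : ∀ p → ev1 (negL p) ≡ ℤ.- ev1 p
ev1-neg p = trans (sym (act-ones (List.map ℤ.-_ (cs p)) (+ 0))) (trans (act-neg (cs p) _ (+ 0)) (cong ℤ.-_ (act-ones (cs p) (+ 0))))

ev1-zero : ∀ p → p ≃ zeroL → ev1 p ≡ + 0
ev1-zero p e = sum-zero (cs p) λ i → trans (lookup-coeff p i) (trans (e (low p ℤ.+ + i)) (coeff-zero (low p ℤ.+ + i)))
  where
  sum-zero : ∀ cs → (∀ i → lookupOr i cs ≡ + 0) → foldr ℤ._+_ (+ 0) cs ≡ + 0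
  sum-zero [] _ = refl
  sum-zero (c ∷ cs) h = trans (cong₂ ℤ._+_ (h 0) (sum-zero cs (h ∘ suc))) refl

ev1-cong : ∀ {p q} → p ≅ q → ev1 p ≡ ev1 q
ev1-cong {p} {q} e = ℤP.i-j≡0⇒i≡j (ev1 p) (ev1 q) (trans (cong (λ z → ev1 p ℤ.+ z) (sym (ev1-neg q))) (trans (sym (ev1-add p (negL q)))
  (ev1-zero (addL p (negL q)) λ k → trans (coeff-add p (negL q) k) (trans (cong₂ ℤ._+_ (un e k) (coeff-neg q k)) (trans (ℤP.+-inverseʳ (coeff q k)) (sym (coeff-zero k)))))))

sumH-Σ : ∀ {n} {Y : Set} (xs : List Y) (F : Y → H n) u → sumH (List.map F xs) u ≡ RingKit.Σ[_] L-ring xs (λ x → F x u)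
sumH-Σ [] F u = refl
sumH-Σ (x ∷ xs) F u = cong (addL (F x u)) (sumH-Σ xs F u)

-- n = m + r, so that α(n,r) = (m, 1^r)
module OverLaurent (m r : ℕ) (0<m : 0 < m) (C : Perm (m + r) → H (m + r)) (kl : IsKL C) where

  module B = DualBasis L-laurent m r
  open B using (_≋_; mk; at; _∙_; β; Ann; Σ[_]; ≡⇒≈; ≈trans; ≈sym; _∙≋_; ≋sym)

  n = m + r

  mulH-∙ : ∀ a g → mulH a g ≋ a ∙ g
  mulH-∙ a g = mk λ u _ → ≡⇒≈ (sumH-Σ (perms n) (λ w → scaleH (a w) (Tw⋆ w g)) u)

  combH-Σ : ∀ (c : Perm n → L) b u → combH c b u ≡ Σ[ perms n ] (λ w → mulL (c w) (b w u))
  combH-Σ c b u = sumH-Σ (perms n) (λ x → scaleH (c x) (b x)) u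

  vpow-pw : ∀ k → vpow k ≅ B.pw k
  vpow-pw zero = wrap λ _ → refl
  vpow-pw (suc k) = ≈trans {vpow (suc k)} {mulL vL (vpow k)} (wrap λ _ → refl) (B.*-congˡ {vL} (vpow-pw k))

  xα-x' : xα n r ≋ B.x'
  xα-x' = mk λ u p → subst (λ k → xs k u ≅ B.x' u) (sym (ℕP.m+n∸n≡m m r)) (go u p)
    where
    term : Perm n → H n
    term w = scaleH (vpow (len w)) (T w)
    xs : ℕ → H n
    xs k = sumH (List.map term (filterᵇ (fixesFromB k 0) (perms n)))
    go : ∀ u → u ∈ perms n → xs m u ≅ B.x' u
    go u p = ≈trans (≡⇒≈ (sumH-Σ (filterᵇ (fixesFromB m 0) (perms n)) term u))
      (≈trans (B.Σ-filterᵇ (fixesFromB m 0) (perms n) (λ w → term w u))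
        (≈trans (B.Σ-perms-single p _ other) self))
      where
      other : ∀ w → w ∈ perms n → w ≢ u → (if fixesFromB m 0 w then term w u else zeroL) ≅ zeroL
      other w _ w≢u with fixesFromB m 0 w
      ... | true = ≈trans (B.*-congˡ {vpow (len w)} (B.T'-other {w} {u} (w≢u ∘ sym))) (B.zeroʳ (vpow (len w)))
      ... | false = B.≈refl
      self : (if fixesFromB m 0 u then term u u else zeroL) ≅ B.x' u
      self with fixesFromB m 0 u
      ... | true = ≈trans (B.*-congˡ {vpow (len u)} (B.T'-self u)) (≈trans (B.*-identityʳ (vpow (len u))) (vpow-pw (len u)))
      ... | false = B.≈refl

  product : ∀ a h → mulH a (mulH h (xα n r)) ≋ a ∙ (h ∙ B.x')
  product a h = mulH-∙ a (mulH h (xα n r)) ∙≋ B.cong-op (B.∙-linʳ a) (mulH-∙ h (xα n r) ∙≋ B.cong-op (B.∙-linʳ h) xα-x')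

  AnnM⇒Ann : ∀ {a} → AnnM n r a → Ann a
  AnnM⇒Ann {a} aa h = ≋sym (product a h) ∙≋ mk λ u p → wrap (aa h u p)

  Ann⇒AnnM : ∀ {a} → Ann a → AnnM n r a
  Ann⇒AnnM {a} aa h u p = un (at (product a h ∙≋ aa h) u p)

  C-bar : ∀ {w} → w ∈ perms n → β (C w) ≋ C w
  C-bar {w} p = B.β-formula (C w) ∙≋ mk λ u q → ≈trans (≡⇒≈ (sym (sumH-Σ (perms n) (λ w' → scaleH (barL (C w w')) (TinvInv w')) u))) (wrap (proj₁ (kl w p) u q))

  C-val : ∀ {w y} → w ∈ perms n → y ∈ perms n → ValL 1 (addL (C w y) (negL (T w y)))
  C-val {w} {y} p q (+ zero) _ = proj₂ (kl w p) y q (+ 0) ℤP.≤-refl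
  C-val {w} {y} p q (+ suc j) (ℤ.+<+ (s≤s ()))
  C-val {w} {y} p q (-[1+ j ]) _ = proj₂ (kl w p) y q (-[1+ j ]) ℤ.-≤+

  open B.Theorem 0<m C C-bar C-val public using (module K; module Vanishing; module CTri; Ann-expansion; C-triangular-off)
  open B public using (X; M[_]; agree; minimal; sel; sel-map; sel-surjective; unact; act-lookup-redWord; selected; selected-right; lookup-injective)

  dominates-X : ∀ x → RSK x ⊵ α n r → X x ≡ true
  dominates-X x d = Equivalence.to T-≡ (ℕP.≤⇒≤ᵇ (subst (_≤ head₀ (RSK x)) (ℕP.m+n∸n≡m m r) (dominates⇒ n r x d)))

  X-dominates : ∀ x → X x ≡ true → RSK x ⊵ α n r
  X-dominates x e = dominates⇐ n r x (ℕP.m<n+m r 0<m) (subst (_≤ head₀ (RSK x)) (sym (ℕP.m+n∸n≡m m r)) (ℕP.≤ᵇ⇒≤ m (head₀ (RSK x)) (Equivalence.from T-≡ e)))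

  not-dominates : ∀ x → ¬ (RSK x ⊵ α n r) → X x ≡ false
  not-dominates x h with X x in e
  ... | false = refl
  ... | true = ⊥-elim (h (X-dominates x e))

  Ann-C : ∀ {x} → x ∈ perms n → X x ≡ false → Ann (C x)
  Ann-C p e = Vanishing.Ann-C p e

  partB : PartB n r C
  partB = (λ x p h → Ann⇒AnnM {C x} (Ann-C p (not-dominates x h)))
        , (λ c _ e x p → un (CTri.independent c (λ u q → ≈trans (≡⇒≈ (sym (combH-Σ c C u))) (wrap (e u q))) x p))
        , λ a aa → let (k , zeros , e) = Ann-expansion (AnnM⇒Ann {a} aa) in
            k , (λ x p d → un (zeros x p (dominates-X x d))) , λ u p → un (≈trans (e u p) (≡⇒≈ (sym (combH-Σ k C u))))

  -- Specialisation to the group ring and the tensor power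

  module Specialised {c ℓ} (𝕜 : CommutativeRing c ℓ) where
    module S = RingKit 𝕜
    open OverRing 𝕜 using (KW; Tensor; actT; coordT; sumK; combK; spec; AnnV; PartA)
    open S using (_≈_; _⊕_; _⊛_; ⊖_; 0#; 1#; Carrier; ιℤ; +-cong; +-congˡ; +-congʳ; *-cong; *-congˡ; *-congʳ; zeroˡ; zeroʳ) renaming (Σ[_] to Σ𝕜[_]; ≈trans to _then_; ≈sym to flip; ≡⇒≈ to same)

    φ : L → Carrier
    φ p = ιℤ (ev1 p)

    φ-cong : ∀ {p q} → p ≅ q → φ p ≈ φ q
    φ-cong e = same (cong ιℤ (ev1-cong e))

    φ-+ : ∀ p q → φ (addL p q) ≈ φ p ⊕ φ q
    φ-+ p q = same (cong ιℤ (ev1-add p q)) then S.ιℤ-+ (ev1 p) (ev1 q)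

    φ-* : ∀ p q → φ (mulL p q) ≈ φ p ⊛ φ q
    φ-* p q = same (cong ιℤ (ev1-mul p q)) then S.ιℤ-* (ev1 p) (ev1 q)

    φ-Σ : ∀ {Y : Set} (xs : List Y) f → φ (Σ[ xs ] f) ≈ Σ𝕜[ xs ] (φ ∘ f)
    φ-Σ [] f = S.≈refl
    φ-Σ (x ∷ xs) f = φ-+ (f x) (Σ[ xs ] f) then +-congˡ (φ-Σ xs f)

    φ-pw : ∀ k → φ (B.pw k) ≈ 1#
    φ-pw zero = S.ιℤ-1
    φ-pw (suc k) = φ-* vL (B.pw k) then (*-cong S.ιℤ-1 (φ-pw k) then S.*-identityˡ 1#)

    -- At v = 1 the factor ξ vanishes and left multiplication merely permutes arguments.
    φ-word : ∀ h ω u → φ (foldr B.lm h ω u) ≈ φ (h (unact ω u))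
    φ-word h [] u = S.≈refl
    φ-word h (j ∷ ω) u = φ-+ (foldr B.lm h ω (sL j u)) (if lenB j u then mulL vmv (foldr B.lm h ω u) else zeroL)
      then ((+-cong (φ-word h ω (sL j u)) (vanish (lenB j u))) then S.+-identityʳ _)
      where
      vanish : ∀ b → φ (if b then mulL vmv (foldr B.lm h ω u) else zeroL) ≈ 0#
      vanish true = φ-* vmv (foldr B.lm h ω u) then zeroˡ _
      vanish false = S.≈refl

    ind : ∀ {k} → Vec (Fin n) k → Vec (Fin n) k → Carrier
    ind f g = if does (f ≟V g) then 1# else 0#

    ind-yes : ∀ {k} {f g : Vec (Fin n) k} → f ≡ g → ind f g ≈ 1#
    ind-yes {f = f} {g} e rewrite dec-true (f ≟V g) e = S.≈refl

    ind-no : ∀ {k} {f g : Vec (Fin n) k} → f ≢ g → ind f g ≈ 0#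
    ind-no {f = f} {g} e rewrite dec-false (f ≟V g) e = S.≈refl

    -- Matrix coefficient on V^{⊗r}: the coefficient of the basis tensor g in a applied to the basis
    -- tensor f.
    entryV : KW n → Vec (Fin n) r → Vec (Fin n) r → Carrier
    entryV a f g = Σ𝕜[ perms n ] (λ w → a w ⊛ ind (V.map (lookup w) f) g)

    coord-++ : ∀ (x y : Tensor n r) g → coordT (x ++ y) g ≈ coordT x g ⊕ coordT y g
    coord-++ [] y g = flip (S.+-identityˡ _)
    coord-++ ((k , f) ∷ x) y g = +-congˡ (coord-++ x y g) then flip (S.+-assoc _ _ _)

    coord-map : ∀ (a : KW n) k (f g : Vec (Fin n) r) ws → coordT (List.map (λ w → (a w ⊛ k , V.map (lookup w) f)) ws) g ≈ Σ𝕜[ ws ] (λ w → a w ⊛ ind (V.map (lookup w) f) g) ⊛ k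
    coord-map a k f g [] = flip (zeroˡ k)
    coord-map a k f g (w ∷ ws) = +-cong term (coord-map a k f g ws) then flip (S.distribʳ k _ _)
      where
      term : (if does (V.map (lookup w) f ≟V g) then a w ⊛ k else 0#) ≈ a w ⊛ ind (V.map (lookup w) f) g ⊛ k
      term with does (V.map (lookup w) f ≟V g)
      ... | true = *-congʳ (flip (S.*-identityʳ (a w)))
      ... | false = flip (*-congʳ (zeroʳ (a w)) then zeroˡ k)

    entryV⇒AnnV : ∀ a → (∀ f g → entryV a f g ≈ 0#) → AnnV n r a
    entryV⇒AnnV a h [] g = S.≈refl
    entryV⇒AnnV a h ((k , f) ∷ x) g = coord-++ (List.map (λ w → (a w ⊛ k , V.map (lookup w) f)) (perms n)) (actT a x) g
      then ((+-cong (coord-map a k f g (perms n) then (*-congʳ (h f g) then zeroˡ k)) (entryV⇒AnnV a h x g)) then S.+-identityˡ 0#)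

    AnnV⇒entryV : ∀ a → AnnV n r a → ∀ f g → entryV a f g ≈ 0#
    AnnV⇒entryV a h f g = flip (S.*-identityʳ _) then (flip (coord-map a 1# f g (perms n)) then (flip (S.+-identityʳ _)
      then (flip (coord-++ (List.map (λ w → (a w ⊛ 1# , V.map (lookup w) f)) (perms n)) [] g) then h ((1# , f) ∷ []) g)))

    -- At v = 1 the matrix coefficients of the right ideal generated by the right-symmetric
    -- functions include those of V^{⊗r}.
    Ann⇒entryV : ∀ a → Ann a → ∀ f g → entryV (spec a) f g ≈ 0#
    Ann⇒entryV a aa f g with sel-surjective g
    ... | u , κ , pu , refl = S.Σ-cong {xs = perms n} (λ w p → *-congˡ (flip (leading w p)) then flip (φ-* (a w) (B.W w (selected κ f) u)))
        then (flip (φ-Σ (perms n) (λ w → mulL (a w) (B.W w (selected κ f) u))) then φ-cong (at (B.Ann-right {a} aa {selected κ f} (selected-right κ f)) u pu))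
      where
      leading : ∀ w → w ∈ perms n → φ (B.W w (selected κ f) u) ≈ ind (V.map (lookup w) f) (sel κ u)
      leading w p = φ-word (selected κ f) (redWord w) u then value
        where
        z = unact (redWord w) u
        wz : V.map (lookup w) (sel κ z) ≡ sel κ u
        wz = trans (sym (sel-map κ (lookup w) z)) (cong (sel κ) (act-lookup-redWord p u))
        value : φ (selected κ f z) ≈ ind (V.map (lookup w) f) (sel κ u)
        value with sel κ z ≟V f
        ... | yes e = φ-pw (len z) then flip (ind-yes (trans (cong (V.map (lookup w)) (sym e)) wz))
        ... | no e = flip (ind-no λ e' → e (lookup-injective p (trans wz (sym e'))))

    entryV-Σ : ∀ (k : Perm n → Carrier) (F : Perm n → KW n) f g →
      entryV (λ u → Σ𝕜[ perms n ] (λ w → k w ⊛ F w u)) f g ≈ Σ𝕜[ perms n ] (λ w → k w ⊛ entryV (F w) f g)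
    entryV-Σ k F f g =
      S.Σ-cong {xs = perms n} (λ u _ → flip (S.Σ-*ʳ (perms n) (ind (V.map (lookup u) f) g) (λ w → k w ⊛ F w u)))
      then (S.Σ-swap (perms n) (perms n) (λ u w → k w ⊛ F w u ⊛ ind (V.map (lookup u) f) g)
      then S.Σ-cong {xs = perms n} (λ w _ → S.Σ-cong {xs = perms n} (λ u _ → S.*-assoc _ _ _) then S.Σ-*ˡ (perms n) (k w) _))

    D : Perm n → KW n
    D w = spec (C w)

    D-diag : ∀ {u} → u ∈ perms n → D u u ≈ 1#
    D-diag p = φ-cong (K.C-diag p) then S.ιℤ-1

    D-off : ∀ {w u} → w ∈ perms n → u ∈ perms n → w ≢ u → len w ≤ len u → D w u ≈ 0#
    D-off p q w≢u l = φ-cong (C-triangular-off p q w≢u l)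

    N : ℕ
    N = suc (tri n)

    module DTri = S.Triangular N len (λ p → s≤s (len-≤-tri p)) D D-diag D-off

    combK-Σ : ∀ (k : Perm n → Carrier) (b : Perm n → KW n) u → combK k b u ≡ Σ𝕜[ perms n ] (λ w → k w ⊛ b w u)
    combK-Σ k b u = go (perms n)
      where go : ∀ xs → sumK (List.map (λ x w → k x ⊛ b x w) xs) u ≡ Σ𝕜[ xs ] (λ w → k w ⊛ b w u)
            go [] = refl
            go (x ∷ xs) = cong (k x ⊛ b x u ⊕_) (go xs)

    D-entryV : ∀ {w} → w ∈ perms n → X w ≡ false → ∀ f g → entryV (D w) f g ≈ 0#
    D-entryV {w} p e = Ann⇒entryV (C w) (Ann-C p e)

    -- The sum of the coefficients of a over all w that agree with x outside the selected positions,
    -- here as a matrix coefficient.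
    corner : Perm n → KW n → Carrier
    corner x a = entryV a (falses M[ x ] (idPerm n)) (falses M[ x ] x)

    -- Another z no longer than x disagrees with x outside the selection by minimality; a longer z
    -- is longer than w, and C_w has no term there.
    corner-D : ∀ {x w} → x ∈ perms n → X x ≡ true → w ∈ perms n → len w ≤ len x → corner x (D w) ≈ D w x
    corner-D {x} {w} px xx pw l = S.Σ-perms-single px _ other
      then (*-congˡ (ind-yes (moved x)) then S.*-identityʳ (D w x))
      where
      moved : ∀ z → V.map (lookup z) (falses M[ x ] (idPerm n)) ≡ falses M[ x ] z
      moved z = trans (falses-map (lookup z) M[ x ] (idPerm n)) (cong (falses M[ x ]) (VP.map-lookup-allFin z))
      other : ∀ z → z ∈ perms n → z ≢ x → D w z ⊛ ind (V.map (lookup z) (falses M[ x ] (idPerm n))) (falses M[ x ] x) ≈ 0#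
      other z pz z≢x with len z ℕ.≤? len x
      ... | yes l' = *-congˡ (ind-no (λ e → z≢x (proj₂ (minimal px xx pz (trans (sym e) (moved z))) l'))) then zeroʳ (D w z)
      ... | no l' = *-congʳ (D-off pw pz (λ { refl → l' l }) (ℕP.≤-trans l (ℕP.<⇒≤ (ℕP.≰⇒> l')))) then zeroˡ _

    -- Completed by the identity as before. Over 𝕜 there is neither bar nor valuation, but
    -- independence of this system suffices, because the C_w with w outside X are known to
    -- annihilate by specialisation.
    δX : Perm n → Perm n → Carrier
    δX w u = if X w ∧ X u then corner u (D w) else ind w u

    δX-eq : ∀ {w u b b'} → X w ≡ b → X u ≡ b' → δX w u ≈ (if b ∧ b' then corner u (D w) else ind w u)
    δX-eq {w} {u} e e' = same (cong₂ (λ b b' → if b ∧ b' then corner u (D w) else ind w u) e e')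

    δX-diag : ∀ {u} → u ∈ perms n → δX u u ≈ 1#
    δX-diag {u} p = go (X u) refl
      where
      go : ∀ b → X u ≡ b → δX u u ≈ 1#
      go true e = δX-eq {u} {u} e e then (corner-D p e p ℕP.≤-refl then D-diag p)
      go false e = δX-eq {u} {u} e e then ind-yes {f = u} refl

    δX-off : ∀ {w u} → w ∈ perms n → u ∈ perms n → w ≢ u → len w ≤ len u → δX w u ≈ 0#
    δX-off {w} {u} pw pu w≢u l = go (X w) (X u) refl refl
      where
      go : ∀ b b' → X w ≡ b → X u ≡ b' → δX w u ≈ 0#
      go true true e e' = δX-eq {w} {u} e e' then (corner-D pu e' pw l then D-off pw pu w≢u l)
      go true false e e' = δX-eq {w} {u} e e' then ind-no w≢u
      go false b' e e' = δX-eq {w} {u} e e' then ind-no w≢u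

    module XTri = S.Triangular N len (λ p → s≤s (len-≤-tri p)) δX δX-diag δX-off

    -- The corner functionals kill a and all specialised C_w with w outside X, so the coefficients
    -- of a in X solve a homogeneous unitriangular system.
    module Spanning (a : KW n) (aa : AnnV n r a) (k : Perm n → Carrier)
      (expansion : ∀ u → u ∈ perms n → Σ𝕜[ perms n ] (λ w → k w ⊛ D w u) ≈ a u) where

      k' : Perm n → Carrier
      k' w = if X w then k w else 0#

      k'-eq : ∀ w {b} → X w ≡ b → k' w ≈ (if b then k w else 0#)
      k'-eq w e = same (cong (λ b → if b then k w else 0#) e)

      corner-sum : ∀ u → Σ𝕜[ perms n ] (λ w → k w ⊛ corner u (D w)) ≈ 0#
      corner-sum u = flip (entryV-Σ k D f g) then (S.Σ-cong {xs = perms n} {λ w → Σ𝕜[ perms n ] (λ z → k z ⊛ D z w) ⊛ ind (V.map (lookup w) f) g}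
          {λ w → a w ⊛ ind (V.map (lookup w) f) g} (λ w p → *-congʳ (expansion w p)) then AnnV⇒entryV a aa f g)
        where
        f g : Vec (Fin n) r
        f = falses M[ u ] (idPerm n)
        g = falses M[ u ] u

      term-X : ∀ {u} → X u ≡ true → ∀ w → w ∈ perms n → ∀ b → X w ≡ b → k' w ⊛ δX w u ≈ k w ⊛ corner u (D w)
      term-X {u} e w p true e' = *-cong (k'-eq w e') (δX-eq {w} {u} e' e)
      term-X {u} e w p false e' = (*-congʳ (k'-eq w e') then zeroˡ (δX w u))
        then flip (*-congˡ (D-entryV p e' (falses M[ u ] (idPerm n)) (falses M[ u ] u)) then zeroʳ (k w))

      term-Y : ∀ {u} → X u ≡ false → ∀ w b → X w ≡ b → k' w ⊛ δX w u ≈ 0#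
      term-Y {u} e w true e' = *-cong (k'-eq w e') (δX-eq {w} {u} e' e then ind-no {f = w} {u} λ { refl → true≢false (trans (sym e') e) }) then zeroʳ (k w)
      term-Y {u} e w false e' = *-congʳ (k'-eq w e') then zeroˡ (δX w u)

      system : ∀ u → u ∈ perms n → ∀ b → X u ≡ b → Σ𝕜[ perms n ] (λ w → k' w ⊛ δX w u) ≈ 0#
      system u pu true e = S.Σ-cong {xs = perms n} {λ w → k' w ⊛ δX w u} {λ w → k w ⊛ corner u (D w)} (λ w p → term-X {u} e w p (X w) refl) then corner-sum u
      system u pu false e = S.Σ-0 {xs = perms n} {λ w → k' w ⊛ δX w u} λ w p → term-Y {u} e w (X w) refl

      vanishing : ∀ x → x ∈ perms n → X x ≡ true → k x ≈ 0#
      vanishing x p xx = flip (k'-eq x xx) then XTri.independent k' (λ u pu → system u pu (X u) refl) x p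

    spanning : ∀ a → AnnV n r a → ∃ λ (k : Perm n → Carrier) → (∀ x → x ∈ perms n → X x ≡ true → k x ≈ 0#)
      × (∀ u → u ∈ perms n → a u ≈ Σ𝕜[ perms n ] (λ w → k w ⊛ D w u))
    spanning a aa = proj₁ solution , Spanning.vanishing a aa (proj₁ solution) (proj₂ solution) , λ u p → flip (proj₂ solution u p)
      where
      solution : ∃ λ (k : Perm n → Carrier) → ∀ u → u ∈ perms n → Σ𝕜[ perms n ] (λ w → k w ⊛ D w u) ≈ a u
      solution = DTri.solvable a

    partA : PartA n r C
    partA = (λ x p h → entryV⇒AnnV (D x) (D-entryV p (not-dominates x h)))
          , (λ k _ e x p → DTri.independent k (λ u q → flip (same (combK-Σ k D u)) then e u q) x p)
          , λ a aa → let (k , zeros , e) = spanning a aa in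
              k , (λ x p d → zeros x p (dominates-X x d)) , λ u p → e u p then flip (same (combK-Σ k D u))

-- With n a literal sum m + r, splitting off the last r positions needs no transport along
-- equations.
theorem2-split : ∀ {c ℓ} (𝕜 : CommutativeRing c ℓ) (m r : ℕ) {n} → n ≡ m + r → 0 < m →
    (C : Perm n → H n) → IsKL C → OverRing.PartA 𝕜 n r C × PartB n r C
theorem2-split 𝕜 m r refl 0<m C kl = OverLaurent.Specialised.partA m r 0<m C kl 𝕜 , OverLaurent.partB m r 0<m C kl

theorem2 : ∀ {c ℓ} (𝕜 : CommutativeRing c ℓ) (n r : ℕ) → 1 ≤ r → r + 1 < n →
    (C : Perm n → H n) → IsKL C →
    OverRing.PartA 𝕜 n r C × PartB n r C
theorem2 𝕜 n r _ r+1<n = theorem2-split 𝕜 (n ∸ r) r (sym (ℕP.m∸n+n≡m (ℕP.<⇒≤ r<n))) (ℕP.m<n⇒0<n∸m r<n)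
  where
  r<n : r < n
  r<n = ℕP.≤-<-trans (ℕP.m≤m+n r 1) r+1<n
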